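{- Every connected component of $\Lambda^{\mathrm{bal}}_{>0}$ is of the form $B(\zeta,p^k)$ for some $k\in\mathbb{Z}_{\ge 0}$ and some $\zeta\in p^k\Lambda^{\mathrm{bal}}_{\mathrm{odd}}$.
   Context: Let $p$ be a prime, $\mathbb{F}=\mathbb{F}_p$, $S=\mathbb{F}[x,y]$, $\mathrm{Der}_S = S\partial_x\oplus S\partial_y$. Let $\mathcal{A}=\{H_1,H_2,H_3\}$ with $H_1=\ker x$, $H_2=\ker y$, $H_3=\ker(x+y)$, $\alpha_1=x,\alpha_2=y,\alpha_3=x+y$. For $\mu=(\mu_1,\mu_2,\mu_3)\in\Lambda\coloneqq\mathbb{Z}_{\ge0}^3$, $D(\mathcal{A},\mu)=\{\theta\in\mathrm{Der}_S:\theta(\alpha_i)\in\alpha_i^{\mu_i}S,\ i=1,2,3\}$; it is free of rank 2 with a homogeneous basis whose degrees (the exponents) are unique up to order and sum to $|\mu|=\mu_1+\mu_2+\mu_3$; $\Delta(\mu)$ denotes the absolute difference of the two exponents. $\mu$ is balanced if $\mu_i\le|\mu|/2$ for all $i$; $\Lambda^{\mathrm{bal}}$ is the set of balanced elements, $\Lambda_{>0}=\{\mu:\Delta(\mu)>0\}$, $\Lambda^{\mathrm{bal}}_{>0}=\Lambda^{\mathrm{bal}}\cap\Lambda_{>0}$, $\Lambda^{\mathrm{bal}}_{\mathrm{odd}}=\{\mu\in\Lambda^{\mathrm{bal}}:|\mu|\text{ odd}\}$, $p^k\Lambda^{\mathrm{bal}}_{\mathrm{odd}}=\{p^k\nu:\nu\in\Lambda^{\mathrm{bal}}_{\mathrm{odd}}\}$.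 Two elements $\mu,\nu\in\Lambda$ are adjacent if $\mu-\nu=\pm\mathbf{e}_i$ for some $i$; connected components of $\Lambda_{>0}$ are the equivalence classes of the equivalence relation on $\Lambda_{>0}$ generated by adjacency, and the connected components of $\Lambda^{\mathrm{bal}}_{>0}$ are those connected components of $\Lambda_{>0}$ contained in $\Lambda^{\mathrm{bal}}$ (it is known that $\Lambda^{\mathrm{bal}}_{>0}$ is a union of such components). $B(\zeta,r)=\{\mu\in\Lambda:|\mu-\zeta|<r\}$. -}

module Defs where

open import Data.Nat using (ℕ; zero; suc; _+_; _*_; _^_; _≤_; _<_; ∣_-_∣; _≟_)
open import Data.Nat.Divisibility using (_∣_)
open import Data.Bool using (if_then_else_; _∧_)
open import Data.List using (List; []; _∷_; _++_; map; concatMap; foldr)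
open import Data.Product using (Σ; _×_; _,_; ∃; ∃-syntax)
open import Data.Sum using (_⊎_)
open import Relation.Nullary using (¬_)
open import Relation.Nullary.Decidable using (⌊_⌋)
open import Relation.Binary.PropositionalEquality using (_≡_)
open import Relation.Binary.Construct.Closure.ReflexiveTransitive using (Star)

-- Polynomials in S = F_p[x,y].
-- A polynomial is a finite formal sum of terms  c · x^i y^j,  a term being
-- the triple (c , i , j) with c ∈ ℕ read modulo p.  Two polynomials are
-- equal in F_p[x,y] iff all their coefficients agree modulo p.

Poly : Set
Poly = List (ℕ × ℕ × ℕ)

coeff : Poly → ℕ → ℕ → ℕ
coeff []              i j = 0
coeff ((c , a , b) ∷ f) i j =
  (if ⌊ a ≟ i ⌋ ∧ ⌊ b ≟ j ⌋ then c else 0) + coeff f i j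

_≡[_]_ : ℕ → ℕ → ℕ → Set
a ≡[ p ] b = p ∣ ∣ a - b ∣

PolyEq : ℕ → Poly → Poly → Set
PolyEq p f g = ∀ i j → coeff f i j ≡[ p ] coeff g i j

0ₚ 1ₚ xₚ yₚ : Poly
0ₚ = []
1ₚ = (1 , 0 , 0) ∷ []
xₚ = (1 , 1 , 0) ∷ []
yₚ = (1 , 0 , 1) ∷ []

_⊕_ : Poly → Poly → Poly
f ⊕ g = f ++ g

_⊗_ : Poly → Poly → Poly
f ⊗ g = concatMap (λ { (c , a , b) → map (λ { (d , a' , b') → (c * d , a + a' , b + b') }) g }) f

x+yₚ : Poly
x+yₚ = xₚ ⊕ yₚ

_^ₚ_ : Poly → ℕ → Poly
f ^ₚ zero  = 1ₚ
f ^ₚ suc n = f ⊗ (f ^ₚ n)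

InIdeal : ℕ → Poly → Poly → Set
InIdeal p f g = ∃[ h ] PolyEq p f (g ⊗ h)

-- f is homogeneous of degree d (the zero polynomial is homogeneous of every degree)
Homog : ℕ → ℕ → Poly → Set
Homog p d f = ∀ i j → ¬ (i + j ≡ d) → coeff f i j ≡[ p ] 0

-- Derivations  θ = f ∂x + g ∂y ∈ Der_S, represented by (f , g) = (θ(x) , θ(y)).

Der : Set
Der = Poly × Poly

DerEq : ℕ → Der → Der → Set
DerEq p (f , g) (f' , g') = PolyEq p f f' × PolyEq p g g'

lin : Poly → Der → Poly → Der → Der
lin a (f₁ , g₁) b (f₂ , g₂) = ((a ⊗ f₁) ⊕ (b ⊗ f₂)) , ((a ⊗ g₁) ⊕ (b ⊗ g₂))

Mult : Set
Mult = ℕ × ℕ × ℕ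

-- θ ∈ D(A, μ) for A = {ker x, ker y, ker (x+y)} over F_p
InD : ℕ → Mult → Der → Set
InD p (m₁ , m₂ , m₃) (f , g) =
  InIdeal p f (xₚ ^ₚ m₁) × InIdeal p g (yₚ ^ₚ m₂) × InIdeal p (f ⊕ g) (x+yₚ ^ₚ m₃)

HomogDer : ℕ → ℕ → Der → Set
HomogDer p d (f , g) = Homog p d f × Homog p d g

IsBasis : ℕ → Mult → Der → Der → Set
IsBasis p μ θ₁ θ₂ =
  InD p μ θ₁ × InD p μ θ₂ ×
  (∀ θ → InD p μ θ → ∃[ a ] ∃[ b ] DerEq p θ (lin a θ₁ b θ₂)) ×
  (∀ a b → DerEq p (lin a θ₁ b θ₂) (0ₚ , 0ₚ) → PolyEq p a 0ₚ × PolyEq p b 0ₚ)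

IsExponents : ℕ → Mult → ℕ → ℕ → Set
IsExponents p μ d₁ d₂ =
  ∃[ θ₁ ] ∃[ θ₂ ] HomogDer p d₁ θ₁ × HomogDer p d₂ θ₂ × IsBasis p μ θ₁ θ₂

PosΔ : ℕ → Mult → Set
PosΔ p μ = ∃[ d₁ ] ∃[ d₂ ] IsExponents p μ d₁ d₂ × ¬ (d₁ ≡ d₂)

∣_∣ₘ : Mult → ℕ
∣ (a , b , c) ∣ₘ = a + b + c

Balanced : Mult → Set
Balanced μ@(a , b , c) = (2 * a ≤ ∣ μ ∣ₘ) × (2 * b ≤ ∣ μ ∣ₘ) × (2 * c ≤ ∣ μ ∣ₘ)

Odd : ℕ → Set
Odd n = ∃[ k ] n ≡ suc (2 * k)

BalOdd : Mult → Set
BalOdd μ = Balanced μ × Odd ∣ μ ∣ₘ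

scale : ℕ → Mult → Mult
scale n (a , b , c) = (n * a , n * b , n * c)

data Step : Mult → Mult → Set where
  step₁ : ∀ {a b c} → Step (a , b , c) (suc a , b , c)
  step₂ : ∀ {a b c} → Step (a , b , c) (a , suc b , c)
  step₃ : ∀ {a b c} → Step (a , b , c) (a , b , suc c)

Adjacent : Mult → Mult → Set
Adjacent μ ν = Step μ ν ⊎ Step ν μ

AdjPos : ℕ → Mult → Mult → Set
AdjPos p μ ν = Adjacent μ ν × PosΔ p μ × PosΔ p ν

-- for μ ∈ Λ_{>0}: ν lies in the connected component of μ in Λ_{>0}
SameComponent : ℕ → Mult → Mult → Set
SameComponent p = Star (AdjPos p)

dist : Mult → Mult → ℕ
dist (a , b , c) (a' , b' , c') = ∣ a - a' ∣ + ∣ b - b' ∣ + ∣ c - c' ∣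

InBall : Mult → ℕ → Mult → Set
InBall ζ r μ = dist μ ζ < r

{-# OPTIONS --safe #-}
-- Since the exponents sum to |μ|, Δ(μ) > 0 holds iff D(A, μ) has a nonzero homogeneous element θ with 2 deg θ < |μ|.
-- Climb inside the component of μ: if θ also lies in D(A, μ + eᵢ), move to μ + eᵢ; if αᵢ divides θ, move to μ - eᵢ and
-- divide. Balancedness bounds the climb, and it stops at a peak ζ, where every derivation proportional to θ is a
-- multiple of θ. With δ = |ζ| - 2 deg θ, the multiples of θ by products of the forms show Δ > 0 on B(ζ, δ). At distance
-- exactly δ such a multiple has degree |μ|/2, so a lower element would be proportional to it by Saito's determinant,
-- hence a multiple of it, which is absurd. So the component is B(ζ, δ).
-- If δ ≥ 2, the Wronskians det(θ, ∂θ) have degree too small for the monomial dividing them, so they vanish and ∂θ is a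
-- multiple of θ of smaller degree, that is, 0. Thus θ is the Frobenius image of a θ′, which is a peak at ζ / p with
-- δ / p in place of δ. Iterating down to δ = 1 gives δ = p^k and ζ = p^k ν with |ν| odd.
module Submission where

import Algebra.Definitions.RawSemiring
open import Algebra.Bundles using (CommutativeRing; RawRing; module Semiring)
open import Level using (0ℓ)
open import Data.Bool using (if_then_else_; true; false; _∧_)
open import Data.Empty using (⊥; ⊥-elim)
open import Data.Fin using (Fin)
import Data.Fin.Properties as Fin
open import Data.Fin.Patterns using (0F; 1F; 2F)
open import Data.List using ([]; _∷_; _++_; concatMap)
import Data.List.Properties as List
open import Data.Maybe using (Maybe; just; nothing)
open import Data.Nat as ℕ using (ℕ; zero; suc; _≤_; _<_; _∸_; z≤n; s≤s; NonZero; ∣_-_∣)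
open import Data.Nat.Coprimality using (coprime-Bézout)
import Data.Nat.Divisibility as ℕ
import Data.Nat.DivMod as ℕ
open import Data.Nat.GCD using (module Bézout)
open import Data.Nat.Primality
  using (Prime; prime⇒nonZero; prime⇒nonTrivial; prime⇒irreducible; euclidsLemma)
import Data.Nat.Properties as ℕ
open import Data.Nat.Solver using (module +-*-Solver)
open import Data.Product using (_×_; _,_; ∃-syntax; proj₁; proj₂)
open import Data.Sum as Sum using (_⊎_; inj₁; inj₂)
open import Defs using (Mult; ∣_∣ₘ; Balanced; Adjacent; Step; step₁; step₂; step₃; dist; scale; Odd)
open import Function using (_∘_)
open import Relation.Binary.Construct.Closure.ReflexiveTransitive as Star using (Star; ε; _◅_; _◅◅_)
open import Relation.Binary.Definitions using (tri<; tri≈; tri>)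
open import Relation.Binary.PropositionalEquality as ≡ using (_≡_; _≢_)
open import Relation.Nullary using (¬_; Dec; yes; no)
open import Relation.Nullary.Decidable using (⌊_⌋; _×-dec_)

-- Replacing bases by single elements rests on one existence result: raising a multiplicity by 1
-- turns a basis into a basis and raises one exponent by 1. It is proved on the line where a form
-- vanishes, on which every homogeneous polynomial is a constant times a power of one linear form.
-- The same restriction decides divisibility by a form, so factorization in S enters only through
-- the three forms. Saturation of a peak follows this pattern: the product of the powers of the
-- forms prescribed by ζ carries every derivation into D(A, ζ), where it expands in a basis, so only
-- common factors of θ among the three forms have to be excluded. The climb ends because 3 deg θ -
-- |μ| drops at every move while balancedness keeps it nonnegative. The threshold δ = 2 is exactly
-- what the Wronskian allows: ∂x kills y and ∂y kills x, so differentiation costs two factors of the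
-- monomial rather than three, and 2 deg θ - 1 < |ζ| - 2 means δ ≥ 2. The multiplicities of θ′ are
-- read off as orders of its values along the forms, because Frobenius multiplies these orders by p.

-- The library solvers cancel terms only when equality of coefficients is decidable, so the coefficients here are
-- integers, encoded as differences m − n of naturals.
module Solver (R : CommutativeRing 0ℓ 0ℓ) where
  open CommutativeRing R
  open import Algebra.Properties.Ring ring using (-‿distribˡ-*; -‿distribʳ-*)
  open import Algebra.Properties.AbelianGroup +-abelianGroup using (⁻¹-∙-comm; ⁻¹-involutive; ε⁻¹≈ε)
  open import Algebra.Properties.Monoid.Mult +-monoid using (×-homo-+)
  open import Algebra.Properties.Semiring.Mult semiring using (×1-homo-*)
  open import Algebra.Definitions.RawMonoid +-rawMonoid using () renaming (_×_ to _⨯_)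
  open import Algebra.Properties.CommutativeSemigroup +-commutativeSemigroup using (interchange)
  open import Algebra.Solver.Ring.AlmostCommutativeRing using (fromCommutativeRing; _-Raw-AlmostCommutative⟶_)
  open import Relation.Binary.Reasoning.Setoid setoid

  private
    reduce : ℕ × ℕ → ℕ × ℕ
    reduce (a , b) = a ∸ b , b ∸ a

    add multiply : ℕ × ℕ → ℕ × ℕ → ℕ × ℕ
    add      (a , b) (c , d) = a ℕ.+ c , b ℕ.+ d
    multiply (a , b) (c , d) = a ℕ.* c ℕ.+ b ℕ.* d , a ℕ.* d ℕ.+ b ℕ.* c

    coefficients : RawRing 0ℓ 0ℓ
    coefficients = record
      { Carrier = ℕ × ℕ
      ; _≈_     = _≡_
      ; _+_     = λ x y → reduce (add x y)
      ; _*_     = λ x y → reduce (multiply x y)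
      ; -_      = λ { (a , b) → b , a }
      ; 0#      = 0 , 0
      ; 1#      = 1 , 0
      }

    module C = RawRing coefficients

    difference : ℕ × ℕ → Carrier
    difference (a , b) = a ⨯ 1# + - (b ⨯ 1#)

    -- The first two clauses make the constants 0 and 1 of a solver expression denote 0# and 1# definitionally.
    ⟦_⟧ᶜ : ℕ × ℕ → Carrier
    ⟦ 0 , 0 ⟧ᶜ = 0#
    ⟦ 1 , 0 ⟧ᶜ = 1#
    ⟦ x     ⟧ᶜ = difference x

    ⟦⟧ᶜ≈difference : ∀ x → ⟦ x ⟧ᶜ ≈ difference x
    ⟦⟧ᶜ≈difference (0 , 0) = sym (-‿inverseʳ 0#)
    ⟦⟧ᶜ≈difference (1 , 0) = sym (trans (+-congˡ ε⁻¹≈ε) (trans (+-identityʳ _) (+-identityʳ 1#)))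
    ⟦⟧ᶜ≈difference (0 , suc b) = refl
    ⟦⟧ᶜ≈difference (1 , suc b) = refl
    ⟦⟧ᶜ≈difference (suc (suc a) , b) = refl

    +-difference : ∀ a b c d → (a + c) + - (b + d) ≈ (a + - b) + (c + - d)
    +-difference a b c d = trans (+-congˡ (sym (⁻¹-∙-comm b d))) (interchange a c (- b) (- d))

    *-difference : ∀ a b c d → (a * c + b * d) + - (a * d + b * c) ≈ (a + - b) * (c + - d)
    *-difference a b c d = begin
      (a * c + b * d) + - (a * d + b * c)             ≈⟨ +-difference _ _ _ _ ⟩
      (a * c + - (a * d)) + (b * d + - (b * c))       ≈⟨ +-cong (+-congˡ (-‿distribʳ-* a d)) (+-comm _ _) ⟩
      (a * c + a * - d) + (- (b * c) + b * d)         ≈⟨ +-cong (sym (distribˡ a c (- d))) (+-cong (-‿distribˡ-* b c) negate²) ⟩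
      a * (c + - d) + (- b * c + - b * - d)           ≈⟨ +-congˡ (distribˡ (- b) c (- d)) ⟨
      a * (c + - d) + - b * (c + - d)                 ≈⟨ distribʳ (c + - d) a (- b) ⟨
      (a + - b) * (c + - d)                           ∎
      where
      negate² : b * d ≈ - b * - d
      negate² = begin
        b * d          ≈⟨ ⁻¹-involutive (b * d) ⟨
        - - (b * d)    ≈⟨ -‿cong (-‿distribʳ-* b d) ⟩
        - (b * - d)    ≈⟨ -‿distribˡ-* b (- d) ⟩
        - b * - d      ∎

    difference-cong : ∀ a b c d → a ℕ.+ d ≡ c ℕ.+ b → difference (a , b) ≈ difference (c , d)
    difference-cong a b c d e = begin
      a ⨯ 1# + - (b ⨯ 1#)                                    ≈⟨ +-identityʳ _ ⟨
      (a ⨯ 1# + - (b ⨯ 1#)) + 0#                              ≈⟨ +-congˡ (-‿inverseʳ (d ⨯ 1#)) ⟨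
      (a ⨯ 1# + - (b ⨯ 1#)) + (d ⨯ 1# + - (d ⨯ 1#))           ≈⟨ +-difference _ _ _ _ ⟨
      (a ⨯ 1# + d ⨯ 1#) + - (b ⨯ 1# + d ⨯ 1#)                 ≈⟨ +-congʳ (×-homo-+ 1# a d) ⟨
      (a ℕ.+ d) ⨯ 1# + - (b ⨯ 1# + d ⨯ 1#)                    ≡⟨ ≡.cong (λ n → n ⨯ 1# + - (b ⨯ 1# + d ⨯ 1#)) e ⟩
      (c ℕ.+ b) ⨯ 1# + - (b ⨯ 1# + d ⨯ 1#)                    ≈⟨ +-cong (×-homo-+ 1# c b) (-‿cong (+-comm _ _)) ⟩
      (c ⨯ 1# + b ⨯ 1#) + - (d ⨯ 1# + b ⨯ 1#)                 ≈⟨ +-difference _ _ _ _ ⟩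
      (c ⨯ 1# + - (d ⨯ 1#)) + (b ⨯ 1# + - (b ⨯ 1#))           ≈⟨ +-congˡ (-‿inverseʳ _) ⟩
      (c ⨯ 1# + - (d ⨯ 1#)) + 0#                              ≈⟨ +-identityʳ _ ⟩
      c ⨯ 1# + - (d ⨯ 1#)                                     ∎

    difference-reduce : ∀ x → difference (reduce x) ≈ difference x
    difference-reduce (a , b) = difference-cong (a ∸ b) (b ∸ a) a b (balance a b)
      where
      balance : ∀ m n → (m ∸ n) ℕ.+ n ≡ m ℕ.+ (n ∸ m)
      balance zero    zero    = ≡.refl
      balance zero    (suc n) = ≡.refl
      balance (suc m) zero    = ≡.refl
      balance (suc m) (suc n) = ≡.trans (ℕ.+-suc _ n) (≡.cong suc (balance m n))

    product : ∀ a c b d → (a ℕ.* c ℕ.+ b ℕ.* d) ⨯ 1# ≈ (a ⨯ 1#) * (c ⨯ 1#) + (b ⨯ 1#) * (d ⨯ 1#)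
    product a c b d = trans (×-homo-+ 1# (a ℕ.* c) (b ℕ.* d)) (+-cong (×1-homo-* a c) (×1-homo-* b d))

    +-homo : ∀ x y → difference (x C.+ y) ≈ difference x + difference y
    +-homo (a , b) (c , d) = trans (difference-reduce (add (a , b) (c , d))) (
      trans (+-cong (×-homo-+ 1# a c) (-‿cong (×-homo-+ 1# b d))) (+-difference _ _ _ _))

    *-homo : ∀ x y → difference (x C.* y) ≈ difference x * difference y
    *-homo (a , b) (c , d) = trans (difference-reduce (multiply (a , b) (c , d))) (
      trans (+-cong (product a c b d) (-‿cong (product a d b c))) (*-difference _ _ _ _))

    -‿homo : ∀ x → difference (C.- x) ≈ - difference x
    -‿homo (a , b) = trans (+-congʳ (sym (⁻¹-involutive _))) (trans (⁻¹-∙-comm _ _) (-‿cong (+-comm _ _)))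

    morphism : coefficients -Raw-AlmostCommutative⟶ fromCommutativeRing R
    morphism = record
      { ⟦_⟧    = ⟦_⟧ᶜ
      ; +-homo = λ x y → trans (⟦⟧ᶜ≈difference (x C.+ y)) (trans (+-homo x y)
          (sym (+-cong (⟦⟧ᶜ≈difference x) (⟦⟧ᶜ≈difference y))))
      ; *-homo = λ x y → trans (⟦⟧ᶜ≈difference (x C.* y)) (trans (*-homo x y)
          (sym (*-cong (⟦⟧ᶜ≈difference x) (⟦⟧ᶜ≈difference y))))
      ; -‿homo = λ x → trans (⟦⟧ᶜ≈difference (C.- x)) (trans (-‿homo x) (sym (-‿cong (⟦⟧ᶜ≈difference x))))
      ; 0-homo = refl
      ; 1-homo = refl
      }

    decide : ∀ x y → Maybe (⟦ x ⟧ᶜ ≈ ⟦ y ⟧ᶜ)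
    decide (a , b) (c , d) with a ℕ.+ d ℕ.≟ c ℕ.+ b
    ... | yes e = just (trans (⟦⟧ᶜ≈difference (a , b))
          (trans (difference-cong a b c d e) (sym (⟦⟧ᶜ≈difference (c , d)))))
    ... | no _  = nothing

  open import Algebra.Solver.Ring coefficients (fromCommutativeRing R) morphism decide public
    using (solve; _:=_; _:+_; _:*_; _:-_; :-_; con)

-- The properties of the graded ring F_p[x,y] that the proof uses.
record Plane : Set₁ where
  field
    R : CommutativeRing 0ℓ 0ℓ
  open CommutativeRing R public hiding (zero)
  infix 4 _∣_
  _∣_ : Carrier → Carrier → Set
  g ∣ f = ∃[ h ] f ≈ g * h
  field
    X Y   : Carrier
    Homog : ℕ → Carrier → Set
    homog-cong   : ∀ {n f g} → f ≈ g → Homog n f → Homog n g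
    homog-0      : ∀ n → Homog n 0#
    homog-1      : Homog 0 1#
    homog-X      : Homog 1 X
    homog-Y      : Homog 1 Y
    homog-+      : ∀ {n f g} → Homog n f → Homog n g → Homog n (f + g)
    homog-neg    : ∀ {n f} → Homog n f → Homog n (- f)
    homog-*      : ∀ {m n f g} → Homog m f → Homog n g → Homog (m ℕ.+ n) (f * g)
    homog-unique : ∀ {m n f} → m ≢ n → Homog m f → Homog n f → f ≈ 0#
    -- The coefficients `a` and `b` are arbitrary: all terms of the right-hand side have degree at
    -- least the smaller of `d` and `d′`, so none of them meets degree `e`.
    homog-low    : ∀ {e d d′ f g g′} → Homog e f → Homog d g → Homog d′ g′ → e < d → e < d′ →
                   ∀ a b → f ≈ a * g + b * g′ → f ≈ 0#
    homog-split  : ∀ {n f} → Homog (suc n) f →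
                   ∃[ g ] ∃[ h ] Homog n g × Homog n h × f ≈ X * g + Y * h
    homog-const  : ∀ {f} → Homog 0 f → f ≈ 0# ⊎ ∃[ g ] Homog 0 g × f * g ≈ 1#
    quotient-X   : ∀ {n} f → Homog (suc n) (X * f) → Homog n f
    quotient-Y   : ∀ {n} f → Homog (suc n) (Y * f) → Homog n f
    quotient-X+Y : ∀ {n} f → Homog (suc n) ((X + Y) * f) → Homog n f
    X∣Y*⇒X∣      : ∀ f → X ∣ Y * f → X ∣ f
    1≉0          : ¬ 1# ≈ 0#

-- Multiplicities indexed by the three forms

at : Fin 3 → Mult → ℕ
at 0F (a , b , c) = a
at 1F (a , b , c) = b
at 2F (a , b , c) = c

inc : Fin 3 → Mult → Mult
inc 0F (a , b , c) = suc a , b , c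
inc 1F (a , b , c) = a , suc b , c
inc 2F (a , b , c) = a , b , suc c

at-inc : ∀ i μ → at i (inc i μ) ≡ suc (at i μ)
at-inc 0F μ = ≡.refl
at-inc 1F μ = ≡.refl
at-inc 2F μ = ≡.refl

at-inc-≢ : ∀ i j μ → j ≢ i → at j (inc i μ) ≡ at j μ
at-inc-≢ 0F 0F μ n = ⊥-elim (n ≡.refl)
at-inc-≢ 0F 1F μ n = ≡.refl
at-inc-≢ 0F 2F μ n = ≡.refl
at-inc-≢ 1F 0F μ n = ≡.refl
at-inc-≢ 1F 1F μ n = ⊥-elim (n ≡.refl)
at-inc-≢ 1F 2F μ n = ≡.refl
at-inc-≢ 2F 0F μ n = ≡.refl
at-inc-≢ 2F 1F μ n = ≡.refl
at-inc-≢ 2F 2F μ n = ⊥-elim (n ≡.refl)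

∣inc∣ : ∀ i μ → ∣ inc i μ ∣ₘ ≡ suc ∣ μ ∣ₘ
∣inc∣ 0F (a , b , c) = ≡.refl
∣inc∣ 1F (a , b , c) = ≡.cong (ℕ._+ c) (ℕ.+-suc a b)
∣inc∣ 2F (a , b , c) = ℕ.+-suc (a ℕ.+ b) c

-- Divisibility by the three linear forms

module Forms (P : Plane) where
  open Plane P public
  open Solver R public
  open import Algebra.Properties.Semiring.Exp semiring public using (_^_; ^-homo-*; ^-congˡ)
  open import Algebra.Properties.Ring ring public using (x∙y⁻¹≈ε⇒x≈y; x≈y⇒x∙y⁻¹≈ε)

  ∣-respʳ : ∀ {f g h} → g ≈ h → f ∣ g → f ∣ h
  ∣-respʳ e (q , r) = q , trans (sym e) r

  ∣-respˡ : ∀ {f g h} → f ≈ g → f ∣ h → g ∣ h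
  ∣-respˡ e (q , r) = q , trans r (*-congʳ e)

  ∣-+ : ∀ {f g h} → f ∣ g → f ∣ h → f ∣ g + h
  ∣-+ (q , r) (q′ , r′) = q + q′ , trans (+-cong r r′) (sym (distribˡ _ q q′))

  ∣-neg : ∀ {f g} → f ∣ g → f ∣ - g
  ∣-neg {f} (q , r) = - q , trans (-‿cong r) (solve 2 (λ f q → :- (f :* q) := f :* (:- q)) refl f q)

  ∣-* : ∀ {f g} h → f ∣ g → f ∣ h * g
  ∣-* {f} h (q , r) = h * q , trans (*-congˡ r) (solve 3 (λ f q h → h :* (f :* q) := f :* (h :* q)) refl f q h)

  ∣-self : ∀ f g → f ∣ f * g
  ∣-self f g = g , refl

  ∣-0 : ∀ {f} → f ∣ 0#
  ∣-0 = 0# , sym (zeroʳ _)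

  ∣-trans : ∀ {f g h} → f ∣ g → g ∣ h → f ∣ h
  ∣-trans {f} (q , r) (q′ , r′) = q * q′ , trans r′ (trans (*-congʳ r) (*-assoc f q q′))

  ^-∣ : ∀ f {m n} → m ≤ n → f ^ m ∣ f ^ n
  ^-∣ f {m} {n} m≤n = f ^ (n ∸ m) , trans (reflexive (≡.cong (f ^_) (≡.sym (ℕ.m+[n∸m]≡n m≤n)))) (^-homo-* f m (n ∸ m))

  homog-cast : ∀ {m n f} → m ≡ n → Homog m f → Homog n f
  homog-cast ≡.refl h = h

  homog-^ : ∀ {f} n → Homog 1 f → Homog n (f ^ n)
  homog-^ zero    h = homog-1
  homog-^ (suc n) h = homog-* h (homog-^ n h)

  homog-∣ : ∀ {e d f g} → Homog e f → Homog d g → e < d → g ∣ f → f ≈ 0#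
  homog-∣ {f = f} {g} hf hg e<d (q , r) =
    homog-low hf hg hg e<d e<d q 0# (trans r (solve 2 (λ g q → g :* q := q :* g :+ con (0 , 0) :* g) refl g q))

  form : Fin 3 → Carrier
  form 0F = X
  form 1F = Y
  form 2F = X + Y

  homog-form : ∀ i → Homog 1 (form i)
  homog-form 0F = homog-X
  homog-form 1F = homog-Y
  homog-form 2F = homog-+ homog-X homog-Y

  homog-quotient : ∀ i {n} f → Homog (suc n) (form i * f) → Homog n f
  homog-quotient 0F = quotient-X
  homog-quotient 1F = quotient-Y
  homog-quotient 2F = quotient-X+Y

  -- Zero is homogeneous of degrees 1 and 2, so the quotient `f` is homogeneous of degrees 0 and 1
  -- at once.
  form-cancel₀ : ∀ i f → form i * f ≈ 0# → f ≈ 0#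
  form-cancel₀ i f e = homog-unique (λ ()) (homog-quotient i f (zeros 1)) (homog-quotient i f (zeros 2))
    where
    zeros : ∀ n → Homog n (form i * f)
    zeros n = homog-cong (sym e) (homog-0 n)

  form-cancel : ∀ i f g → form i * f ≈ form i * g → f ≈ g
  form-cancel i f g e = x∙y⁻¹≈ε⇒x≈y f g (form-cancel₀ i _
    (trans (solve 3 (λ l f g → l :* (f :- g) := l :* f :- l :* g) refl (form i) f g) (x≈y⇒x∙y⁻¹≈ε e)))

  form^-cancel : ∀ i n f g → form i ^ n * f ≈ form i ^ n * g → f ≈ g
  form^-cancel i zero    f g e = trans (sym (*-identityˡ f)) (trans e (*-identityˡ g))
  form^-cancel i (suc n) f g e = form^-cancel i n f g
    (form-cancel i _ _ (trans (sym (*-assoc _ _ f)) (trans e (*-assoc _ _ g))))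

  form^-cancel₀ : ∀ i n f → form i ^ n * f ≈ 0# → f ≈ 0#
  form^-cancel₀ i n f e = form^-cancel i n f 0# (trans e (sym (zeroʳ _)))

  form∤1 : ∀ i → ¬ form i ∣ 1#
  form∤1 i d = 1≉0 (homog-∣ homog-1 (homog-form i) (s≤s z≤n) d)

  -- From form i * f = form j * h the hypothesis extracts `form i` from `h`, and cancelling it
  -- leaves `f` as a multiple of `form j`.
  prime-swap : ∀ i j → (∀ f → form i ∣ form j * f → form i ∣ f) → ∀ f → form j ∣ form i * f → form j ∣ f
  prime-swap i j prime f (h , e) with prime h (f , sym e)
  ... | h′ , e′ = h′ , form-cancel i _ _
    (trans e (trans (*-congˡ e′) (solve 3 (λ x y z → x :* (y :* z) := y :* (x :* z)) refl (form j) (form i) h′)))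

  private
    prime-X+Y : ∀ i j f → X + Y ≈ form i + form j → (∀ f → form i ∣ form j * f → form i ∣ f) →
                form i ∣ (X + Y) * f → form i ∣ f
    prime-X+Y i j f e prime d = prime f
      (∣-respʳ (trans (+-congʳ (*-congʳ e)) (solve 3 (λ l t f → (l :+ t) :* f :- l :* f := t :* f) refl (form i) (form j) f))
               (∣-+ d (∣-neg (∣-self (form i) f))))

  private
    Y∣X*⇒Y∣ : ∀ f → Y ∣ X * f → Y ∣ f
    Y∣X*⇒Y∣ = prime-swap 0F 1F X∣Y*⇒X∣

    X∣[X+Y]*⇒X∣ : ∀ f → X ∣ (X + Y) * f → X ∣ f
    X∣[X+Y]*⇒X∣ f = prime-X+Y 0F 1F f refl X∣Y*⇒X∣

    Y∣[X+Y]*⇒Y∣ : ∀ f → Y ∣ (X + Y) * f → Y ∣ f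
    Y∣[X+Y]*⇒Y∣ f = prime-X+Y 1F 0F f (+-comm X Y) Y∣X*⇒Y∣

  form-prime : ∀ i j → i ≢ j → ∀ f → form i ∣ form j * f → form i ∣ f
  form-prime 0F 0F i≢j = ⊥-elim (i≢j ≡.refl)
  form-prime 0F 1F i≢j = X∣Y*⇒X∣
  form-prime 0F 2F i≢j = X∣[X+Y]*⇒X∣
  form-prime 1F 0F i≢j = Y∣X*⇒Y∣
  form-prime 1F 1F i≢j = ⊥-elim (i≢j ≡.refl)
  form-prime 1F 2F i≢j = Y∣[X+Y]*⇒Y∣
  form-prime 2F 0F i≢j = prime-swap 0F 2F X∣[X+Y]*⇒X∣
  form-prime 2F 1F i≢j = prime-swap 1F 2F Y∣[X+Y]*⇒Y∣
  form-prime 2F 2F i≢j = ⊥-elim (i≢j ≡.refl)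

  form-prime^ : ∀ i j → i ≢ j → ∀ n f → form i ∣ form j ^ n * f → form i ∣ f
  form-prime^ i j i≢j zero    f d = ∣-respʳ (*-identityˡ f) d
  form-prime^ i j i≢j (suc n) f d =
    form-prime^ i j i≢j n f (form-prime i j i≢j _ (∣-respʳ (*-assoc _ _ f) d))

  form^-coprime : ∀ i j → i ≢ j → ∀ m n f → form i ^ m ∣ form j ^ n * f → form i ^ m ∣ f
  form^-coprime i j i≢j zero    n f d = f , sym (*-identityˡ f)
  form^-coprime i j i≢j (suc m) n f d@(q , r)
    with form-prime^ i j i≢j n f (∣-trans (∣-self (form i) (form i ^ m)) d)
  ... | g , f≈ = ∣-respʳ (sym f≈) (multiply (form^-coprime i j i≢j m n g (q , form-cancel i _ _ reduced)))
    where
    reduced : form i * (form j ^ n * g) ≈ form i * (form i ^ m * q)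
    reduced = trans (solve 3 (λ x y z → x :* (y :* z) := y :* (x :* z)) refl (form i) (form j ^ n) g)
      (trans (*-congˡ (sym f≈)) (trans r (*-assoc _ _ q)))
    multiply : ∀ {g} → form i ^ m ∣ g → form i * form i ^ m ∣ form i * g
    multiply (q , r) = q , trans (*-congˡ r) (sym (*-assoc _ _ q))

  monomial : Mult → Carrier
  monomial (a , b , c) = form 0F ^ a * (form 1F ^ b * form 2F ^ c)

  homog-monomial : ∀ μ → Homog ∣ μ ∣ₘ (monomial μ)
  homog-monomial (a , b , c) = homog-cast (≡.sym (ℕ.+-assoc a b c))
    (homog-* (homog-^ a (homog-form 0F)) (homog-* (homog-^ b (homog-form 1F)) (homog-^ c (homog-form 2F))))

  monomial-cancel₀ : ∀ μ f → monomial μ * f ≈ 0# → f ≈ 0#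
  monomial-cancel₀ (a , b , c) f e =
    form^-cancel₀ 2F c f (form^-cancel₀ 1F b _ (form^-cancel₀ 0F a _
      (trans (solve 4 (λ x y z f → x :* (y :* (z :* f)) := (x :* (y :* z)) :* f) refl _ _ _ f) e)))

  -- The forms are pairwise coprime, so the power of one can be divided out while the powers of the
  -- others still divide the quotient.
  monomial-∣ : ∀ μ f → (∀ i → form i ^ at i μ ∣ f) → monomial μ ∣ f
  monomial-∣ (a , b , c) f d with d 0F
  ... | g , f≈ with form^-coprime 1F 0F (λ ()) b a g (∣-respʳ f≈ (d 1F))
  ... | h , g≈ with form^-coprime 2F 1F (λ ()) c b h (∣-respʳ g≈ (form^-coprime 2F 0F (λ ()) c a g (∣-respʳ f≈ (d 2F))))
  ... | k , h≈ = k , trans f≈ (trans (*-congˡ (trans g≈ (*-congˡ h≈)))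
    (solve 4 (λ x y z k → x :* (y :* (z :* k)) := (x :* (y :* z)) :* k) refl _ _ _ k))

  cofactor : Fin 3 → Mult → Carrier
  cofactor 0F (a , b , c) = form 1F ^ b * form 2F ^ c
  cofactor 1F (a , b , c) = form 0F ^ a * form 2F ^ c
  cofactor 2F (a , b , c) = form 0F ^ a * form 1F ^ b

  monomial-cofactor : ∀ i μ → monomial μ ≈ form i ^ at i μ * cofactor i μ
  monomial-cofactor 0F (a , b , c) = refl
  monomial-cofactor 1F (a , b , c) = solve 3 (λ x y z → x :* (y :* z) := y :* (x :* z)) refl _ _ _
  monomial-cofactor 2F (a , b , c) = solve 3 (λ x y z → x :* (y :* z) := z :* (x :* y)) refl _ _ _

  form^∣monomial : ∀ i μ → form i ^ at i μ ∣ monomial μ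
  form^∣monomial i μ = cofactor i μ , monomial-cofactor i μ

  form∤cofactor : ∀ i μ → ¬ form i ∣ cofactor i μ
  form∤cofactor i μ d = form∤1 i (go i μ d)
    where
    two : ∀ i j k → i ≢ j → i ≢ k → ∀ m n → form i ∣ form j ^ m * form k ^ n → form i ∣ 1#
    two i j k i≢j i≢k m n d = form-prime^ i k i≢k n 1# (∣-respʳ (sym (*-identityʳ _)) (form-prime^ i j i≢j m _ d))
    go : ∀ i μ → form i ∣ cofactor i μ → form i ∣ 1#
    go 0F (a , b , c) = two 0F 1F 2F (λ ()) (λ ()) b c
    go 1F (a , b , c) = two 1F 0F 2F (λ ()) (λ ()) a c
    go 2F (a , b , c) = two 2F 0F 1F (λ ()) (λ ()) a b

  IsUnit : Carrier → Set
  IsUnit c = ∃[ c′ ] Homog 0 c′ × c * c′ ≈ 1#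

  -- On the line form i = 0 every form is a constant multiple of form (other i), so a homogeneous polynomial of
  -- degree n restricts to a constant multiple of form (other i) ^ n.
  other : Fin 3 → Fin 3
  other 0F = 1F
  other 1F = 0F
  other 2F = 0F

  other-≢ : ∀ i → i ≢ other i
  other-≢ 0F ()
  other-≢ 1F ()
  other-≢ 2F ()

  private
    restrict-X : ∀ i → ∃[ α ] Homog 0 α × form i ∣ X - α * form (other i)
    restrict-X 0F = 0# , homog-0 0 , 1# , solve 2 (λ x y → x :- con (0 , 0) :* y := x :* con (1 , 0)) refl X Y
    restrict-X 1F = 1# , homog-1 , 0# , solve 2 (λ x y → x :- con (1 , 0) :* x := y :* con (0 , 0)) refl X Y
    restrict-X 2F = 1# , homog-1 , 0# , solve 2 (λ x y → x :- con (1 , 0) :* x := (x :+ y) :* con (0 , 0)) refl X Y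

    restrict-Y : ∀ i → ∃[ α ] Homog 0 α × form i ∣ Y - α * form (other i)
    restrict-Y 0F = 1# , homog-1 , 0# , solve 2 (λ x y → y :- con (1 , 0) :* y := x :* con (0 , 0)) refl X Y
    restrict-Y 1F = 0# , homog-0 0 , 1# , solve 2 (λ x y → y :- con (0 , 0) :* x := y :* con (1 , 0)) refl X Y
    restrict-Y 2F = - 1# , homog-neg homog-1 , 1# ,
      solve 2 (λ x y → y :- (:- con (1 , 0)) :* x := (x :+ y) :* con (1 , 0)) refl X Y

  -- Induction on the degree through f = X g + Y h, since modulo `form i` both X and Y are constant
  -- multiples of `form (other i)`.
  restrict : ∀ i n f → Homog n f → ∃[ c ] Homog 0 c × form i ∣ f - c * form (other i) ^ n
  restrict i zero    f h = f , h , 0# , solve 2 (λ f l → f :- f :* con (1 , 0) := l :* con (0 , 0)) refl f (form i)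
  restrict i (suc n) f h with homog-split h | restrict-X i | restrict-Y i
  ... | g , g′ , hg , hg′ , f≈ | α , hα , dα | β , hβ , dβ with restrict i n g hg | restrict i n g′ hg′
  ... | c , hc , dc | c′ , hc′ , dc′ =
    α * c + β * c′ , homog-+ (homog-* hα hc) (homog-* hβ hc′) ,
    ∣-respʳ (trans
      (solve 10 (λ x y g g′ c c′ α β t s →
          ((g :* (x :- α :* t) :+ (α :* t) :* (g :- c :* s)) :+ (g′ :* (y :- β :* t) :+ (β :* t) :* (g′ :- c′ :* s)))
          := (x :* g :+ y :* g′) :- (α :* c :+ β :* c′) :* (t :* s)) refl X Y g g′ c c′ α β t (t ^ n))
      (+-congʳ (sym f≈)))
      (∣-+ (∣-+ (∣-* g dα) (∣-* _ dc)) (∣-+ (∣-* g′ dβ) (∣-* _ dc′)))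
    where t = form (other i)

-- Existence of homogeneous bases

module Derivations (P : Plane) where
  open Forms P public

  Derivation : Set
  Derivation = Carrier × Carrier

  infix 4 _≈ᵈ_
  _≈ᵈ_ : Derivation → Derivation → Set
  (f , g) ≈ᵈ (f′ , g′) = f ≈ f′ × g ≈ g′

  combine : Carrier → Derivation → Carrier → Derivation → Derivation
  combine a (f , g) b (f′ , g′) = a * f + b * f′ , a * g + b * g′

  infixr 7 _·_
  _·_ : Carrier → Derivation → Derivation
  a · (f , g) = a * f , a * g

  0ᵈ : Derivation
  0ᵈ = 0# , 0#

  HomogD : ℕ → Derivation → Set
  HomogD d (f , g) = Homog d f × Homog d g

  -- The value θ(α_i); the pair itself consists of θ(x) and θ(y).
  val : Fin 3 → Derivation → Carrier
  val 0F (f , g) = f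
  val 1F (f , g) = g
  val 2F (f , g) = f + g

  val-cong : ∀ i {θ η} → θ ≈ᵈ η → val i θ ≈ val i η
  val-cong 0F (e , e′) = e
  val-cong 1F (e , e′) = e′
  val-cong 2F (e , e′) = +-cong e e′

  val-combine : ∀ i a θ b η → val i (combine a θ b η) ≈ a * val i θ + b * val i η
  val-combine 0F a θ b η = refl
  val-combine 1F a θ b η = refl
  val-combine 2F a (f , g) b (f′ , g′) =
    solve 6 (λ a f g b f′ g′ → (a :* f :+ b :* f′) :+ (a :* g :+ b :* g′) := a :* (f :+ g) :+ b :* (f′ :+ g′))
      refl a f g b f′ g′

  val-· : ∀ i a θ → val i (a · θ) ≈ a * val i θ
  val-· 0F a θ = refl
  val-· 1F a θ = refl
  val-· 2F a (f , g) = sym (distribˡ a f g)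

  homog-val : ∀ i {d θ} → HomogD d θ → Homog d (val i θ)
  homog-val 0F (h , h′) = h
  homog-val 1F (h , h′) = h′
  homog-val 2F (h , h′) = homog-+ h h′

  homog-· : ∀ {m n a θ} → Homog m a → HomogD n θ → HomogD (m ℕ.+ n) (a · θ)
  homog-· h (h₁ , h₂) = homog-* h h₁ , homog-* h h₂

  D : Mult → Derivation → Set
  D μ θ = ∀ i → form i ^ at i μ ∣ val i θ

  D-≈ : ∀ {μ θ η} → θ ≈ᵈ η → D μ θ → D μ η
  D-≈ e d i = ∣-respʳ (val-cong i e) (d i)

  D-combine : ∀ {μ θ η} a b → D μ θ → D μ η → D μ (combine a θ b η)
  D-combine a b d d′ i = ∣-respʳ (sym (val-combine i a _ b _)) (∣-+ (∣-* a (d i)) (∣-* b (d′ i)))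

  D-· : ∀ {μ θ} a → D μ θ → D μ (a · θ)
  D-· a d i = ∣-respʳ (sym (val-· i a _)) (∣-* a (d i))

  D-inc : ∀ i {μ θ} → D μ θ → form i ^ suc (at i μ) ∣ val i θ → D (inc i μ) θ
  D-inc i {μ} {θ} d dᵢ j with j Fin.≟ i
  ... | yes ≡.refl = ≡.subst (λ m → form i ^ m ∣ val i θ) (≡.sym (at-inc i μ)) dᵢ
  ... | no  j≢i    = ≡.subst (λ m → form j ^ m ∣ val j θ) (≡.sym (at-inc-≢ i j μ j≢i)) (d j)

  D-inc⁻ : ∀ i {μ θ} → D (inc i μ) θ → form i ^ suc (at i μ) ∣ val i θ
  D-inc⁻ i {μ} {θ} d = ≡.subst (λ m → form i ^ m ∣ val i θ) (at-inc i μ) (d i)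

  D-dec : ∀ i {μ θ} → D (inc i μ) θ → D μ θ
  D-dec i {μ} {θ} d j with j Fin.≟ i
  ... | yes ≡.refl = ∣-trans (^-∣ (form i) (ℕ.n≤1+n (at i μ))) (D-inc⁻ i d)
  ... | no  j≢i    = ≡.subst (λ m → form j ^ m ∣ val j θ) (at-inc-≢ i j μ j≢i) (d j)

  record Basis (μ : Mult) (d₁ d₂ : ℕ) : Set where
    field
      θ₁ θ₂       : Derivation
      homog₁      : HomogD d₁ θ₁
      homog₂      : HomogD d₂ θ₂
      D₁          : D μ θ₁
      D₂          : D μ θ₂
      span        : ∀ θ → D μ θ → ∃[ a ] ∃[ b ] θ ≈ᵈ combine a θ₁ b θ₂
      independent : ∀ a b → combine a θ₁ b θ₂ ≈ᵈ 0ᵈ → a ≈ 0# × b ≈ 0#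

  -- The restriction of f / form i ^ m to the line form i = 0: either it vanishes, or it is a
  -- nonzero constant times a power of `form (other i)`.
  data Leading (i : Fin 3) (m d : ℕ) (f : Carrier) : Set where
    divisible : form i ^ suc m ∣ f → Leading i m d f
    unit      : ∀ c n q → Homog 0 c → IsUnit c → d ≡ m ℕ.+ n →
                f ≈ form i ^ m * (c * form (other i) ^ n + form i * q) → Leading i m d f

  homog-quotient^ : ∀ i m {n} f → Homog (m ℕ.+ n) (form i ^ m * f) → Homog n f
  homog-quotient^ i zero    f h = homog-cong (*-identityˡ f) h
  homog-quotient^ i (suc m) f h = homog-quotient^ i m f (homog-quotient i _ (homog-cong (*-assoc _ _ f) h))

  leading : ∀ i m {d f} → Homog d f → form i ^ m ∣ f → Leading i m d f
  leading i m {d} {f} hf (h , f≈) with ℕ.<-≤-connex d m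
  -- In degree below `m` the only multiple of form i ^ m is 0, which every power divides.
  ... | inj₁ d<m = divisible (∣-respʳ (sym (homog-∣ hf (homog-^ m (homog-form i)) d<m (h , f≈))) ∣-0)
  ... | inj₂ m≤d with restrict i (d ∸ m) h (homog-quotient^ i m h
                        (homog-cast (≡.sym (ℕ.m+[n∸m]≡n m≤d)) (homog-cong f≈ hf)))
  ... | c , hc , q , h-c≈ with homog-const hc
  ... | inj₁ c≈0 = divisible (q , trans f≈ (trans (*-congˡ
          (trans (solve 2 (λ h t → h := h :- con (0 , 0) :* t) refl h _)
            (trans (+-congˡ (-‿cong (*-congʳ (sym c≈0)))) h-c≈)))
          (solve 3 (λ x l q → x :* (l :* q) := (l :* x) :* q) refl _ _ q)))
  ... | inj₂ u   = unit c (d ∸ m) q hc u (≡.sym (ℕ.m+[n∸m]≡n m≤d)) (trans f≈ (*-congˡ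
          (trans (solve 2 (λ h t → h := t :+ (h :- t)) refl h _) (+-congˡ h-c≈))))

  unit-prime : ∀ i {c} n f → IsUnit c → form i ∣ (c * form (other i) ^ n) * f → form i ∣ f
  unit-prime i {c} n f (c′ , _ , cc′) d = form-prime^ i (other i) (other-≢ i) n f
    (∣-respʳ (trans (solve 4 (λ c c′ t f → c′ :* ((c :* t) :* f) := (c :* c′) :* (t :* f)) refl c c′ _ f)
                    (trans (*-congʳ cc′) (*-identityˡ _)))
             (∣-* c′ d))

  private
    -- An element of D μ whose value at `form i` has order exactly `at i μ`; hence the values of a
    -- basis at `form i` cannot all have larger order.
    witness : Fin 3 → Mult → Derivation
    witness 0F μ = monomial μ , 0#
    witness 1F μ = 0# , monomial μ
    witness 2F μ = monomial μ , 0#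

    val-witness : ∀ i μ → val i (witness i μ) ≈ monomial μ
    val-witness 0F μ = refl
    val-witness 1F μ = refl
    val-witness 2F μ = +-identityʳ _

    D-witness : ∀ i μ → D μ (witness i μ)
    D-witness 0F μ 0F = form^∣monomial 0F μ
    D-witness 0F μ 1F = ∣-0
    D-witness 0F μ 2F = ∣-respʳ (sym (+-identityʳ _)) (form^∣monomial 2F μ)
    D-witness 1F μ 0F = ∣-0
    D-witness 1F μ 1F = form^∣monomial 1F μ
    D-witness 1F μ 2F = ∣-respʳ (sym (+-identityˡ _)) (form^∣monomial 2F μ)
    D-witness 2F μ 0F = form^∣monomial 0F μ
    D-witness 2F μ 1F = ∣-0
    D-witness 2F μ 2F = ∣-respʳ (sym (+-identityʳ _)) (form^∣monomial 2F μ)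

    form^∤witness : ∀ i μ → ¬ form i ^ suc (at i μ) ∣ val i (witness i μ)
    form^∤witness i μ (q , e) = form∤cofactor i μ (q , form^-cancel i (at i μ) _ _
      (trans (sym (monomial-cofactor i μ)) (trans (sym (val-witness i μ))
        (trans e (solve 3 (λ l x q → (l :* x) :* q := x :* (l :* q)) refl _ _ q)))))

  module _ {μ d₁ d₂} (B : Basis μ d₁ d₂) where
    open Basis B

    basis-swap : Basis μ d₂ d₁
    basis-swap = record
      { θ₁ = θ₂ ; θ₂ = θ₁ ; homog₁ = homog₂ ; homog₂ = homog₁ ; D₁ = D₂ ; D₂ = D₁
      ; span = λ θ d → let (a , b , e , e′) = span θ d in b , a , trans e (+-comm _ _) , trans e′ (+-comm _ _)
      ; independent = λ a b (e , e′) →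
          let (b≈0 , a≈0) = independent b a (trans (+-comm _ _) e , trans (+-comm _ _) e′) in a≈0 , b≈0 }

    basis-shear : ∀ {n} u → Homog n u → n ℕ.+ d₁ ≡ d₂ → Basis μ d₁ d₂
    basis-shear u hu degree = record
      { θ₁ = θ₁ ; θ₂ = combine 1# θ₂ (- u) θ₁ ; homog₁ = homog₁
      ; homog₂ = sheared (proj₁ homog₂) (proj₁ homog₁) , sheared (proj₂ homog₂) (proj₂ homog₁)
      ; D₁ = D₁ ; D₂ = D-combine 1# (- u) D₂ D₁
      ; span = λ θ d → let (a , b , e , e′) = span θ d in
          a + b * u , b , trans e (back a b _ _) , trans e′ (back a b _ _)
      ; independent = λ a b (e , e′) →
          let (a-bu≈0 , b≈0) = independent (a - b * u) b (trans (forth a b _ _) e , trans (forth a b _ _) e′) in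
          trans (solve 3 (λ a b u → a := (a :- b :* u) :+ b :* u) refl a b u)
            (trans (+-cong a-bu≈0 (trans (*-congʳ b≈0) (zeroˡ u))) (+-identityʳ 0#)) , b≈0 }
      where
      sheared : ∀ {f g} → Homog d₂ f → Homog d₁ g → Homog d₂ (1# * f + - u * g)
      sheared hf hg = homog-+ (homog-cong (sym (*-identityˡ _)) hf) (homog-cast degree (homog-* (homog-neg hu) hg))
      back : ∀ a b f g → a * f + b * g ≈ (a + b * u) * f + b * (1# * g + - u * f)
      back a b = solve 5 (λ u a b f g → a :* f :+ b :* g := (a :+ b :* u) :* f :+ b :* (con (1 , 0) :* g :+ (:- u) :* f))
        refl u a b
      forth : ∀ a b f g → (a - b * u) * f + b * g ≈ a * f + b * (1# * g + - u * f)
      forth a b = solve 5 (λ u a b f g → (a :- b :* u) :* f :+ b :* g := a :* f :+ b :* (con (1 , 0) :* g :+ (:- u) :* f))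
        refl u a b

    -- Since θ₁ has the extra factor of `form i`, θ₂ cannot have it: otherwise all of D μ would,
    -- including `witness i μ`. So an element of the smaller module has a θ₂-coefficient that
    -- vanishes on the line form i = 0, which means that `form i · θ₂` takes the place of θ₂.
    basis-raise : ∀ i → form i ^ suc (at i μ) ∣ val i θ₁ → Basis (inc i μ) d₁ (suc d₂)
    basis-raise i dvd = record
      { θ₁ = θ₁ ; θ₂ = form i · θ₂ ; homog₁ = homog₁ ; homog₂ = homog-· (homog-form i) homog₂
      ; D₁ = D-inc i D₁ dvd
      ; D₂ = D-inc i (D-· (form i) D₂) raised
      ; span = λ θ d → let (a , b , e , e′) = span θ (D-dec i d)
                           (b′ , b≈) = coefficient θ a b d (e , e′) in
          a , b′ , trans e (+-congˡ (factor b≈)) , trans e′ (+-congˡ (factor b≈))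
      ; independent = λ a b (e , e′) →
          let (a≈0 , lb≈0) = independent a (form i * b) (trans (+-congˡ (factor refl)) e , trans (+-congˡ (factor refl)) e′)
          in a≈0 , form-cancel₀ i b lb≈0 }
      where
      factor : ∀ {b b′ f} → b ≈ form i * b′ → b * f ≈ b′ * (form i * f)
      factor {b} {b′} {f} e = trans (*-congʳ e) (solve 3 (λ l b f → (l :* b) :* f := b :* (l :* f)) refl (form i) b′ f)
      raised : form i ^ suc (at i μ) ∣ val i (form i · θ₂)
      raised with D₂ i
      ... | q , e = q , trans (val-· i (form i) θ₂) (trans (*-congˡ e) (sym (*-assoc _ _ q)))
      coefficient : ∀ θ a b → D (inc i μ) θ → θ ≈ᵈ combine a θ₁ b θ₂ → form i ∣ b
      coefficient θ a b d e with leading i (at i μ) (homog-val i homog₂) (D₂ i)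
      ... | divisible dvd₂ = ⊥-elim (form^∤witness i μ
              (let (a , b , e) = span (witness i μ) (D-witness i μ) in
               ∣-respʳ (sym (trans (val-cong i e) (val-combine i a θ₁ b θ₂))) (∣-+ (∣-* a dvd) (∣-* b dvd₂))))
      ... | unit c n q hc u d₂≡ v≈ = unit-prime i n b u
              (∣-respʳ (solve 4 (λ b x l q → b :* (x :+ l :* q) :+ (:- (l :* (b :* q))) := x :* b) refl b _ (form i) q)
                       (∣-+ reduced (∣-neg (∣-self (form i) _))))
        where
        product : form i ^ suc (at i μ) ∣ b * val i θ₂
        product = ∣-respʳ
          (trans (+-congʳ (trans (val-cong i e) (val-combine i a θ₁ b θ₂)))
                 (solve 2 (λ x y → (x :+ y) :- x := y) refl _ _))
          (∣-+ (D-inc⁻ i d) (∣-neg (∣-* a dvd)))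
        reduced : form i ∣ b * (c * form (other i) ^ n + form i * q)
        reduced with product
        ... | h , bv≈ = h , form^-cancel i (at i μ) _ _
          (trans (solve 3 (λ x b y → x :* (b :* y) := b :* (x :* y)) refl _ b _)
            (trans (*-congˡ (sym v≈)) (trans bv≈
              (solve 3 (λ l x h → (l :* x) :* h := x :* (l :* h)) refl _ _ h))))

  -- On the line form i = 0 both leading values are constants times powers of the same form, so
  -- subtracting u θ₁ with u = (c₂ / c₁) t ^ (n₂ - n₁) kills that of θ₂. The sheared θ₂ keeps degree
  -- d₂, and θ₁ is then the element that has to be multiplied by `form i`.
  basis-eliminate : ∀ {μ d₁ d₂} (B : Basis μ d₁ d₂) i {c₁ n₁ q₁ c₂ n₂ q₂} → let open Basis B in
    IsUnit c₁ → Homog 0 c₂ → d₁ ≡ at i μ ℕ.+ n₁ → d₂ ≡ at i μ ℕ.+ n₂ → n₁ ≤ n₂ →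
    val i θ₁ ≈ form i ^ at i μ * (c₁ * form (other i) ^ n₁ + form i * q₁) →
    val i θ₂ ≈ form i ^ at i μ * (c₂ * form (other i) ^ n₂ + form i * q₂) →
    Basis (inc i μ) d₂ (suc d₁)
  basis-eliminate {μ} {d₁} {d₂} B i {c₁} {n₁} {q₁} {c₂} {n₂} {q₂} (c₁⁻¹ , h₁⁻¹ , c₁c₁⁻¹) hc₂ d₁≡ d₂≡ n₁≤n₂ v₁ v₂ =
    basis-raise (basis-swap (basis-shear B u hu degree)) i (q₂ - u * q₁ , eliminated)
    where
    open Basis B
    l = form i
    t = form (other i)
    x = form i ^ at i μ
    k = n₂ ∸ n₁
    u = (c₂ * c₁⁻¹) * t ^ k
    hu : Homog k u
    hu = homog-* (homog-* hc₂ h₁⁻¹) (homog-^ k (homog-form (other i)))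
    degree : k ℕ.+ d₁ ≡ d₂
    degree = ≡.trans (≡.cong (k ℕ.+_) d₁≡) (≡.trans (ℕ.+-comm k _)
      (≡.trans (ℕ.+-assoc (at i μ) n₁ k) (≡.trans (≡.cong (at i μ ℕ.+_) (ℕ.m+[n∸m]≡n n₁≤n₂)) (≡.sym d₂≡))))
    power : t ^ n₂ ≈ t ^ n₁ * t ^ k
    power = trans (reflexive (≡.cong (t ^_) (≡.sym (ℕ.m+[n∸m]≡n n₁≤n₂)))) (^-homo-* t n₁ k)
    eliminated : val i (combine 1# θ₂ (- u) θ₁) ≈ (l * x) * (q₂ - u * q₁)
    eliminated = trans (val-combine i 1# θ₂ (- u) θ₁)
      (trans (+-cong (*-congˡ (trans v₂ (*-congˡ (+-congʳ (*-congˡ power))))) (*-congˡ v₁))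
      (trans (solve 10 (λ x l t₁ tₖ c₁ c₁⁻¹ c₂ q₁ q₂ w →
          con (1 , 0) :* (x :* (c₂ :* (t₁ :* tₖ) :+ l :* q₂)) :+ (:- ((c₂ :* c₁⁻¹) :* tₖ)) :* (x :* (c₁ :* t₁ :+ l :* q₁))
          := (l :* x) :* (q₂ :- (c₂ :* c₁⁻¹) :* tₖ :* q₁) :+ (x :* (c₂ :* (t₁ :* tₖ))) :* (con (1 , 0) :- c₁ :* c₁⁻¹))
          refl x l (t ^ n₁) (t ^ k) c₁ c₁⁻¹ c₂ q₁ q₂ 0#)
      (trans (+-congˡ (*-congˡ (x≈y⇒x∙y⁻¹≈ε (sym c₁c₁⁻¹)))) (trans (+-congˡ (zeroʳ _)) (+-identityʳ _)))))

  Exponents : Mult → Set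
  Exponents μ = ∃[ d₁ ] ∃[ d₂ ] d₁ ≤ d₂ × d₁ ℕ.+ d₂ ≡ ∣ μ ∣ₘ × Basis μ d₁ d₂

  exponents-sort : ∀ {μ d₁ d₂} → d₁ ℕ.+ d₂ ≡ ∣ μ ∣ₘ → Basis μ d₁ d₂ → Exponents μ
  exponents-sort {d₁ = d₁} {d₂} s B with ℕ.≤-total d₁ d₂
  ... | inj₁ le = d₁ , d₂ , le , s , B
  ... | inj₂ ge = d₂ , d₁ , ge , ≡.trans (ℕ.+-comm d₂ d₁) s , basis-swap B

  -- Either some basis element already has the extra factor, or the one of higher leading power is
  -- corrected by the other. In each case exactly one degree grows by 1, which keeps the sum equal
  -- to the total multiplicity.
  exponents-inc : ∀ i {μ} → Exponents μ → Exponents (inc i μ)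
  exponents-inc i {μ} (d₁ , d₂ , _ , s , B) = raise (leading i (at i μ) (homog-val i homog₁) (D₁ i))
                                                    (leading i (at i μ) (homog-val i homog₂) (D₂ i))
    where
    open Basis B
    s′ : d₁ ℕ.+ suc d₂ ≡ ∣ inc i μ ∣ₘ
    s′ = ≡.trans (ℕ.+-suc d₁ d₂) (≡.trans (≡.cong suc s) (≡.sym (∣inc∣ i μ)))
    s″ : d₂ ℕ.+ suc d₁ ≡ ∣ inc i μ ∣ₘ
    s″ = ≡.trans (ℕ.+-suc d₂ d₁) (≡.trans (≡.cong suc (ℕ.+-comm d₂ d₁)) (≡.trans (≡.cong suc s) (≡.sym (∣inc∣ i μ))))
    raise : Leading i (at i μ) d₁ (val i θ₁) → Leading i (at i μ) d₂ (val i θ₂) → Exponents (inc i μ)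
    raise (divisible dvd) _               = exponents-sort s′ (basis-raise B i dvd)
    raise (unit _ _ _ _ _ _ _) (divisible dvd) = exponents-sort s″ (basis-raise (basis-swap B) i dvd)
    raise (unit c₁ n₁ q₁ h₁ u₁ e₁ v₁) (unit c₂ n₂ q₂ h₂ u₂ e₂ v₂) with ℕ.≤-total n₁ n₂
    ... | inj₁ le = exponents-sort s″ (basis-eliminate B i u₁ h₂ e₁ e₂ le v₁ v₂)
    ... | inj₂ ge = exponents-sort s′ (basis-eliminate (basis-swap B) i u₂ h₁ e₂ e₁ ge v₂ v₁)

  exponents : ∀ μ → Exponents μ
  exponents (suc a , b , c)       = exponents-inc 0F (exponents (a , b , c))
  exponents (zero , suc b , c)    = exponents-inc 1F (exponents (zero , b , c))
  exponents (zero , zero , suc c) = exponents-inc 2F (exponents (zero , zero , c))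
  exponents (zero , zero , zero)  = 0 , 0 , z≤n , ≡.refl , record
    { θ₁ = 1# , 0# ; θ₂ = 0# , 1# ; homog₁ = homog-1 , homog-0 0 ; homog₂ = homog-0 0 , homog-1
    ; D₁ = everything ; D₂ = everything
    ; span = λ (f , g) _ → f , g , first f g , second f g
    ; independent = λ a b (e , e′) → trans (first a b) e , trans (second a b) e′ }
    where
    first : ∀ f g → f ≈ f * 1# + g * 0#
    first = solve 2 (λ f g → f := f :* con (1 , 0) :+ g :* con (0 , 0)) refl
    second : ∀ f g → g ≈ f * 0# + g * 1#
    second = solve 2 (λ f g → g := f :* con (0 , 0) :+ g :* con (1 , 0)) refl
    everything : ∀ {θ} → D (0 , 0 , 0) θ
    everything {θ} 0F = val 0F θ , sym (*-identityˡ _)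
    everything {θ} 1F = val 1F θ , sym (*-identityˡ _)
    everything {θ} 2F = val 2F θ , sym (*-identityˡ _)

-- Distances between multiplicities

infixl 6 _∸ₘ_
-- The positive part of μ - ζ: the factors that a derivation in D ζ may lack for membership in D μ.
_∸ₘ_ : Mult → Mult → Mult
(a , b , c) ∸ₘ (a′ , b′ , c′) = a ∸ a′ , b ∸ b′ , c ∸ c′

at-∸ : ∀ i μ ν → at i (μ ∸ₘ ν) ≡ at i μ ∸ at i ν
at-∸ 0F μ ν = ≡.refl
at-∸ 1F μ ν = ≡.refl
at-∸ 2F μ ν = ≡.refl

-- The identity 2 (m - n)⁺ = (m - n) + |m - n|, rearranged so that it makes sense in ℕ. Summed over
-- coordinates it brings the distance into degree counts.
double-∸ : ∀ m n → (m ∸ n) ℕ.+ (m ∸ n) ℕ.+ n ≡ m ℕ.+ ∣ m - n ∣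
double-∸ zero    zero    = ≡.refl
double-∸ zero    (suc n) = ≡.refl
double-∸ (suc m) zero    = ℕ.+-identityʳ _
double-∸ (suc m) (suc n) = ≡.trans (ℕ.+-suc _ n) (≡.cong suc (double-∸ m n))

∣∸∣-dist : ∀ μ ν → ∣ μ ∸ₘ ν ∣ₘ ℕ.+ ∣ μ ∸ₘ ν ∣ₘ ℕ.+ ∣ ν ∣ₘ ≡ ∣ μ ∣ₘ ℕ.+ dist μ ν
∣∸∣-dist (a , b , c) (a′ , b′ , c′) =
  ≡.trans (gather (a ∸ a′) (b ∸ b′) (c ∸ c′) a′ b′ c′)
    (≡.trans (≡.cong₂ ℕ._+_ (≡.cong₂ ℕ._+_ (double-∸ a a′) (double-∸ b b′)) (double-∸ c c′)) (scatter a b c _ _ _))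
  where
  open +-*-Solver
  gather : ∀ x y z x′ y′ z′ → (x ℕ.+ y ℕ.+ z) ℕ.+ (x ℕ.+ y ℕ.+ z) ℕ.+ (x′ ℕ.+ y′ ℕ.+ z′) ≡
           (x ℕ.+ x ℕ.+ x′) ℕ.+ (y ℕ.+ y ℕ.+ y′) ℕ.+ (z ℕ.+ z ℕ.+ z′)
  gather = solve 6 (λ x y z x′ y′ z′ → (x :+ y :+ z) :+ (x :+ y :+ z) :+ (x′ :+ y′ :+ z′) :=
           (x :+ x :+ x′) :+ (y :+ y :+ y′) :+ (z :+ z :+ z′)) ≡.refl
  scatter : ∀ x y z x′ y′ z′ → (x ℕ.+ x′) ℕ.+ (y ℕ.+ y′) ℕ.+ (z ℕ.+ z′) ≡ (x ℕ.+ y ℕ.+ z) ℕ.+ (x′ ℕ.+ y′ ℕ.+ z′)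
  scatter = solve 6 (λ x y z x′ y′ z′ → (x :+ x′) :+ (y :+ y′) :+ (z :+ z′) := (x :+ y :+ z) :+ (x′ :+ y′ :+ z′)) ≡.refl

step-inc : ∀ i {μ} → Step μ (inc i μ)
step-inc 0F = step₁
step-inc 1F = step₂
step-inc 2F = step₃

inc⁻ : ∀ i μ → at i μ ≡ 0 ⊎ ∃[ ν ] inc i ν ≡ μ
inc⁻ 0F (zero  , b , c) = inj₁ ≡.refl
inc⁻ 0F (suc a , b , c) = inj₂ ((a , b , c) , ≡.refl)
inc⁻ 1F (a , zero  , c) = inj₁ ≡.refl
inc⁻ 1F (a , suc b , c) = inj₂ ((a , b , c) , ≡.refl)
inc⁻ 2F (a , b , zero ) = inj₁ ≡.refl
inc⁻ 2F (a , b , suc c) = inj₂ ((a , b , c) , ≡.refl)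

-- Low-degree elements and peaks

module Peaks (P : Plane) where
  open Derivations P public

  det : Derivation → Derivation → Carrier
  det (f , g) (f′ , g′) = f * g′ - f′ * g

  homog-det : ∀ {m n θ η} → HomogD m θ → HomogD n η → Homog (m ℕ.+ n) (det θ η)
  homog-det {m} {n} (h₁ , h₂) (h₁′ , h₂′) =
    homog-+ (homog-* h₁ h₂′) (homog-neg (homog-cast (ℕ.+-comm n m) (homog-* h₁′ h₂)))

  -- Up to sign the determinant can be computed from the values at any two of the three forms, so
  -- for each i it is a combination of the two values at `form i`.
  monomial-∣-det : ∀ {μ θ η} → D μ θ → D μ η → monomial μ ∣ det θ η
  monomial-∣-det {μ} {f , g} {f′ , g′} d d′ = monomial-∣ μ _ λ where
    0F → ∣-respʳ (solve 4 (λ f g f′ g′ → g′ :* f :+ :- (g :* f′) := f :* g′ :- f′ :* g) refl f g f′ g′)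
           (∣-+ (∣-* g′ (d 0F)) (∣-neg (∣-* g (d′ 0F))))
    1F → ∣-+ (∣-* f (d′ 1F)) (∣-neg (∣-* f′ (d 1F)))
    2F → ∣-respʳ (solve 4 (λ f g f′ g′ → f :* (f′ :+ g′) :+ :- (f′ :* (f :+ g)) := f :* g′ :- f′ :* g) refl f g f′ g′)
           (∣-+ (∣-* f (d′ 2F)) (∣-neg (∣-* f′ (d 2F))))

  -- If the determinant vanished, (g₂ , - g₁) and (f₂ , - f₁) would be relations between θ₁ and θ₂.
  -- Then all four coordinates would be 0, and 1 θ₁ = 0 would be a nontrivial relation.
  basis-det≉0 : ∀ {μ d₁ d₂} (B : Basis μ d₁ d₂) → ¬ det (Basis.θ₁ B) (Basis.θ₂ B) ≈ 0#
  basis-det≉0 B e =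
    1≉0 (proj₁ (independent 1# 0# (vanishes f₁≈0 f₂≈0 , vanishes g₁≈0 g₂≈0)))
    where
    open Basis B
    f₁ = proj₁ θ₁
    g₁ = proj₂ θ₁
    f₂ = proj₁ θ₂
    g₂ = proj₂ θ₂
    byG = independent g₂ (- g₁)
      ( trans (solve 4 (λ f₁ g₁ f₂ g₂ → g₂ :* f₁ :+ (:- g₁) :* f₂ := f₁ :* g₂ :- f₂ :* g₁) refl f₁ g₁ f₂ g₂) e
      , solve 2 (λ g₁ g₂ → g₂ :* g₁ :+ (:- g₁) :* g₂ := con (0 , 0)) refl g₁ g₂ )
    byF = independent f₂ (- f₁)
      ( solve 2 (λ f₁ f₂ → f₂ :* f₁ :+ (:- f₁) :* f₂ := con (0 , 0)) refl f₁ f₂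
      , trans (solve 4 (λ f₁ g₁ f₂ g₂ → f₂ :* g₁ :+ (:- f₁) :* g₂ := :- (f₁ :* g₂ :- f₂ :* g₁)) refl f₁ g₁ f₂ g₂)
          (trans (-‿cong e) (solve 0 (:- con (0 , 0) := con (0 , 0)) refl)) )
    neg≈0 : ∀ {f} → - f ≈ 0# → f ≈ 0#
    neg≈0 {f} e = trans (solve 1 (λ f → f := :- (:- f)) refl f) (trans (-‿cong e) (solve 0 (:- con (0 , 0) := con (0 , 0)) refl))
    f₁≈0 = neg≈0 (proj₂ byF)
    f₂≈0 = proj₁ byF
    g₁≈0 = neg≈0 (proj₂ byG)
    g₂≈0 = proj₁ byG
    vanishes : ∀ {a b f g} → f ≈ 0# → g ≈ 0# → a * f + b * g ≈ 0#
    vanishes {a} {b} f≈0 g≈0 = trans (+-cong (*-congˡ f≈0) (*-congˡ g≈0))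
      (solve 2 (λ a b → a :* con (0 , 0) :+ b :* con (0 , 0) := con (0 , 0)) refl a b)

  det-combine : ∀ a b c d θ η → det (combine a θ b η) (combine c θ d η) ≈ det θ η * (a * d - b * c)
  det-combine a b c d (f , g) (f′ , g′) =
    solve 8 (λ a b c d f g f′ g′ → (a :* f :+ b :* f′) :* (c :* g :+ d :* g′) :- (c :* f :+ d :* f′) :* (a :* g :+ b :* g′)
      := (f :* g′ :- f′ :* g) :* (a :* d :- b :* c)) refl a b c d f g f′ g′

  -- The basis supplied by `exponents` has a nonzero determinant of degree |μ|. Expanding it in the
  -- given basis shows that `det θ₁ θ₂` divides this determinant.
  basis-degree : ∀ {μ d₁ d₂} → Basis μ d₁ d₂ → d₁ ℕ.+ d₂ ≤ ∣ μ ∣ₘ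
  basis-degree {μ} {d₁} {d₂} B with exponents μ
  ... | e₁ , e₂ , _ , s , E = ℕ.≮⇒≥ λ lt → basis-det≉0 E
      (homog-∣ (homog-det (Basis.homog₁ E) (Basis.homog₂ E)) (homog-det homog₁ homog₂)
        (ℕ.<-≤-trans (ℕ.≤-<-trans (ℕ.≤-reflexive s) lt) ℕ.≤-refl) divides)
    where
    open Basis B
    divides : det θ₁ θ₂ ∣ det (Basis.θ₁ E) (Basis.θ₂ E)
    divides with span _ (Basis.D₁ E) | span _ (Basis.D₂ E)
    ... | a , b , e , e′ | c , d , f , f′ = _ , trans
      (+-cong (*-cong e f′) (-‿cong (*-cong f e′))) (det-combine a b c d θ₁ θ₂)

  basis-θ₁≉0 : ∀ {μ d₁ d₂} (B : Basis μ d₁ d₂) → ¬ Basis.θ₁ B ≈ᵈ 0ᵈ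
  basis-θ₁≉0 B (e , e′) = 1≉0 (proj₁ (independent 1# 0# (vanish e _ , vanish e′ _)))
    where
    open Basis B
    vanish : ∀ {f} → f ≈ 0# → ∀ g → 1# * f + 0# * g ≈ 0#
    vanish f≈0 g = trans (+-congʳ (*-congˡ f≈0))
      (solve 1 (λ g → con (1 , 0) :* con (0 , 0) :+ con (0 , 0) :* g := con (0 , 0)) refl g)

  Uneven : Mult → Set
  Uneven μ = ∃[ d₁ ] ∃[ d₂ ] Basis μ d₁ d₂ × d₁ ≢ d₂

  Low : Mult → Set
  Low μ = ∃[ d ] ∃[ θ ] HomogD d θ × D μ θ × (¬ θ ≈ᵈ 0ᵈ) × d ℕ.+ d < ∣ μ ∣ₘ

  basis⇒low : ∀ {μ d₁ d₂} → Basis μ d₁ d₂ → d₁ < d₂ → Low μ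
  basis⇒low {d₁ = d₁} B d₁<d₂ = d₁ , θ₁ , homog₁ , D₁ , basis-θ₁≉0 B ,
    ℕ.<-≤-trans (ℕ.+-monoʳ-< d₁ d₁<d₂) (basis-degree B)
    where open Basis B

  uneven⇒low : ∀ {μ} → Uneven μ → Low μ
  uneven⇒low (d₁ , d₂ , B , d₁≢d₂) with ℕ.<-cmp d₁ d₂
  ... | tri< lt _ _ = basis⇒low B lt

  ... | tri≈ _ eq _ = ⊥-elim (d₁≢d₂ eq)
  ... | tri> _ _ gt = basis⇒low (basis-swap B) gt

  -- An element of degree below both exponents is a combination of elements of larger degree, hence
  -- 0; so the smaller exponent is at most the degree of the low element. As the exponents sum to
  -- |μ|, they must differ.
  low⇒basis : ∀ {μ} (L : Low μ) → ∃[ d₁ ] ∃[ d₂ ] d₁ ≤ proj₁ L × d₁ < d₂ × Basis μ d₁ d₂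
  low⇒basis {μ} (d , η , h , dη , η≉0 , d+d<) with exponents μ
  ... | d₁ , d₂ , d₁≤d₂ , s , B = d₁ , d₂ , d₁≤d ,
      ℕ.+-cancelˡ-< d₁ d₁ d₂ (ℕ.≤-<-trans (ℕ.+-mono-≤ d₁≤d d₁≤d) (ℕ.<-≤-trans d+d< (ℕ.≤-reflexive (≡.sym s)))) , B
    where
    open Basis B
    d₁≤d : d₁ ≤ d
    d₁≤d = ℕ.≮⇒≥ λ d<d₁ → let (a , b , e , e′) = span η dη in η≉0
      ( homog-low (proj₁ h) (proj₁ homog₁) (proj₁ homog₂) d<d₁ (ℕ.<-≤-trans d<d₁ d₁≤d₂) a b e
      , homog-low (proj₂ h) (proj₂ homog₁) (proj₂ homog₂) d<d₁ (ℕ.<-≤-trans d<d₁ d₁≤d₂) a b e′ )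

  low⇒uneven : ∀ {μ} → Low μ → Uneven μ
  low⇒uneven L with low⇒basis L
  ... | d₁ , d₂ , _ , d₁<d₂ , B = d₁ , d₂ , B , ℕ.<⇒≢ d₁<d₂

  -- Modulo `form i` a homogeneous `f` outside its ideal is a unit times a power of the coprime form
  -- `form (other i)`, and such a factor can be cancelled.
  form-prime-homog : ∀ i {d f} a → Homog d f → ¬ form i ∣ f → form i ∣ a * f → form i ∣ a
  form-prime-homog i a h ∤f d with leading i 0 h (_ , sym (*-identityˡ _))
  ... | divisible dvd = ⊥-elim (∤f (∣-respˡ (*-identityʳ _) dvd))
  ... | unit c n q hc u _ f≈ = unit-prime i n a u
    (∣-respʳ (trans (+-congʳ (*-congˡ f≈))
      (solve 4 (λ a x l q → a :* (con (1 , 0) :* (x :+ l :* q)) :+ :- (l :* (a :* q)) := x :* a) refl a _ (form i) q))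
      (∣-+ d (∣-neg (∣-self (form i) (a * q)))))

  -- Decidable because one constant decides it: the coefficient of the restriction to the line form
  -- i = 0.
  form^suc? : ∀ i {m d f} → Homog d f → form i ^ m ∣ f → Dec (form i ^ suc m ∣ f)
  form^suc? i {m} h dvd with leading i m h dvd
  ... | divisible d = yes d
  ... | unit c n q hc u _ f≈ = no λ { (h , f≈′) → form∤1 i (unit-prime i n 1# u
    (∣-respʳ (solve 3 (λ x l q → (x :+ l :* q) :+ :- (l :* q) := x :* con (1 , 0)) refl _ (form i) q)
      (∣-+ (h , form^-cancel i m _ _ (trans (sym f≈) (trans f≈′ (solve 3 (λ l x h → (l :* x) :* h := x :* (l :* h)) refl _ _ h))))
           (∣-neg (∣-self (form i) q))))) }

  form? : ∀ i {d f} → Homog d f → Dec (form i ∣ f)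
  form? i {f = f} h with form^suc? i {0} h (f , sym (*-identityˡ f))
  ... | yes d = yes (∣-respˡ (*-identityʳ _) d)
  ... | no ∤f = no λ d → ∤f (∣-respˡ (sym (*-identityʳ _)) d)

  -- A local maximum of Δ in its component, with Δ(ζ) = |ζ| − 2 d: by exactness θ leaves D when a multiplicity is
  -- raised, and by saturation it is not divisible by a form, so no multiplicity can be lowered profitably either.
  record Peak (ζ : Mult) (d : ℕ) : Set where
    field
      θ         : Derivation
      homog     : HomogD d θ
      inD       : D ζ θ
      exact     : ∀ i → ¬ form i ^ suc (at i ζ) ∣ val i θ
      saturated : ∀ η → det θ η ≈ 0# → ∃[ u ] η ≈ᵈ u · θ
      low       : d ℕ.+ d < ∣ ζ ∣ₘ

    θ≉0 : ¬ θ ≈ᵈ 0ᵈ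
    θ≉0 (e , e′) = exact 0F (∣-respʳ (sym e) ∣-0)

  -- The work lies in saturation. For η parallel to θ₁ the multiple `monomial ζ · η` lies in D ζ,
  -- hence equals a θ₁ + b θ₂. Parallelism forces b = 0, and since no form divides both coordinates
  -- of θ₁, all of `monomial ζ` divides a and can be cancelled.
  basis⇒peak : ∀ {ζ d₁ d₂} (B : Basis ζ d₁ d₂) → let open Basis B in d₁ < d₂ →
    (∀ i → ¬ form i ^ suc (at i ζ) ∣ val i θ₁) → (∀ i → ¬ (form i ∣ proj₁ θ₁ × form i ∣ proj₂ θ₁)) → Peak ζ d₁
  basis⇒peak {ζ} {d₁} {d₂} B d₁<d₂ exact content = record
    { θ = θ₁ ; homog = homog₁ ; inD = D₁ ; exact = exact ; saturated = saturated
    ; low = ℕ.<-≤-trans (ℕ.+-monoʳ-< d₁ d₁<d₂) (basis-degree B) }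
    where
    open Basis B
    f₁ = proj₁ θ₁
    g₁ = proj₂ θ₁
    -- At least one coordinate of θ₁ is prime to `form i`, so each factor `form i` common to the
    -- coordinates of a θ₁ must come from `a`.
    form^-content : ∀ i n a f g → form i ^ n * f ≈ a * f₁ → form i ^ n * g ≈ a * g₁ → form i ^ n ∣ a
    form^-content i zero    a f g e e′ = a , sym (*-identityˡ a)
    form^-content i (suc n) a f g e e′ = step l∣a
      where
      l∣_a : ∀ {h f} → form i ^ suc n * f ≈ h → form i ∣ h
      l∣_a e = _ , trans (sym e) (*-assoc _ _ _)
      l∣a : form i ∣ a
      l∣a with form? i (proj₁ homog₁)
      ... | no  ∤f = form-prime-homog i a (proj₁ homog₁) ∤f (l∣_a e)
      ... | yes ∣f with form? i (proj₂ homog₁)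
      ... | no  ∤g = form-prime-homog i a (proj₂ homog₁) ∤g (l∣_a e′)
      ... | yes ∣g = ⊥-elim (content i (∣f , ∣g))
      cancel : ∀ {a′ f f′} → a ≈ form i * a′ → form i ^ suc n * f ≈ a * f′ → form i ^ n * f ≈ a′ * f′
      cancel a≈ e = form-cancel i _ _ (trans (sym (*-assoc _ _ _)) (trans e (trans (*-congʳ a≈) (*-assoc _ _ _))))
      step : form i ∣ a → form i ^ suc n ∣ a
      step (a′ , a≈) =
        let (q , a′≈) = form^-content i n a′ f g (cancel a≈ e) (cancel a≈ e′)
        in q , trans a≈ (trans (*-congˡ a′≈) (sym (*-assoc _ _ q)))
    q = monomial ζ
    D-q : ∀ η → D ζ (q · η)
    D-q η i = ∣-respʳ (trans (*-comm _ _) (sym (val-· i q η))) (∣-* (val i η) (form^∣monomial i ζ))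
    saturated : ∀ η → det θ₁ η ≈ 0# → ∃[ u ] η ≈ᵈ u · θ₁
    saturated η@(f , g) parallel = conclude (monomial-∣ ζ a λ i →
        form^-content i (at i ζ) a (cofactor i ζ * f) (cofactor i ζ * g) (along i qf≈) (along i qg≈))
      where
      spanned = span (q · η) (D-q η)
      a = proj₁ spanned
      b = proj₁ (proj₂ spanned)
      e = proj₁ (proj₂ (proj₂ spanned))
      e′ = proj₂ (proj₂ (proj₂ spanned))
      zeroes : ∀ x → x * det θ₁ η ≈ 0#
      zeroes x = trans (*-congˡ parallel) (zeroʳ x)
      -- For parallel η and θ₁ the derivations f₁ q η and (q f) θ₁ agree. Substituting q η = a θ₁ +
      -- b θ₂ gives the relation (f₁ a - q f) θ₁ + (f₁ b) θ₂ = 0.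
      bf≈0 : f₁ * b ≈ 0#
      bf≈0 = proj₂ (independent (f₁ * a - q * f) (f₁ * b)
        ( trans (solve 5 (λ a b f₁ f₂ qf → (f₁ :* a :- qf) :* f₁ :+ (f₁ :* b) :* f₂ := f₁ :* (a :* f₁ :+ b :* f₂) :- qf :* f₁)
                   refl a b f₁ (proj₁ θ₂) (q * f))
            (trans (+-congʳ (*-congˡ (sym e))) (solve 2 (λ x y → x :* y :- y :* x := con (0 , 0)) refl f₁ (q * f)))
        , trans (solve 6 (λ a b f₁ g₁ g₂ qf → (f₁ :* a :- qf) :* g₁ :+ (f₁ :* b) :* g₂ := f₁ :* (a :* g₁ :+ b :* g₂) :- qf :* g₁)
                   refl a b f₁ g₁ (proj₂ θ₂) (q * f))
            (trans (+-congʳ (*-congˡ (sym e′)))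
              (trans (solve 5 (λ f₁ g₁ q f g → f₁ :* (q :* g) :- (q :* f) :* g₁ := q :* (f₁ :* g :- f :* g₁)) refl f₁ g₁ q f g)
                (zeroes q))) ))
      bg≈0 : g₁ * b ≈ 0#
      bg≈0 = proj₂ (independent (g₁ * a - q * g) (g₁ * b)
        ( trans (solve 6 (λ a b f₁ g₁ f₂ qg → (g₁ :* a :- qg) :* f₁ :+ (g₁ :* b) :* f₂ := g₁ :* (a :* f₁ :+ b :* f₂) :- qg :* f₁)
                   refl a b f₁ g₁ (proj₁ θ₂) (q * g))
            (trans (+-congʳ (*-congˡ (sym e)))
              (trans (solve 5 (λ f₁ g₁ q f g → g₁ :* (q :* f) :- (q :* g) :* f₁ := (:- q) :* (f₁ :* g :- f :* g₁)) refl f₁ g₁ q f g)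
                (zeroes (- q))))
        , trans (solve 5 (λ a b g₁ g₂ qg → (g₁ :* a :- qg) :* g₁ :+ (g₁ :* b) :* g₂ := g₁ :* (a :* g₁ :+ b :* g₂) :- qg :* g₁)
                   refl a b g₁ (proj₂ θ₂) (q * g))
            (trans (+-congʳ (*-congˡ (sym e′))) (solve 2 (λ x y → x :* y :- y :* x := con (0 , 0)) refl g₁ (q * g))) ))
      b≈0 : b ≈ 0#
      b≈0 = proj₁ (independent b 0# (trans (vanish bf≈0) refl , trans (vanish bg≈0) refl))
        where
        vanish : ∀ {x y} → x * b ≈ 0# → b * x + 0# * y ≈ 0#
        vanish {x} {y} e = trans (solve 3 (λ b x y → b :* x :+ con (0 , 0) :* y := x :* b) refl b x y) e
      only : ∀ {x y} → a * x + b * y ≈ a * x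
      only {x} {y} = trans (+-congˡ (*-congʳ b≈0)) (solve 2 (λ z y → z :+ con (0 , 0) :* y := z) refl (a * x) y)
      qf≈ : q * f ≈ a * f₁
      qf≈ = trans e only
      qg≈ : q * g ≈ a * g₁
      qg≈ = trans e′ only
      along : ∀ i {f h} → q * f ≈ h → form i ^ at i ζ * (cofactor i ζ * f) ≈ h
      along i e = trans (sym (*-assoc _ _ _)) (trans (*-congʳ (sym (monomial-cofactor i ζ))) e)
      conclude : q ∣ a → ∃[ u ] η ≈ᵈ u · θ₁
      conclude (u , a≈) = u , divide qf≈ , divide qg≈
        where
        divide : ∀ {f f′} → q * f ≈ a * f′ → f ≈ u * f′
        divide {f} {f′} e = x∙y⁻¹≈ε⇒x≈y f (u * f′) (monomial-cancel₀ ζ _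
          (trans (solve 4 (λ q f u f′ → q :* (f :- u :* f′) := q :* f :- (q :* u) :* f′) refl q f u f′)
            (x≈y⇒x∙y⁻¹≈ε (trans e (*-congʳ a≈)))))

-- The ball around a peak, and the ascent to a peak

regroup : ∀ s d → (s ℕ.+ d) ℕ.+ (s ℕ.+ d) ≡ (s ℕ.+ s) ℕ.+ (d ℕ.+ d)
regroup = solve 2 (λ s d → (s :+ d) :+ (s :+ d) := (s :+ s) :+ (d :+ d)) ≡.refl
  where open +-*-Solver

-- Twice the degree of monomial (μ ∸ₘ ζ) · θ for θ of degree d, compared with |μ|.
degree-∸ : ∀ μ ζ {d δ} → ∣ ζ ∣ₘ ≡ d ℕ.+ d ℕ.+ δ → let e = ∣ μ ∸ₘ ζ ∣ₘ ℕ.+ d in e ℕ.+ e ℕ.+ δ ≡ ∣ μ ∣ₘ ℕ.+ dist μ ζ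
degree-∸ μ ζ {d} {δ} s = ≡.trans (≡.cong (ℕ._+ δ) (regroup e d)) (≡.trans (ℕ.+-assoc (e ℕ.+ e) (d ℕ.+ d) δ)
  (≡.trans (≡.cong (e ℕ.+ e ℕ.+_) (≡.sym s)) (∣∸∣-dist μ ζ)))
  where e = ∣ μ ∸ₘ ζ ∣ₘ

balanced-at : ∀ i {μ} → Balanced μ → at i μ ℕ.+ at i μ ≤ ∣ μ ∣ₘ
balanced-at 0F {a , b , c} (h , _ , _) = ℕ.≤-trans (ℕ.+-monoʳ-≤ a (ℕ.m≤m+n a 0)) h
balanced-at 1F {a , b , c} (_ , h , _) = ℕ.≤-trans (ℕ.+-monoʳ-≤ b (ℕ.m≤m+n b 0)) h
balanced-at 2F {a , b , c} (_ , _ , h) = ℕ.≤-trans (ℕ.+-monoʳ-≤ c (ℕ.m≤m+n c 0)) h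

at-zero : Fin 3 → Mult → Mult
at-zero 0F (a , b , c) = 0 , b , c
at-zero 1F (a , b , c) = a , 0 , c
at-zero 2F (a , b , c) = a , b , 0

∣at-zero∣ : ∀ i μ → at i μ ℕ.+ ∣ at-zero i μ ∣ₘ ≡ ∣ μ ∣ₘ
∣at-zero∣ 0F (a , b , c) = ≡.sym (ℕ.+-assoc a b c)
∣at-zero∣ 1F (a , b , c) = solve 3 (λ a b c → b :+ (a :+ con 0 :+ c) := a :+ b :+ c) ≡.refl a b c
  where open +-*-Solver
∣at-zero∣ 2F (a , b , c) = solve 3 (λ a b c → c :+ (a :+ b :+ con 0) := a :+ b :+ c) ≡.refl a b c
  where open +-*-Solver

three : ∀ e → 3 ℕ.+ (e ℕ.+ e ℕ.+ e) ≡ suc e ℕ.+ suc e ℕ.+ suc e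
three = solve 1 (λ e → con 3 :+ (e :+ e :+ e) := (con 1 :+ e) :+ (con 1 :+ e) :+ (con 1 :+ e)) ≡.refl
  where open +-*-Solver

module Balls (P : Plane) where
  open Peaks P public

  D-∸ : ∀ μ ζ {θ} → D ζ θ → D μ (monomial (μ ∸ₘ ζ) · θ)
  D-∸ μ ζ {θ} d i with d i | form^∣monomial i (μ ∸ₘ ζ)
  ... | q , v≈ | r , m≈ = ∣-trans (^-∣ (form i) bound) (r * q , trans (val-· i _ θ) (trans (*-cong m≈ v≈)
      (trans (solve 4 (λ x r y q → (x :* r) :* (y :* q) := (x :* y) :* (r :* q)) refl _ r _ q)
        (*-congʳ (sym (^-homo-* (form i) (at i (μ ∸ₘ ζ)) (at i ζ)))))))
    where
    bound : at i μ ≤ at i (μ ∸ₘ ζ) ℕ.+ at i ζ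
    bound = ℕ.≤-trans (ℕ.m≤n+m∸n (at i μ) (at i ζ))
      (ℕ.≤-reflexive (≡.trans (ℕ.+-comm (at i ζ) _) (≡.cong (ℕ._+ at i ζ) (≡.sym (at-∸ i μ ζ)))))

  form^-divides : ∀ i k {d f} u → Homog d f → ¬ form i ∣ f → form i ^ k ∣ u * f → form i ^ k ∣ u
  form^-divides i zero    u h ∤f d = u , sym (*-identityˡ u)
  form^-divides i (suc k) {f = f} u h ∤f d@(q , uf≈) =
    let (u′ , u≈)  = form-prime-homog i u h ∤f (∣-trans (∣-self (form i) (form i ^ k)) d)
        (r , u′≈) = form^-divides i k u′ h ∤f (q , form-cancel i _ _
          (trans (sym (*-assoc _ _ f)) (trans (*-congʳ (sym u≈)) (trans uf≈ (*-assoc _ _ q)))))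
    in r , trans u≈ (trans (*-congˡ u′≈) (sym (*-assoc _ _ r)))

  det-·ˡ : ∀ m θ η → m * det θ η ≈ det (m · θ) η
  det-·ˡ m (f , g) (f′ , g′) =
    solve 5 (λ m f g f′ g′ → m :* (f :* g′ :- f′ :* g) := (m :* f) :* g′ :- f′ :* (m :* g)) refl m f g f′ g′

  *-swapʳ : ∀ f g h → (f * g) * h ≈ (f * h) * g
  *-swapʳ = solve 3 (λ f g h → (f :* g) :* h := (f :* h) :* g) refl

  module _ {ζ d} (K : Peak ζ d) where
    open Peak K

    -- By exactness val i θ is form i ^ at i ζ times a factor prime to `form i`, so whatever D μ
    -- demands beyond `at i ζ` has to be supplied by `u`.
    D-·⁻ : ∀ {μ} u → D μ (u · θ) → monomial (μ ∸ₘ ζ) ∣ u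
    D-·⁻ {μ} u dvd = monomial-∣ (μ ∸ₘ ζ) u λ i → go i (inD i) (dvd i)
      where
      go : ∀ i → form i ^ at i ζ ∣ val i θ → form i ^ at i μ ∣ val i (u · θ) → form i ^ at i (μ ∸ₘ ζ) ∣ u
      go i (f , v≈) (q , uv≈) rewrite at-∸ i μ ζ with ℕ.≤-total (at i μ) (at i ζ)
      ... | inj₁ le rewrite ℕ.m≤n⇒m∸n≡0 le = u , sym (*-identityˡ u)
      ... | inj₂ ge = form^-divides i (at i μ ∸ at i ζ) u (homog-quotient^ i (at i ζ) {d ∸ at i ζ} f
              (homog-cast degree (homog-cong v≈ (homog-val i homog))))
              ∤f (q , form^-cancel i (at i ζ) _ _ product)
        where
        l = form i
        ∤f : ¬ l ∣ f
        ∤f (g , f≈) = exact i (g , trans v≈ (trans (*-congˡ f≈) (solve 3 (λ x l g → x :* (l :* g) := (l :* x) :* g) refl _ _ g)))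
        -- If `d` were less than the multiplicity, val i θ would be 0 and exactness would fail.
        degree : d ≡ at i ζ ℕ.+ (d ∸ at i ζ)
        degree = ≡.sym (ℕ.m+[n∸m]≡n (ℕ.≮⇒≥ λ lt → exact i
          (∣-respʳ (sym (homog-∣ (homog-val i homog) (homog-^ (at i ζ) (homog-form i)) lt (f , v≈))) ∣-0)))
        product : l ^ at i ζ * (u * f) ≈ l ^ at i ζ * (l ^ (at i μ ∸ at i ζ) * q)
        product = trans (solve 3 (λ x u f → x :* (u :* f) := u :* (x :* f)) refl _ u f)
          (trans (*-congˡ (sym v≈)) (trans (sym (val-· i u θ)) (trans uv≈ (trans
            (*-congʳ (trans (reflexive (≡.cong (l ^_) (≡.sym (ℕ.m+[n∸m]≡n ge)))) (^-homo-* l (at i ζ) _)))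
            (*-assoc _ _ q)))))

    low-inside : ∀ μ {δ} → ∣ ζ ∣ₘ ≡ d ℕ.+ d ℕ.+ δ → dist μ ζ < δ → Low μ
    low-inside μ {δ} s near = ∣ t ∣ₘ ℕ.+ d , monomial t · θ , homog-· (homog-monomial t) homog , D-∸ μ ζ inD ,
      (λ (e , e′) → θ≉0 (monomial-cancel₀ t _ e , monomial-cancel₀ t _ e′)) ,
      ℕ.+-cancelʳ-< (dist μ ζ) _ _ (ℕ.<-≤-trans (ℕ.+-monoʳ-< _ near) (ℕ.≤-reflexive (degree-∸ μ ζ s)))
      where t = μ ∸ₘ ζ

    not-low-boundary : ∀ μ {δ} → ∣ ζ ∣ₘ ≡ d ℕ.+ d ℕ.+ δ → dist μ ζ ≡ δ → ¬ Low μ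
    not-low-boundary μ {δ} s far (e , η , hη , dη , η≉0 , e+e<) = conclude (saturated η parallel)
      where
      t = μ ∸ₘ ζ
      n = ∣ t ∣ₘ ℕ.+ d
      n+n : n ℕ.+ n ≡ ∣ μ ∣ₘ
      n+n = ℕ.+-cancelʳ-≡ δ _ _ (≡.trans (degree-∸ μ ζ s) (≡.cong (∣ μ ∣ₘ ℕ.+_) far))
      e<n : e < n
      e<n = ℕ.≰⇒> λ n≤e → ℕ.<⇒≱ e+e< (ℕ.≤-trans (ℕ.≤-reflexive (≡.sym n+n)) (ℕ.+-mono-≤ n≤e n≤e))
      hθ : HomogD n (monomial t · θ)
      hθ = homog-· (homog-monomial t) homog
      parallel : det θ η ≈ 0#
      parallel = monomial-cancel₀ t _ (trans
        (det-·ˡ (monomial t) θ η)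
        (homog-∣ (homog-det {n} {e} {monomial t · θ} {η} hθ hη) (homog-monomial μ) (ℕ.<-≤-trans (ℕ.+-monoʳ-< n e<n) (ℕ.≤-reflexive n+n))
          (monomial-∣-det {μ} {monomial t · θ} {η} (D-∸ μ ζ {θ} inD) dη)))
      conclude : ∃[ u ] η ≈ᵈ u · θ → ⊥
      conclude (u , e₁ , e₂) = η≉0 (homog-∣ (proj₁ hη) (proj₁ hθ) e<n (multiple e₁) , homog-∣ (proj₂ hη) (proj₂ hθ) e<n (multiple e₂))
        where
        -- A multiple of θ in D μ is a multiple of `monomial t · θ`, whose degree `n` exceeds that
        -- of η.
        t∣u : monomial t ∣ u
        t∣u = D-·⁻ {μ} u (D-≈ {μ} {η} {u · θ} (e₁ , e₂) dη)
        multiple : ∀ {f g} → f ≈ u * g → monomial t * g ∣ f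
        multiple {f} {g} e = proj₁ t∣u , trans e (trans (*-congʳ (proj₂ t∣u)) (*-swapʳ (monomial t) (proj₁ t∣u) g))

  AdjacentLow : Mult → Mult → Set
  AdjacentLow μ ν = Adjacent μ ν × Low μ × Low ν

  module _ {d f g} (h : HomogD d (f , g)) (θ≉0 : ¬ (f , g) ≈ᵈ 0ᵈ) where

    -- If val i θ = 0, then the other two values agree up to sign, so the remaining two powers divide a single
    -- nonzero polynomial.
    degree-at-zero : ∀ i {μ} → D μ (f , g) → val i (f , g) ≈ 0# → ∣ at-zero i μ ∣ₘ ≤ d
    degree-at-zero i {μ} dθ = others i dθ
      where
      rest : ∀ ν {d f} → Homog d f → (∀ j → form j ^ at j ν ∣ f) → ¬ f ≈ 0# → ∣ ν ∣ₘ ≤ d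
      rest ν {f = f} hf dvd f≉0 = ℕ.≮⇒≥ λ lt → f≉0 (homog-∣ hf (homog-monomial ν) lt (monomial-∣ ν f dvd))
      others : ∀ i → D μ (f , g) → val i (f , g) ≈ 0# → ∣ at-zero i μ ∣ₘ ≤ d
      others 0F dθ f≈0 = rest (at-zero 0F μ) (proj₂ h)
        (λ { 0F → _ , sym (*-identityˡ g) ; 1F → dθ 1F ; 2F → ∣-respʳ (trans (+-congʳ f≈0) (+-identityˡ g)) (dθ 2F) })
        (λ g≈0 → θ≉0 (f≈0 , g≈0))
      others 1F dθ g≈0 = rest (at-zero 1F μ) (proj₁ h)
        (λ { 0F → dθ 0F ; 1F → _ , sym (*-identityˡ f) ; 2F → ∣-respʳ (trans (+-congˡ g≈0) (+-identityʳ f)) (dθ 2F) })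
        (λ f≈0 → θ≉0 (f≈0 , g≈0))
      others 2F dθ f+g≈0 = rest (at-zero 2F μ) (proj₁ h)
        (λ { 0F → dθ 0F ; 1F → ∣-respʳ (sym f≈-g) (∣-neg (dθ 1F)) ; 2F → _ , sym (*-identityˡ f) })
        (λ f≈0 → θ≉0 (f≈0 , trans (sym (+-identityˡ g)) (trans (+-congʳ (sym f≈0)) f+g≈0)))
        where
        f≈-g : f ≈ - g
        f≈-g = x∙y⁻¹≈ε⇒x≈y f (- g) (trans (solve 2 (λ f g → f :- (:- g) := f :+ g) refl f g) f+g≈0)

    -- A multiplicity above `d` makes the value at `form i` vanish; then the other two
    -- multiplicities sum to at most `d`. Balancedness bounds `at i μ` by that sum, so |μ| ≤ 2 d,
    -- contrary to lowness.
    balanced⇒at≤degree : ∀ i {μ} → Balanced μ → D μ (f , g) → d ℕ.+ d < ∣ μ ∣ₘ → at i μ ≤ d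
    balanced⇒at≤degree i {μ} bal dθ d+d< = ℕ.≮⇒≥ λ d<m →
      let r≤d = degree-at-zero i dθ (homog-∣ (homog-val i h) (homog-^ (at i μ) (homog-form i)) d<m (dθ i))
      in ℕ.<⇒≱ d+d< (ℕ.≤-trans (ℕ.≤-reflexive (≡.sym (∣at-zero∣ i μ)))
           (ℕ.≤-trans (ℕ.+-monoˡ-≤ r m≤r) (ℕ.+-mono-≤ r≤d r≤d)))
      where
      r = ∣ at-zero i μ ∣ₘ
      m≤r : at i μ ≤ r
      m≤r = ℕ.+-cancelˡ-≤ (at i μ) _ _ (ℕ.≤-trans (balanced-at i {μ} bal) (ℕ.≤-reflexive (≡.sym (∣at-zero∣ i μ))))

    balanced⇒bounded : ∀ {μ} → Balanced μ → D μ (f , g) → d ℕ.+ d < ∣ μ ∣ₘ → ∣ μ ∣ₘ ≤ d ℕ.+ d ℕ.+ d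
    balanced⇒bounded {μ} bal dθ d+d< = ℕ.+-mono-≤ (ℕ.+-mono-≤ (at≤ 0F) (at≤ 1F)) (at≤ 2F)
      where
      at≤ : ∀ i → at i μ ≤ d
      at≤ i = balanced⇒at≤degree i {μ} bal dθ d+d<

  D-form⁻ : ∀ i {ν f g θ} → proj₁ θ ≈ form i * f → proj₂ θ ≈ form i * g → D (inc i ν) θ → D ν (f , g)
  D-form⁻ i {ν} {f} {g} {θ} e e′ d j with j Fin.≟ i
  ... | yes ≡.refl = let (q , v≈) = D-inc⁻ i d in q , form-cancel i _ _ (trans (sym (val-· i (form i) (f , g)))
    (trans (val-cong i (sym e , sym e′)) (trans v≈ (*-assoc _ _ q))))
  D-form⁻ i {ν} {f} {g} {θ} e e′ d j | no j≢i = ≡.subst (λ m → form j ^ m ∣ val j (f , g)) (at-inc-≢ i j ν j≢i)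
    (≡.subst (λ m → form j ^ at j (inc i ν) ∣ m) ≡.refl
      (form^-coprime j i j≢i (at j (inc i ν)) 1 _ (∣-respʳ
        (trans (val-cong j (e , e′)) (trans (val-· j (form i) (f , g)) (*-congʳ (sym (*-identityʳ _))))) (d j))))

  divide-form : ∀ i {d θ} → HomogD d θ → ¬ θ ≈ᵈ 0ᵈ → form i ∣ proj₁ θ → form i ∣ proj₂ θ →
    ∃[ e ] ∃[ η ] d ≡ suc e × HomogD e η × (¬ η ≈ᵈ 0ᵈ) × θ ≈ᵈ form i · η
  divide-form i {zero} (h , h′) θ≉0 df dg =
    ⊥-elim (θ≉0 (homog-∣ h (homog-form i) (s≤s z≤n) df , homog-∣ h′ (homog-form i) (s≤s z≤n) dg))
  divide-form i {suc d} (h , h′) θ≉0 (f , e) (g , e′) =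
    d , (f , g) , ≡.refl , (homog-quotient i f (homog-cong e h) , homog-quotient i g (homog-cong e′ h′)) ,
    (λ (z , z′) → θ≉0 (trans e (trans (*-congˡ z) (zeroʳ _)) , trans e′ (trans (*-congˡ z′) (zeroʳ _)))) , e , e′

  -- The fuel exceeds 3 d - |μ|. Raising a multiplicity lowers this number by 1, dividing θ by a
  -- form lowers it by 2, and `balanced⇒bounded` keeps it nonnegative. Each round first passes to a
  -- basis element of least degree, so that at the end θ belongs to a basis, as `basis⇒peak`
  -- requires.
  ascend : ∀ n {μ} (L : Low μ) → let d = proj₁ L in d ℕ.+ d ℕ.+ d < ∣ μ ∣ₘ ℕ.+ n →
           (∀ ν → Star AdjacentLow μ ν → Balanced ν) → ∃[ ζ ] ∃[ d ] Star AdjacentLow μ ζ × Peak ζ d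
  ascend zero {μ} (d , θ , h , dθ , θ≉0 , low) fuel bal =
    ⊥-elim (ℕ.<⇒≱ fuel (ℕ.≤-trans (ℕ.≤-reflexive (ℕ.+-identityʳ _)) (balanced⇒bounded h θ≉0 {μ} (bal μ ε) dθ low)))
  ascend (suc n) {μ} L fuel bal = go
    (Fin.any? λ i → form^suc? i {at i μ} (homog-val i homog₁) (D₁ i))
    (Fin.any? λ i → form? i (proj₁ homog₁) ×-dec form? i (proj₂ homog₁))
    where
    lowest = low⇒basis L
    d₁ = proj₁ lowest
    d₁≤ = proj₁ (proj₂ (proj₂ lowest))
    d₁<d₂ = proj₁ (proj₂ (proj₂ (proj₂ lowest)))
    B = proj₂ (proj₂ (proj₂ (proj₂ lowest)))
    open Basis B
    low : Low μ
    low = basis⇒low B d₁<d₂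
    low< : d₁ ℕ.+ d₁ < ∣ μ ∣ₘ
    low< = proj₂ (proj₂ (proj₂ (proj₂ (proj₂ low))))
    fuel′ : d₁ ℕ.+ d₁ ℕ.+ d₁ < ∣ μ ∣ₘ ℕ.+ suc n
    fuel′ = ℕ.≤-<-trans (ℕ.+-mono-≤ (ℕ.+-mono-≤ d₁≤ d₁≤) d₁≤) fuel
    continue : ∀ {ν} → Adjacent μ ν → (L′ : Low ν) → let d = proj₁ L′ in d ℕ.+ d ℕ.+ d < ∣ ν ∣ₘ ℕ.+ n →
               ∃[ ζ ] ∃[ d ] Star AdjacentLow μ ζ × Peak ζ d
    continue adj L′ fuel″ =
      let (ζ , d , s , K) = ascend n L′ fuel″ (λ ν s → bal ν ((adj , low , L′) ◅ s))
      in ζ , d , (adj , low , L′) ◅ s , K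
    go : Dec (∃[ i ] form i ^ suc (at i μ) ∣ val i θ₁) → Dec (∃[ i ] form i ∣ proj₁ θ₁ × form i ∣ proj₂ θ₁) →
         ∃[ ζ ] ∃[ d ] Star AdjacentLow μ ζ × Peak ζ d
    go (yes (i , dvd)) _ = continue (inj₁ (step-inc i))
      (d₁ , θ₁ , homog₁ , D-inc i D₁ dvd , basis-θ₁≉0 B ,
        ℕ.<-≤-trans (ℕ.m<n⇒m<1+n low<) (ℕ.≤-reflexive (≡.sym (∣inc∣ i μ))))
      (ℕ.<-≤-trans fuel′ (ℕ.≤-reflexive (≡.trans (ℕ.+-suc _ n) (≡.cong (ℕ._+ n) (≡.sym (∣inc∣ i μ))))))
    go (no exact) (yes (i , df , dg)) = descend (inc⁻ i μ) (divide-form i homog₁ (basis-θ₁≉0 B) df dg)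
      where
      descend : at i μ ≡ 0 ⊎ ∃[ ν ] inc i ν ≡ μ →
        ∃[ e ] ∃[ η ] d₁ ≡ suc e × HomogD e η × (¬ η ≈ᵈ 0ᵈ) × θ₁ ≈ᵈ form i · η →
        ∃[ ζ ] ∃[ d ] Star AdjacentLow μ ζ × Peak ζ d
      -- With multiplicity 0 at i, divisibility of θ₁ by `form i` would allow raising that
      -- multiplicity, a case already excluded.
      descend (inj₁ m≡0) (e , η , _ , _ , _ , eq) = ⊥-elim (exact (i ,
        ≡.subst (λ m → form i ^ suc m ∣ val i θ₁) (≡.sym m≡0)
          (∣-respˡ (sym (*-identityʳ _)) (val i η , trans (val-cong i eq) (val-· i (form i) η)))))
      descend (inj₂ (ν , ≡.refl)) (e , η , d₁≡ , hη , η≉0 , eq , eq′) = continue (inj₂ (step-inc i))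
        (e , η , hη , D-form⁻ i eq eq′ D₁ , η≉0 , ℕ.≤-pred (ℕ.≤-pred (ℕ.≤-trans
          (ℕ.≤-reflexive (≡.cong (λ m → suc (suc m)) (≡.sym (ℕ.+-suc e e))))
          (ℕ.m≤n⇒m≤1+n (ℕ.≤-trans (≡.subst (λ d → d ℕ.+ d < ∣ inc i ν ∣ₘ) d₁≡ low<) (ℕ.≤-reflexive (∣inc∣ i ν)))))))
        (ℕ.≤-pred (ℕ.≤-pred (ℕ.<-trans (ℕ.≤-reflexive (three e))
          (ℕ.≤-trans (≡.subst (λ d → d ℕ.+ d ℕ.+ d < ∣ inc i ν ∣ₘ ℕ.+ suc n) d₁≡ fuel′)
            (ℕ.≤-reflexive (≡.trans (≡.cong (ℕ._+ suc n) (∣inc∣ i ν)) (≡.cong suc (ℕ.+-suc ∣ ν ∣ₘ n))))))))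
    go (no exact) (no content) = μ , d₁ , ε , basis⇒peak B d₁<d₂ (λ i d → exact (i , d)) (λ i d → content (i , d))

-- Frobenius descent of peaks

record IsPartial (P : Plane) (∂ : Plane.Carrier P → Plane.Carrier P) : Set where
  open Plane P
  field
    ∂-cong  : ∀ {f g} → f ≈ g → ∂ f ≈ ∂ g
    ∂-+     : ∀ f g → ∂ (f + g) ≈ ∂ f + ∂ g
    ∂-*     : ∀ f g → ∂ (f * g) ≈ f * ∂ g + ∂ f * g
    ∂-homog : ∀ {n f} → Homog (suc n) f → Homog n (∂ f)
    ∂-const : ∀ {f} → Homog 0 f → ∂ f ≈ 0#

-- φ substitutes x ↦ x^p, y ↦ y^p and π extracts the terms x^(p i) y^(p j) as x^i y^j.
record Frobenius (P : Plane) (p : ℕ) : Set where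
  open Plane P
  open Algebra.Definitions.RawSemiring (Semiring.rawSemiring semiring) using (_^_) renaming (_×_ to _⨯_)
  field
    characteristic : ∀ f → p ⨯ f ≈ 0#
    ∂X ∂Y     : Carrier → Carrier
    partial-X : IsPartial P ∂X
    partial-Y : IsPartial P ∂Y
    ∂X-Y      : ∂X Y ≈ 0#
    ∂Y-X      : ∂Y X ≈ 0#
    φ π       : Carrier → Carrier
    φ-cong    : ∀ {f g} → f ≈ g → φ f ≈ φ g
    φ-+       : ∀ f g → φ (f + g) ≈ φ f + φ g
    φ-*       : ∀ f g → φ (f * g) ≈ φ f * φ g
    φ-1       : φ 1# ≈ 1#
    φ-X       : φ X ≈ X ^ p
    φ-Y       : φ Y ≈ Y ^ p
    π-cong    : ∀ {f g} → f ≈ g → π f ≈ π g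
    -- The projection formula: π is linear when the ring acts on its source through φ.
    π-φ*      : ∀ f g → π (φ f * g) ≈ f * π g
    π-1       : π 1# ≈ 1#
    π-homog   : ∀ {n f} → Homog (p ℕ.* n) f → Homog n (π f)
    π-homog-∤ : ∀ {d f} → ¬ p ℕ.∣ d → Homog d f → π f ≈ 0#
    φ-π       : ∀ {f} → ∂X f ≈ 0# → ∂Y f ≈ 0# → f ≈ φ (π f)

tabulateₘ : (Fin 3 → ℕ) → Mult
tabulateₘ m = m 0F , m 1F , m 2F

at-tabulate : ∀ i m → at i (tabulateₘ m) ≡ m i
at-tabulate 0F m = ≡.refl
at-tabulate 1F m = ≡.refl
at-tabulate 2F m = ≡.refl

∣scale∣ : ∀ n μ → ∣ scale n μ ∣ₘ ≡ n ℕ.* ∣ μ ∣ₘ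
∣scale∣ n (a , b , c) = solve 4 (λ n a b c → n :* a :+ n :* b :+ n :* c := n :* (a :+ b :+ c)) ≡.refl n a b c
  where open +-*-Solver

distrib₃ : ∀ p d e → p ℕ.* (d ℕ.+ d ℕ.+ e) ≡ (p ℕ.* d ℕ.+ p ℕ.* d) ℕ.+ p ℕ.* e
distrib₃ = solve 3 (λ p d e → p :* (d :+ d :+ e) := (p :* d :+ p :* d) :+ p :* e) ≡.refl
  where open +-*-Solver

-- The divisibility that survives a derivation killing `form k`: powers of `form k` are constants
-- for it and lose nothing, the other two lose one factor each.
lower : Fin 3 → Mult → Mult
lower 0F (a , b , c) = a , b ∸ 1 , c ∸ 1
lower 1F (a , b , c) = a ∸ 1 , b , c ∸ 1
lower 2F (a , b , c) = a ∸ 1 , b ∸ 1 , c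

lower-≤ : ∀ k i ζ → at i (lower k ζ) ≤ at i ζ ∸ 1 ⊎ i ≡ k × at i (lower k ζ) ≡ at i ζ
lower-≤ 0F 0F ζ = inj₂ (≡.refl , ≡.refl)
lower-≤ 0F 1F ζ = inj₁ ℕ.≤-refl
lower-≤ 0F 2F ζ = inj₁ ℕ.≤-refl
lower-≤ 1F 0F ζ = inj₁ ℕ.≤-refl
lower-≤ 1F 1F ζ = inj₂ (≡.refl , ≡.refl)
lower-≤ 1F 2F ζ = inj₁ ℕ.≤-refl
lower-≤ 2F 0F ζ = inj₁ ℕ.≤-refl
lower-≤ 2F 1F ζ = inj₁ ℕ.≤-refl
lower-≤ 2F 2F ζ = inj₂ (≡.refl , ≡.refl)

∣lower∣ : ∀ k ζ → ∣ ζ ∣ₘ ≤ 2 ℕ.+ ∣ lower k ζ ∣ₘ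
∣lower∣ k (a , b , c) = go k
  where
  open +-*-Solver
  pred : ∀ n → n ≤ 1 ℕ.+ (n ∸ 1)
  pred n = ℕ.m≤n+m∸n n 1
  go : ∀ k → a ℕ.+ b ℕ.+ c ≤ 2 ℕ.+ ∣ lower k (a , b , c) ∣ₘ
  go 0F = ℕ.≤-trans (ℕ.+-mono-≤ (ℕ.+-monoʳ-≤ a (pred b)) (pred c)) (ℕ.≤-reflexive
    (solve 3 (λ a b c → a :+ (con 1 :+ b) :+ (con 1 :+ c) := con 2 :+ (a :+ b :+ c)) ≡.refl a (b ∸ 1) (c ∸ 1)))
  go 1F = ℕ.≤-trans (ℕ.+-mono-≤ (ℕ.+-monoˡ-≤ b (pred a)) (pred c)) (ℕ.≤-reflexive
    (solve 3 (λ a b c → (con 1 :+ a) :+ b :+ (con 1 :+ c) := con 2 :+ (a :+ b :+ c)) ≡.refl (a ∸ 1) b (c ∸ 1)))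
  go 2F = ℕ.≤-trans (ℕ.+-mono-≤ (ℕ.+-mono-≤ (pred a) (pred b)) ℕ.≤-refl) (ℕ.≤-reflexive
    (solve 3 (λ a b c → (con 1 :+ a) :+ (con 1 :+ b) :+ c := con 2 :+ (a :+ b :+ c)) ≡.refl (a ∸ 1) (b ∸ 1) c))

module Descent (P : Plane) (p : ℕ) (1<p : 1 < p) (F : Frobenius P p) where
  open Balls P public
  open Frobenius F
  open import Algebra.Definitions.RawMonoid +-rawMonoid using () renaming (_×_ to _⨯_)

  module _ {∂ : Carrier → Carrier} (partial : IsPartial P ∂) where
    open IsPartial partial

    ^-∣-∂ : ∀ g m → g ^ m ∣ ∂ (g ^ suc m)
    ^-∣-∂ g zero    = _ , sym (*-identityˡ _)
    ^-∣-∂ g (suc m) =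
      let (q , e) = ^-∣-∂ g m in
      ∣-respʳ (sym (∂-* g (g ^ suc m))) (∣-+ (q , trans (*-congˡ e) (sym (*-assoc _ _ q))) (∣-* (∂ g) (1# , sym (*-identityʳ _))))

    ∂-∣ : ∀ g m {f} → g ^ m ∣ f → g ^ (m ∸ 1) ∣ ∂ f
    ∂-∣ g zero    d       = _ , sym (*-identityˡ _)
    ∂-∣ g (suc m) (q , e) = ∣-respʳ (sym (trans (∂-cong e) (∂-* _ q)))
      (∣-+ (∣-trans (^-∣ g {m} {suc m} (ℕ.n≤1+n m)) (∣-self _ (∂ q)))
           (∣-respʳ (*-comm q _) (∣-* q (^-∣-∂ g m))))

    ∂-^≈0 : ∀ {g} → ∂ g ≈ 0# → ∀ m → ∂ (g ^ m) ≈ 0#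
    ∂-^≈0 e zero    = ∂-const homog-1
    ∂-^≈0 {g} e (suc m) = trans (∂-* g (g ^ m)) (trans (+-cong (*-congˡ (∂-^≈0 e m)) (*-congʳ e))
      (solve 2 (λ g h → g :* con (0 , 0) :+ con (0 , 0) :* h := con (0 , 0)) refl g (g ^ m)))

    ∂-∣-constant : ∀ {g} → ∂ g ≈ 0# → ∀ m {f} → g ^ m ∣ f → g ^ m ∣ ∂ f
    ∂-∣-constant {g} ∂g≈0 m (q , e) = ∂ q , trans (∂-cong e) (trans (∂-* _ q) (trans (+-congˡ (*-congʳ (∂-^≈0 ∂g≈0 m)))
      (solve 2 (λ x q → x :+ con (0 , 0) :* q := x) refl _ q)))

    ∂-power : ∀ g n → ∂ (g ^ suc n) ≈ (suc n ⨯ g ^ n) * ∂ g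
    ∂-power g zero    = trans (∂-cong (*-identityʳ g)) (solve 1 (λ d → d := (con (1 , 0) :+ con (0 , 0)) :* d) refl (∂ g))
    ∂-power g (suc n) = trans (∂-* g (g ^ suc n)) (trans (+-congʳ (*-congˡ (∂-power g n)))
      (trans (solve 4 (λ g s d h → g :* (s :* d) :+ d :* h := (h :+ g :* s) :* d) refl g _ (∂ g) (g ^ suc n))
        (*-congʳ (+-congˡ (×-comm-* (suc n) g (g ^ n))))))
      where open import Algebra.Properties.Semiring.Mult semiring using (×-comm-*)

    ∂-pth-power : ∀ g → ∂ (g ^ p) ≈ 0#
    ∂-pth-power g = power p 1<p (characteristic (g ^ (p ∸ 1)))
      where
      power : ∀ q → 1 < q → q ⨯ g ^ (q ∸ 1) ≈ 0# → ∂ (g ^ q) ≈ 0#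
      power (suc q) _ e = trans (∂-power g q) (trans (*-congʳ e) (zeroˡ _))

    ∂ᵈ : Derivation → Derivation
    ∂ᵈ (f , g) = ∂ f , ∂ g

    val-∂ᵈ : ∀ i θ → val i (∂ᵈ θ) ≈ ∂ (val i θ)
    val-∂ᵈ 0F θ = refl
    val-∂ᵈ 1F θ = refl
    val-∂ᵈ 2F (f , g) = sym (∂-+ f g)

    -- The Wronskian det θ (∂ θ) has degree 2 d - 1 but is divisible by a monomial of degree ≥ |ζ| - 2.
    peak-∂≈0 : ∀ k → ∂ (form k) ≈ 0# → ∀ {ζ d} (K : Peak ζ d) → 2 ℕ.+ (d ℕ.+ d) ≤ ∣ ζ ∣ₘ → ∂ᵈ (Peak.θ K) ≈ᵈ 0ᵈ
    peak-∂≈0 k ∂k≈0 {ζ} {zero}  K gap = ∂-const (proj₁ (Peak.homog K)) , ∂-const (proj₂ (Peak.homog K))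
    peak-∂≈0 k ∂k≈0 {ζ} {suc d} K gap = conclude (saturated (∂ᵈ θ) wronskian≈0)
      where
      open Peak K
      h∂ : HomogD d (∂ᵈ θ)
      h∂ = ∂-homog (proj₁ homog) , ∂-homog (proj₂ homog)
      D-lower : D (lower k ζ) θ
      D-lower i = ∣-trans (^-∣ (form i) (le (lower-≤ k i ζ))) (inD i)
        where
        le : at i (lower k ζ) ≤ at i ζ ∸ 1 ⊎ i ≡ k × at i (lower k ζ) ≡ at i ζ → at i (lower k ζ) ≤ at i ζ
        le (inj₁ l)       = ℕ.≤-trans l (ℕ.m∸n≤m (at i ζ) 1)
        le (inj₂ (_ , e)) = ℕ.≤-reflexive e
      D-∂ : D (lower k ζ) (∂ᵈ θ)
      D-∂ i = ∣-respʳ (sym (val-∂ᵈ i θ)) (dvd (lower-≤ k i ζ))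
        where
        dvd : at i (lower k ζ) ≤ at i ζ ∸ 1 ⊎ i ≡ k × at i (lower k ζ) ≡ at i ζ → form i ^ at i (lower k ζ) ∣ ∂ (val i θ)
        dvd (inj₁ l)            = ∣-trans (^-∣ (form i) l) (∂-∣ (form i) (at i ζ) (inD i))
        dvd (inj₂ (≡.refl , e)) = ≡.subst (λ m → form k ^ m ∣ ∂ (val k θ)) (≡.sym e) (∂-∣-constant ∂k≈0 (at k ζ) (inD k))
      wronskian≈0 : det θ (∂ᵈ θ) ≈ 0#
      wronskian≈0 = homog-∣ (homog-det {θ = θ} {∂ᵈ θ} homog h∂) (homog-monomial (lower k ζ))
        (ℕ.≤-trans (ℕ.≤-reflexive (≡.cong suc (≡.sym (ℕ.+-suc d d)))) (ℕ.≤-pred (ℕ.≤-pred (ℕ.≤-trans gap (∣lower∣ k ζ)))))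
        (monomial-∣-det {lower k ζ} {θ} {∂ᵈ θ} D-lower D-∂)
      conclude : ∃[ u ] ∂ᵈ θ ≈ᵈ u · θ → ∂ᵈ θ ≈ᵈ 0ᵈ
      conclude (u , e , e′) = homog-∣ (proj₁ h∂) (proj₁ homog) ℕ.≤-refl (u , trans e (*-comm u _)) ,
                              homog-∣ (proj₂ h∂) (proj₂ homog) ℕ.≤-refl (u , trans e′ (*-comm u _))

  φ-0 : φ 0# ≈ 0#
  φ-0 = trans (solve 1 (λ x → x := (x :+ x) :- x) refl (φ 0#))
    (trans (+-congʳ (trans (sym (φ-+ 0# 0#)) (φ-cong (+-identityʳ 0#)))) (-‿inverseʳ (φ 0#)))

  φ-neg : ∀ f → φ (- f) ≈ - φ f
  φ-neg f = trans (solve 2 (λ x y → x := (x :+ y) :- y) refl (φ (- f)) (φ f))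
    (trans (+-congʳ (trans (sym (φ-+ (- f) f)) (trans (φ-cong (-‿inverseˡ f)) φ-0))) (+-identityˡ _))

  φ-^ : ∀ f n → φ (f ^ n) ≈ φ f ^ n
  φ-^ f zero    = φ-1
  φ-^ f (suc n) = trans (φ-* f (f ^ n)) (*-congˡ (φ-^ f n))

  form∣form^p : ∀ i → form i ∣ form i ^ p
  form∣form^p i = positive p 1<p
    where
    positive : ∀ q → 1 < q → form i ∣ form i ^ q
    positive (suc q) _ = ∣-self (form i) (form i ^ q)

  -- On the line form i = 0 the polynomial `f` is c t ^ n with c a unit; φ turns this into φ(c) t ^
  -- (p n), where φ(c) is again a unit, so `form i` still does not divide it.
  φ-form∤ : ∀ i {d f} → Homog d f → ¬ form i ∣ f → (∀ j → φ (form j) ≈ form j ^ p) → ¬ form i ∣ φ f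
  φ-form∤ i {d} {f} h ∤f φ-form ∣φf = go (leading i 0 h (f , sym (*-identityˡ f)))
    where
    l = form i
    t = form (other i)
    go : Leading i 0 d f → ⊥
    go (divisible dvd) = ∤f (∣-respˡ (*-identityʳ _) dvd)
    go (unit c n q hc (c′ , _ , cc′) _ f≈) = form∤1 i (iterate n (∣-respʳ simplify (∣-+ (∣-* (φ c′) ∣φf) (∣-neg (∣-* (φ c′) l∣φl*)))))
      where
      l∣φl* : l ∣ φ l * φ q
      l∣φl* = ∣-trans (∣-respʳ (sym (φ-form i)) (form∣form^p i)) (∣-self (φ l) (φ q))
      expand : φ f ≈ φ c * φ t ^ n + φ l * φ q
      expand = trans (φ-cong (trans f≈ (*-identityˡ _))) (trans (φ-+ _ _)
        (+-cong (trans (φ-* c _) (*-congˡ (φ-^ t n))) (φ-* l q)))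
      simplify : φ c′ * φ f + - (φ c′ * (φ l * φ q)) ≈ (t ^ p) ^ n
      simplify = trans (+-congʳ (*-congˡ expand)) (trans
        (solve 4 (λ c′ c x y → c′ :* (c :* x :+ y) :+ :- (c′ :* y) := (c :* c′) :* x) refl (φ c′) (φ c) (φ t ^ n) (φ l * φ q))
        (trans (*-cong (trans (sym (φ-* c c′)) (trans (φ-cong cc′) φ-1)) (^-congˡ n (φ-form (other i)))) (*-identityˡ _)))
      iterate : ∀ n → l ∣ (t ^ p) ^ n → l ∣ 1#
      iterate zero    d = d
      iterate (suc n) d = iterate n (form-prime^ i (other i) (other-≢ i) p _ d)

  -- The constant e - 1 is 0 or a unit; in the second case its image under φ would be a unit
  -- divisible by `form i`.
  φ≈1 : ∀ i {e} → Homog 0 e → form i ∣ φ e - 1# → φ e ≈ 1#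
  φ≈1 i {e} h dvd = go (homog-const (homog-+ h (homog-neg homog-1)))
    where
    e-1 : φ (e - 1#) ≈ φ e - 1#
    e-1 = trans (φ-+ e _) (+-congˡ (trans (φ-neg 1#) (-‿cong φ-1)))
    go : e - 1# ≈ 0# ⊎ IsUnit (e - 1#) → φ e ≈ 1#
    go (inj₁ z) = trans (φ-cong (x∙y⁻¹≈ε⇒x≈y e 1# z)) φ-1
    go (inj₂ (c , _ , ec)) = ⊥-elim (form∤1 i (∣-respʳ
      (trans (*-congˡ (sym e-1)) (trans (*-comm _ _) (trans (sym (φ-* _ c)) (trans (φ-cong ec) φ-1)))) (∣-* (φ c) dvd)))

  sum^-mod : ∀ x y n → x ∣ (x + y) ^ n - y ^ n
  sum^-mod x y zero    = 0# , solve 1 (λ x → con (1 , 0) :- con (1 , 0) := x :* con (0 , 0)) refl x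
  sum^-mod x y (suc n) = ∣-respʳ
    (solve 4 (λ x y s t → x :* s :+ y :* (s :- t) := (x :+ y) :* s :- y :* t) refl x y ((x + y) ^ n) (y ^ n))
    (∣-+ (∣-self x _) (∣-* y (sum^-mod x y n)))

  -- (x + y)^p is killed by both derivations, hence of the form x^p φ(c) + y^p φ(e) with c, e of degree 0.
  freshman : (X + Y) ^ p ≈ X ^ p + Y ^ p
  freshman = trans expand (+-cong (trans (*-congˡ c≈1) (*-identityʳ _)) (trans (*-congˡ e≈1) (*-identityʳ _)))
    where
    s = (X + Y) ^ p
    hs : Homog 1 (π s)
    hs = π-homog (homog-cast (≡.sym (ℕ.*-identityʳ p)) (homog-^ p (homog-form 2F)))
    splitting = homog-split hs
    c = proj₁ splitting
    e = proj₁ (proj₂ splitting)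
    hc = proj₁ (proj₂ (proj₂ splitting))
    he = proj₁ (proj₂ (proj₂ (proj₂ splitting)))
    expand : s ≈ X ^ p * φ c + Y ^ p * φ e
    expand = trans (φ-π (∂-pth-power partial-X _) (∂-pth-power partial-Y _))
      (trans (φ-cong (proj₂ (proj₂ (proj₂ (proj₂ splitting))))) (trans (φ-+ _ _)
        (+-cong (trans (φ-* X c) (*-congʳ φ-X)) (trans (φ-* Y e) (*-congʳ φ-Y)))))
    -- Modulo X the power (X + Y) ^ p is Y ^ p, while the expansion is Y ^ p φ(e); the factor Y ^ p
    -- is prime to X. The other coefficient is treated modulo Y.
    e≈1 : φ e ≈ 1#
    e≈1 = φ≈1 0F he (form-prime^ 0F 1F (λ ()) p _ (∣-respʳ
      (trans (+-congʳ (+-congʳ expand)) (solve 4 (λ x y c e → ((x :* c :+ y :* e) :- y) :- c :* x := y :* (e :- con (1 , 0))) refl (X ^ p) (Y ^ p) (φ c) (φ e)))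
      (∣-+ (sum^-mod X Y p) (∣-neg (∣-* (φ c) (form∣form^p 0F))))))
    c≈1 : φ c ≈ 1#
    c≈1 = φ≈1 1F hc (form-prime^ 1F 0F (λ ()) p _ (∣-respʳ
      (trans (+-congʳ (+-congʳ (trans (^-congˡ p (+-comm Y X)) expand)))
        (solve 4 (λ x y c e → ((x :* c :+ y :* e) :- x) :- e :* y := x :* (c :- con (1 , 0))) refl (X ^ p) (Y ^ p) (φ c) (φ e)))
      (∣-+ (sum^-mod Y X p) (∣-neg (∣-* (φ e) (form∣form^p 1F))))))

  φ-form : ∀ i → φ (form i) ≈ form i ^ p
  φ-form 0F = φ-X
  φ-form 1F = φ-Y
  φ-form 2F = trans (φ-+ X Y) (trans (+-cong φ-X φ-Y) (sym freshman))

  valuation : ∀ i d {f} → Homog d f → ¬ f ≈ 0# →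
              ∃[ m ] ∃[ g ] ∃[ n ] f ≈ form i ^ m * g × Homog n g × ¬ form i ∣ g
  valuation i d {f} h f≉0 = go d h (form? i h)
    where
    go : ∀ d → Homog d f → Dec (form i ∣ f) → ∃[ m ] ∃[ g ] ∃[ n ] f ≈ form i ^ m * g × Homog n g × ¬ form i ∣ g
    go d       h (no ∤f)       = 0 , f , d , sym (*-identityˡ f) , h , ∤f
    go zero    h (yes dvd)     = ⊥-elim (f≉0 (homog-∣ h (homog-form i) (s≤s z≤n) dvd))
    go (suc d) h (yes (g , e)) =
      let (m , g′ , n , e′ , h′ , ∤g′) = valuation i d (homog-quotient i g (homog-cong e h))
            (λ g≈0 → f≉0 (trans e (trans (*-congˡ g≈0) (zeroʳ _))))
      in suc m , g′ , n , trans e (trans (*-congˡ e′) (sym (*-assoc _ _ g′))) , h′ , ∤g′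

  valuation-unique : ∀ i m n {f g} → form i ^ m * f ≈ form i ^ n * g → ¬ form i ∣ f → ¬ form i ∣ g → m ≡ n
  valuation-unique i zero    zero    e ∤f ∤g = ≡.refl
  valuation-unique i zero    (suc n) e ∤f ∤g = ⊥-elim (∤f (_ , trans (sym (*-identityˡ _)) (trans e (*-assoc _ _ _))))
  valuation-unique i (suc m) zero    e ∤f ∤g = ⊥-elim (∤g (_ , trans (sym (*-identityˡ _)) (trans (sym e) (*-assoc _ _ _))))
  valuation-unique i (suc m) (suc n) e ∤f ∤g = ≡.cong suc (valuation-unique i m n
    (form-cancel i _ _ (trans (sym (*-assoc _ _ _)) (trans e (*-assoc _ _ _)))) ∤f ∤g)

  form^suc∤ : ∀ i m {f g} → f ≈ form i ^ m * g → ¬ form i ∣ g → ¬ form i ^ suc m ∣ f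
  form^suc∤ i m e ∤g (q , e′) = ∤g (q , form^-cancel i m _ _ (trans (sym e) (trans e′
    (solve 3 (λ l x q → (l :* x) :* q := x :* (l :* q)) refl _ _ q))))

  φ-det : ∀ θ η → φ (det θ η) ≈ det (φ (proj₁ θ) , φ (proj₂ θ)) (φ (proj₁ η) , φ (proj₂ η))
  φ-det (f , g) (f′ , g′) = trans (φ-+ _ _) (+-cong (φ-* f g′) (trans (φ-neg _) (-‿cong (φ-* f′ g))))

  -- The new multiplicities are defined as the orders of the values of θ′ along the forms, which
  -- makes θ′ exact by construction. That ζ is p times them is then a comparison of orders.
  peak-descend : ∀ {ζ d} → Peak ζ d → 2 ℕ.+ (d ℕ.+ d) ≤ ∣ ζ ∣ₘ →
                 ∃[ ζ′ ] ∃[ d′ ] ζ ≡ scale p ζ′ × d ≡ p ℕ.* d′ × Peak ζ′ d′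
  peak-descend {ζ} {d} K gap = go (p ℕ.∣? d)
    where
    open Peak K
    ∂X≈0 = peak-∂≈0 partial-X 1F ∂X-Y K gap
    ∂Y≈0 = peak-∂≈0 partial-Y 0F ∂Y-X K gap
    f = proj₁ θ
    g = proj₂ θ
    θ′ : Derivation
    θ′ = π f , π g
    φπf : f ≈ φ (π f)
    φπf = φ-π (proj₁ ∂X≈0) (proj₁ ∂Y≈0)
    φπg : g ≈ φ (π g)
    φπg = φ-π (proj₂ ∂X≈0) (proj₂ ∂Y≈0)
    val-φ : ∀ i → val i θ ≈ φ (val i θ′)
    val-φ 0F = φπf
    val-φ 1F = φπg
    val-φ 2F = trans (+-cong φπf φπg) (sym (φ-+ _ _))
    val≉0 : ∀ i → ¬ val i θ′ ≈ 0#
    val≉0 i e = exact i (∣-respʳ (sym (trans (val-φ i) (trans (φ-cong e) φ-0))) ∣-0)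
    go : Dec (p ℕ.∣ d) → ∃[ ζ′ ] ∃[ d′ ] ζ ≡ scale p ζ′ × d ≡ p ℕ.* d′ × Peak ζ′ d′
    -- Here θ = φ(π θ), and π kills degrees not divisible by p.
    go (no p∤d) = ⊥-elim (θ≉0 ( trans φπf (trans (φ-cong (π-homog-∤ p∤d (proj₁ homog))) φ-0)
                              , trans φπg (trans (φ-cong (π-homog-∤ p∤d (proj₂ homog))) φ-0)))
    go (yes (ℕ.divides d′ d≡d′p)) = ζ′ , d′ , ζ≡ , d≡ , record
      { θ = θ′ ; homog = h′ ; inD = inD′ ; exact = exact′ ; saturated = saturated′ ; low = low′ }
      where
      d≡ : d ≡ p ℕ.* d′
      d≡ = ≡.trans d≡d′p (ℕ.*-comm d′ p)
      h′ : HomogD d′ θ′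
      h′ = π-homog (homog-cast d≡ (proj₁ homog)) , π-homog (homog-cast d≡ (proj₂ homog))
      factored : ∀ i → ∃[ m ] ∃[ g ] ∃[ n ] val i θ′ ≈ form i ^ m * g × Homog n g × ¬ form i ∣ g
      factored i = valuation i d′ (homog-val i h′) (val≉0 i)
      m : Fin 3 → ℕ
      m i = proj₁ (factored i)
      a : Fin 3 → Carrier
      a i = proj₁ (proj₂ (factored i))
      val≈ : ∀ i → val i θ′ ≈ form i ^ m i * a i
      val≈ i = proj₁ (proj₂ (proj₂ (proj₂ (factored i))))
      ha : ∀ i → Homog _ (a i)
      ha i = proj₁ (proj₂ (proj₂ (proj₂ (proj₂ (factored i)))))
      ∤a : ∀ i → ¬ form i ∣ a i
      ∤a i = proj₂ (proj₂ (proj₂ (proj₂ (proj₂ (factored i)))))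
      ζ′ = tabulateₘ m
      inD′ : D ζ′ θ′
      inD′ i = ≡.subst (λ k → form i ^ k ∣ val i θ′) (≡.sym (at-tabulate i m)) (a i , val≈ i)
      exact′ : ∀ i → ¬ form i ^ suc (at i ζ′) ∣ val i θ′
      exact′ i = ≡.subst (λ k → ¬ form i ^ suc k ∣ val i θ′) (≡.sym (at-tabulate i m)) (form^suc∤ i (m i) (val≈ i) (∤a i))
      -- Both sides are the order of val i θ = φ(val i θ′): the left one by exactness of θ, the
      -- right one because φ sends `form i` to its p-th power and keeps the remaining factor prime
      -- to it.
      at≡ : ∀ i → at i ζ ≡ p ℕ.* m i
      at≡ i = let (b , e) = inD i in valuation-unique i (at i ζ) (p ℕ.* m i)
        (trans (sym e) (trans (val-φ i) (trans (φ-cong (val≈ i)) (trans (φ-* _ _)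
          (*-congʳ (trans (φ-^ (form i) (m i)) (trans (^-congˡ (m i) (φ-form i)) (^-assocʳ (form i) p (m i)))))))))
        (λ (c , b≈) → exact i (c , trans e (trans (*-congˡ b≈) (solve 3 (λ x l c → x :* (l :* c) := (l :* x) :* c) refl _ _ c))))
        (φ-form∤ i (ha i) (∤a i) φ-form)
        where open import Algebra.Properties.Semiring.Exp semiring using (^-assocʳ)
      ζ≡ : ζ ≡ scale p ζ′
      ζ≡ = ≡.cong₂ _,_ (at≡ 0F) (≡.cong₂ _,_ (at≡ 1F) (at≡ 2F))
      low′ : d′ ℕ.+ d′ < ∣ ζ′ ∣ₘ
      low′ = ℕ.*-cancelˡ-< p _ _ (ℕ.≤-trans (ℕ.≤-reflexive (≡.cong suc (≡.trans (ℕ.*-distribˡ-+ p d′ d′) (≡.cong₂ ℕ._+_ (≡.sym d≡) (≡.sym d≡)))))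
        (ℕ.≤-trans low (ℕ.≤-reflexive (≡.trans (≡.cong ∣_∣ₘ ζ≡) (∣scale∣ p ζ′)))))
      -- Saturation of θ applies to φ(η) and gives φ(η) = u θ = u φ(θ′); applying π moves the
      -- multiplier down, η = π(u) θ′.
      saturated′ : ∀ η → det θ′ η ≈ 0# → ∃[ u ] η ≈ᵈ u · θ′
      saturated′ η parallel =
        let (u , e , e′) = saturated (φ (proj₁ η) , φ (proj₂ η))
              (trans (+-cong (*-congʳ φπf) (-‿cong (*-congˡ φπg))) (trans (sym (φ-det θ′ η)) (trans (φ-cong parallel) φ-0)))
        in π u , project φπf e , project φπg e′
        where
        π-φ : ∀ x → π (φ x) ≈ x
        π-φ x = trans (π-cong (sym (*-identityʳ _))) (trans (π-φ* x 1#) (trans (*-congˡ π-1) (*-identityʳ x)))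
        project : ∀ {x y u} → y ≈ φ (π y) → φ x ≈ u * y → x ≈ π u * π y
        project {x} {y} {u} y≈ e = trans (sym (π-φ x)) (trans (π-cong (trans e (trans (*-congˡ y≈) (*-comm u _))))
          (trans (π-φ* (π y) u) (*-comm _ _)))

  -- Each descent divides δ by p ≥ 2, and `n` bounds δ to make the recursion structural. The value 0
  -- is excluded by strictness of `low`; at δ = 1 the total |ζ| = 2 d + 1 is odd and k = 0.
  peak-shape : ∀ n {ζ d δ} → δ ≤ n → ∣ ζ ∣ₘ ≡ d ℕ.+ d ℕ.+ δ → Peak ζ d →
               ∃[ k ] ∃[ ν ] ζ ≡ scale (p ℕ.^ k) ν × Odd ∣ ν ∣ₘ × δ ≡ p ℕ.^ k
  peak-shape n {ζ} {d} {zero} _ s K = ⊥-elim (ℕ.<⇒≢ (Peak.low K) (≡.sym (≡.trans s (ℕ.+-identityʳ _))))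
  peak-shape n {ζ@(a , b , c)} {d} {suc zero} _ s K = 0 , ζ ,
    ≡.cong₂ _,_ (≡.sym (ℕ.+-identityʳ a)) (≡.cong₂ _,_ (≡.sym (ℕ.+-identityʳ b)) (≡.sym (ℕ.+-identityʳ c))) ,
    (d , ≡.trans s (≡.trans (ℕ.+-comm _ 1) (≡.cong (λ e → suc (d ℕ.+ e)) (≡.sym (ℕ.+-identityʳ d))))) , ≡.refl
  peak-shape (suc n) {ζ} {d} {suc (suc δ)} (s≤s δ<n) s K =
    let (ζ′ , d′ , ζ≡ , d≡ , K′) = peak-descend K gap
        δ′ = ∣ ζ′ ∣ₘ ∸ (d′ ℕ.+ d′)
        s′ = ≡.sym (ℕ.m+[n∸m]≡n (ℕ.<⇒≤ (Peak.low K′)))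
        δ≡ = relate ζ′ d′ δ′ ζ≡ d≡ s′
        (k , ν , ζ′≡ , odd , δ′≡) = peak-shape n (smaller δ′ δ≡) s′ K′
    in suc k , ν , ≡.trans ζ≡ (≡.trans (≡.cong (scale p) ζ′≡) (scale-scale ν k)) , odd , ≡.trans δ≡ (≡.cong (p ℕ.*_) δ′≡)
    where
    gap : 2 ℕ.+ (d ℕ.+ d) ≤ ∣ ζ ∣ₘ
    gap = ℕ.≤-trans (ℕ.≤-reflexive (ℕ.+-comm 2 _)) (ℕ.≤-trans (ℕ.+-monoʳ-≤ (d ℕ.+ d) (s≤s (s≤s z≤n))) (ℕ.≤-reflexive (≡.sym s)))
    relate : ∀ ζ′ d′ δ′ → ζ ≡ scale p ζ′ → d ≡ p ℕ.* d′ → ∣ ζ′ ∣ₘ ≡ d′ ℕ.+ d′ ℕ.+ δ′ → suc (suc δ) ≡ p ℕ.* δ′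
    relate ζ′ d′ δ′ ζ≡ d≡ s′ = ℕ.+-cancelˡ-≡ (d ℕ.+ d) _ _ (≡.trans (≡.sym s) (≡.trans (≡.cong ∣_∣ₘ ζ≡)
      (≡.trans (∣scale∣ p ζ′) (≡.trans (≡.cong (p ℕ.*_) s′) (≡.trans
        (distrib₃ p d′ δ′)
        (≡.cong (λ x → x ℕ.+ x ℕ.+ p ℕ.* δ′) (≡.sym d≡)))))))
    smaller : ∀ δ′ → suc (suc δ) ≡ p ℕ.* δ′ → δ′ ≤ n
    smaller zero     e = z≤n
    smaller (suc δ′) e = ℕ.≤-trans (ℕ.≤-pred (ℕ.≤-trans (ℕ.m<m*n (suc δ′) p 1<p)
      (ℕ.≤-reflexive (≡.trans (ℕ.*-comm (suc δ′) p) (≡.sym e))))) δ<n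
    scale-scale : ∀ ν k → scale p (scale (p ℕ.^ k) ν) ≡ scale (p ℕ.^ suc k) ν
    scale-scale (a , b , c) k = ≡.cong₂ _,_ (assoc a) (≡.cong₂ _,_ (assoc b) (assoc c))
      where
      assoc : ∀ x → p ℕ.* (p ℕ.^ k ℕ.* x) ≡ p ℕ.* p ℕ.^ k ℕ.* x
      assoc x = ≡.sym (ℕ.*-assoc p (p ℕ.^ k) x)

open import Defs
open import Data.Nat using (_+_; _*_; _%_; _/_; _≟_; _≤?_)

-- The polynomial ring of Defs

module Coefficients where

  Monomial : Set
  Monomial = ℕ × ℕ × ℕ

  term : ℕ → ℕ → ℕ → ℕ → ℕ → ℕ
  term c a b i j = if ⌊ a ≟ i ⌋ ∧ ⌊ b ≟ j ⌋ then c else 0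

  term-yes : ∀ c {a b i j} → a ≡ i → b ≡ j → term c a b i j ≡ c
  term-yes c {a} {b} ≡.refl ≡.refl with a ≟ a | b ≟ b
  ... | yes _ | yes _ = ≡.refl
  ... | yes _ | no b≢ = ⊥-elim (b≢ ≡.refl)
  ... | no a≢ | _     = ⊥-elim (a≢ ≡.refl)

  term-no : ∀ c a b i j → ¬ (a ≡ i × b ≡ j) → term c a b i j ≡ 0
  term-no c a b i j ¬e with a ≟ i | b ≟ j
  ... | yes e | yes e′ = ⊥-elim (¬e (e , e′))
  ... | yes _ | no _   = ≡.refl
  ... | no _  | _      = ≡.refl

  term-⇔ : ∀ c a b i j a′ b′ i′ j′ → (a ≡ i → b ≡ j → a′ ≡ i′ × b′ ≡ j′) → (a′ ≡ i′ → b′ ≡ j′ → a ≡ i × b ≡ j) →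
           term c a b i j ≡ term c a′ b′ i′ j′
  term-⇔ c a b i j a′ b′ i′ j′ to from with a ≟ i | b ≟ j
  ... | yes e | yes e′ = let (f , f′) = to e e′ in ≡.sym (term-yes c f f′)
  ... | yes _ | no ¬e  = ≡.sym (term-no c a′ b′ i′ j′ λ (f , f′) → ¬e (proj₂ (from f f′)))
  ... | no ¬e | _      = ≡.sym (term-no c a′ b′ i′ j′ λ (f , f′) → ¬e (proj₁ (from f f′)))

  term-* : ∀ c d a b i j → term (c * d) a b i j ≡ c * term d a b i j
  term-* c d a b i j with ⌊ a ≟ i ⌋ ∧ ⌊ b ≟ j ⌋
  ... | true  = ≡.refl
  ... | false = ≡.sym (ℕ.*-zeroʳ c)

  term-+ : ∀ c d a b i j → term (c + d) a b i j ≡ term c a b i j + term d a b i j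
  term-+ c d a b i j with ⌊ a ≟ i ⌋ ∧ ⌊ b ≟ j ⌋
  ... | true  = ≡.refl
  ... | false = ≡.refl

  coeff-++ : ∀ f g i j → coeff (f ++ g) i j ≡ coeff f i j + coeff g i j
  coeff-++ []                g i j = ≡.refl
  coeff-++ ((c , a , b) ∷ f) g i j = ≡.trans (≡.cong (term c a b i j +_) (coeff-++ f g i j)) (≡.sym (ℕ.+-assoc (term c a b i j) _ _))

  -- A functional that sums over the terms of a list is determined by single terms (`additive-ext`).
  -- Applied to coefficients, one factor at a time, this reduces the ring laws to identities between
  -- monomials.
  record Additive (L : Poly → ℕ) : Set where
    field
      on-[] : L [] ≡ 0
      on-∷  : ∀ t f → L (t ∷ f) ≡ L (t ∷ []) + L f

    on-++ : ∀ f g → L (f ++ g) ≡ L f + L g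
    on-++ []      g = ≡.cong (_+ L g) (≡.sym on-[])
    on-++ (t ∷ f) g = begin
      L (t ∷ f ++ g)             ≡⟨ on-∷ t (f ++ g) ⟩
      L (t ∷ []) + L (f ++ g)    ≡⟨ ≡.cong (L (t ∷ []) +_) (on-++ f g) ⟩
      L (t ∷ []) + (L f + L g)   ≡⟨ ℕ.+-assoc (L (t ∷ [])) (L f) (L g) ⟨
      L (t ∷ []) + L f + L g     ≡⟨ ≡.cong (_+ L g) (on-∷ t f) ⟨
      L (t ∷ f) + L g            ∎
      where open ≡.≡-Reasoning

  open Additive

  additive-ext : ∀ {L M} → Additive L → Additive M → (∀ t → L (t ∷ []) ≡ M (t ∷ [])) → ∀ f → L f ≡ M f
  additive-ext l m e []      = ≡.trans (on-[] l) (≡.sym (on-[] m))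
  additive-ext l m e (t ∷ f) = ≡.trans (on-∷ l t f) (≡.trans (≡.cong₂ _+_ (e t) (additive-ext l m e f)) (≡.sym (on-∷ m t f)))

  additive-sum : ∀ {L M} → Additive L → Additive M → Additive (λ f → L f + M f)
  additive-sum {L} {M} l m = record
    { on-[] = ≡.cong₂ _+_ (on-[] l) (on-[] m)
    ; on-∷  = λ t f → ≡.trans (≡.cong₂ _+_ (on-∷ l t f) (on-∷ m t f)) (interchange (L (t ∷ [])) (L f) (M (t ∷ [])) (M f)) }
    where
    interchange : ∀ a b c d → (a + b) + (c + d) ≡ (a + c) + (b + d)
    interchange = solve 4 (λ a b c d → (a :+ b) :+ (c :+ d) := (a :+ c) :+ (b :+ d)) ≡.refl
      where open +-*-Solver

  additive-coeff : ∀ i j → Additive (λ f → coeff f i j)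
  additive-coeff i j = record { on-[] = ≡.refl ; on-∷ = λ t f → coeff-++ (t ∷ []) f i j }

  additive-scale : ∀ n {L} → Additive L → Additive (λ f → n * L f)
  additive-scale n {L} l = record
    { on-[] = ≡.trans (≡.cong (n *_) (on-[] l)) (ℕ.*-zeroʳ n)
    ; on-∷  = λ t f → ≡.trans (≡.cong (n *_) (on-∷ l t f)) (ℕ.*-distribˡ-+ n (L (t ∷ [])) (L f)) }

  additive-0 : Additive (λ _ → 0)
  additive-0 = record { on-[] = ≡.refl ; on-∷ = λ _ _ → ≡.refl }

  additive-concatMap : ∀ {L} (k : Monomial → Poly) → Additive L → Additive (L ∘ concatMap k)
  additive-concatMap {L} k l = record
    { on-[] = on-[] l
    ; on-∷  = λ t f → ≡.trans (on-++ l (k t) (concatMap k f)) (≡.cong (λ g → L g + L (concatMap k f)) (≡.sym (List.++-identityʳ (k t)))) }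

  ⊗-additiveˡ : ∀ {L} g → Additive L → Additive (λ f → L (f ⊗ g))
  ⊗-additiveˡ {L} g l = record
    { on-[] = on-[] l
    ; on-∷  = λ t f → ≡.trans (on-++ l _ (f ⊗ g)) (≡.cong (λ h → L h + L (f ⊗ g)) (≡.sym (List.++-identityʳ _))) }

  -- The product recurses on its left factor only, so additivity on the right is itself an identity
  -- between functionals additive in the left factor.
  ⊗-additiveʳ : ∀ {L} f → Additive L → Additive (λ g → L (f ⊗ g))
  ⊗-additiveʳ {L} f l = record
    { on-[] = additive-ext (⊗-additiveˡ [] l) additive-0 (λ t → on-[] l) f
    ; on-∷  = λ s g → additive-ext (⊗-additiveˡ (s ∷ g) l) (additive-sum (⊗-additiveˡ (s ∷ []) l) (⊗-additiveˡ g l)) (λ t → on-∷ l _ _) f }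

  infix 4 _≐_
  -- Equality of coefficients in ℕ, before reduction modulo p; the semiring laws and the product
  -- rule already hold at this level.
  _≐_ : Poly → Poly → Set
  f ≐ g = ∀ i j → coeff f i j ≡ coeff g i j

  ⊗-comm : ∀ f g → f ⊗ g ≐ g ⊗ f
  ⊗-comm f g i j = additive-ext (⊗-additiveˡ g K) (⊗-additiveʳ g K) (λ t →
    additive-ext (⊗-additiveʳ (t ∷ []) K) (⊗-additiveˡ (t ∷ []) K) (single t) g) f
    where
    K = additive-coeff i j
    single : ∀ t s → coeff ((t ∷ []) ⊗ (s ∷ [])) i j ≡ coeff ((s ∷ []) ⊗ (t ∷ [])) i j
    single (c , a , b) (d , a′ , b′) rewrite ℕ.*-comm c d | ℕ.+-comm a a′ | ℕ.+-comm b b′ = ≡.refl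

  ⊗-assoc : ∀ f g h → (f ⊗ g) ⊗ h ≐ f ⊗ (g ⊗ h)
  ⊗-assoc f g h i j =
    additive-ext (⊗-additiveˡ g (⊗-additiveˡ h K)) (⊗-additiveˡ (g ⊗ h) K) (λ t →
      additive-ext (⊗-additiveʳ (t ∷ []) (⊗-additiveˡ h K)) (⊗-additiveˡ h (⊗-additiveʳ (t ∷ []) K)) (λ s →
        additive-ext (⊗-additiveʳ ((t ∷ []) ⊗ (s ∷ [])) K) (⊗-additiveʳ (s ∷ []) (⊗-additiveʳ (t ∷ []) K)) (single t s) h) g) f
    where
    K = additive-coeff i j
    single : ∀ t s r → coeff (((t ∷ []) ⊗ (s ∷ [])) ⊗ (r ∷ [])) i j ≡ coeff ((t ∷ []) ⊗ ((s ∷ []) ⊗ (r ∷ []))) i j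
    single (c , a , b) (c′ , a′ , b′) (c″ , a″ , b″)
      rewrite ℕ.*-assoc c c′ c″ | ℕ.+-assoc a a′ a″ | ℕ.+-assoc b b′ b″ = ≡.refl

  ⊗-identityˡ : ∀ f → 1ₚ ⊗ f ≐ f
  ⊗-identityˡ f i j = additive-ext (⊗-additiveʳ 1ₚ K) K (λ { (c , a , b) → ≡.cong (λ d → term d a b i j + 0) (ℕ.+-identityʳ c) }) f
    where K = additive-coeff i j

  monomial-coeff : ∀ c a b f i j → coeff (((c , a , b) ∷ []) ⊗ f) (a + i) (b + j) ≡ c * coeff f i j
  monomial-coeff c a b f i j = additive-ext (⊗-additiveʳ ((c , a , b) ∷ []) (additive-coeff (a + i) (b + j)))
    (additive-scale c (additive-coeff i j)) single f
    where
    single : ∀ t → coeff (((c , a , b) ∷ []) ⊗ (t ∷ [])) (a + i) (b + j) ≡ c * coeff (t ∷ []) i j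
    single (d , a′ , b′) = ≡.trans (ℕ.+-identityʳ _) (≡.trans
      (term-⇔ (c * d) (a + a′) (b + b′) (a + i) (b + j) a′ b′ i j (λ e e′ → ℕ.+-cancelˡ-≡ a _ _ e , ℕ.+-cancelˡ-≡ b _ _ e′) (λ e e′ → ≡.cong (a +_) e , ≡.cong (b +_) e′))
      (≡.trans (term-* c d a′ b′ i j) (≡.cong (c *_) (≡.sym (ℕ.+-identityʳ _)))))

  monomial-coeff-≰ : ∀ c a b f i j → ¬ (a ≤ i × b ≤ j) → coeff (((c , a , b) ∷ []) ⊗ f) i j ≡ 0
  monomial-coeff-≰ c a b f i j ≰ = additive-ext (⊗-additiveʳ ((c , a , b) ∷ []) (additive-coeff i j)) additive-0
    (λ { (d , a′ , b′) → ≡.trans (ℕ.+-identityʳ _)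
      (term-no (c * d) (a + a′) (b + b′) i j λ { (≡.refl , ≡.refl) → ≰ (ℕ.m≤m+n a a′ , ℕ.m≤m+n b b′) }) }) f

  -- A view of exponents for multiplication by x^a y^b: inside the shifted quadrant the product has
  -- the coefficients of the other factor up to a scalar, outside it has none.
  data Shifted (a b : ℕ) : ℕ → ℕ → Set where
    inside  : ∀ i j → Shifted a b (a + i) (b + j)
    outside : ∀ {i j} → ¬ (a ≤ i × b ≤ j) → Shifted a b i j

  shifted : ∀ a b i j → Shifted a b i j
  shifted a b i j with a ≤? i | b ≤? j
  ... | no a≰i  | _       = outside (a≰i ∘ proj₁)
  ... | yes _   | no b≰j  = outside (b≰j ∘ proj₂)
  ... | yes a≤i | yes b≤j = ≡.subst₂ (Shifted a b) (ℕ.m+[n∸m]≡n a≤i) (ℕ.m+[n∸m]≡n b≤j) (inside (i ∸ a) (j ∸ b))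

  -- Linear operators on polynomials are given on monomials and extended by concatMap; they are determined by how
  -- they transform coefficients.
  divX ∂x : Poly → Poly
  divX = concatMap λ { (c , zero , b) → [] ; (c , suc a , b) → (c , a , b) ∷ [] }
  ∂x   = concatMap λ { (c , zero , b) → [] ; (c , suc a , b) → (suc a * c , a , b) ∷ [] }

  swap : Poly → Poly
  swap = concatMap λ { (c , a , b) → (c , b , a) ∷ [] }

  homogeneous-part : ℕ → Poly → Poly
  homogeneous-part d = concatMap λ { (c , a , b) → if ⌊ a + b ≟ d ⌋ then (c , a , b) ∷ [] else [] }

  scalar : ℕ → Poly → Poly
  scalar n = concatMap λ { (c , a , b) → (n * c , a , b) ∷ [] }

  coeff-divX : ∀ f i j → coeff (divX f) i j ≡ coeff f (suc i) j
  coeff-divX f i j = additive-ext (additive-concatMap _ (additive-coeff i j)) (additive-coeff (suc i) j)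
    (λ { (c , zero , b) → ≡.refl
       ; (c , suc a , b) → ≡.cong (_+ 0) (term-⇔ c a b i j (suc a) b (suc i) j (λ e e′ → ≡.cong suc e , e′) (λ e e′ → ℕ.suc-injective e , e′)) }) f

  coeff-∂x : ∀ f i j → coeff (∂x f) i j ≡ suc i * coeff f (suc i) j
  coeff-∂x f i j = additive-ext (additive-concatMap _ (additive-coeff i j)) (additive-scale (suc i) (additive-coeff (suc i) j))
    (λ { (c , zero , b) → ≡.sym (ℕ.*-zeroʳ (suc i)) ; (c , suc a , b) → single c a b }) f
    where
    single : ∀ c a b → term (suc a * c) a b i j + 0 ≡ suc i * (term c (suc a) b (suc i) j + 0)
    single c a b = split (a ≟ i)
      where
      split : Dec (a ≡ i) → term (suc a * c) a b i j + 0 ≡ suc i * (term c (suc a) b (suc i) j + 0)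
      split (yes ≡.refl) = ≡.trans (ℕ.+-identityʳ _) (≡.trans (term-* (suc a) c a b a j) (≡.cong (suc a *_) (≡.trans
        (term-⇔ c a b a j (suc a) b (suc a) j (λ e e′ → ≡.cong suc e , e′) (λ e e′ → ℕ.suc-injective e , e′)) (≡.sym (ℕ.+-identityʳ _)))))
      split (no a≢i)     = ≡.trans (≡.cong (_+ 0) (term-no (suc a * c) a b i j (a≢i ∘ proj₁))) (≡.sym
        (≡.trans (≡.cong (λ x → suc i * (x + 0)) (term-no c (suc a) b (suc i) j (a≢i ∘ ℕ.suc-injective ∘ proj₁))) (ℕ.*-zeroʳ (suc i))))

  coeff-swap : ∀ f i j → coeff (swap f) i j ≡ coeff f j i
  coeff-swap f i j = additive-ext (additive-concatMap _ (additive-coeff i j)) (additive-coeff j i)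
    (λ { (c , a , b) → ≡.cong (_+ 0) (term-⇔ c b a i j a b j i (λ e e′ → e′ , e) (λ e e′ → e′ , e)) }) f

  coeff-scalar : ∀ n f i j → coeff (scalar n f) i j ≡ n * coeff f i j
  coeff-scalar n f i j = additive-ext (additive-concatMap _ (additive-coeff i j)) (additive-scale n (additive-coeff i j))
    (λ { (c , a , b) → ≡.trans (ℕ.+-identityʳ _) (≡.trans (term-* n c a b i j) (≡.cong (n *_) (≡.sym (ℕ.+-identityʳ _)))) }) f

  coeff-part : ∀ d f i j → i + j ≡ d → coeff (homogeneous-part d f) i j ≡ coeff f i j
  coeff-part d f i j e = additive-ext (additive-concatMap _ (additive-coeff i j)) (additive-coeff i j) (λ { (c , a , b) → single c a b }) f
    where
    single : ∀ c a b → coeff ((if ⌊ a + b ≟ d ⌋ then (c , a , b) ∷ [] else []) ++ []) i j ≡ term c a b i j + 0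
    single c a b with a + b ≟ d
    ... | yes _ = ≡.refl
    ... | no ¬e = ≡.sym (≡.cong (_+ 0) (term-no c a b i j λ { (≡.refl , ≡.refl) → ¬e e }))

  coeff-part-≢ : ∀ d f i j → i + j ≢ d → coeff (homogeneous-part d f) i j ≡ 0
  coeff-part-≢ d f i j ≢ = additive-ext (additive-concatMap _ (additive-coeff i j)) additive-0 (λ { (c , a , b) → single c a b }) f
    where
    single : ∀ c a b → coeff ((if ⌊ a + b ≟ d ⌋ then (c , a , b) ∷ [] else []) ++ []) i j ≡ 0
    single c a b with a + b ≟ d
    ... | yes e = ≡.cong (_+ 0) (term-no c a b i j λ { (≡.refl , ≡.refl) → ≢ e })
    ... | no _  = ≡.refl

  swap-⊗ : ∀ f g → swap (f ⊗ g) ≐ swap f ⊗ swap g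
  swap-⊗ f g i j = additive-ext (⊗-additiveˡ g S) (additive-concatMap _ (⊗-additiveˡ (swap g) K)) (λ t →
    additive-ext (⊗-additiveʳ (t ∷ []) S) (additive-concatMap _ (⊗-additiveʳ (swap (t ∷ [])) K)) (λ s → ≡.refl) g) f
    where
    K = additive-coeff i j
    S = additive-concatMap _ K

  ∂x-⊗ : ∀ f g → ∂x (f ⊗ g) ≐ (f ⊗ ∂x g) ⊕ (∂x f ⊗ g)
  ∂x-⊗ f g i j = additive-ext (⊗-additiveˡ g S) (left g) (λ t →
    additive-ext (⊗-additiveʳ (t ∷ []) S) (right (t ∷ [])) (single t) g) f
    where
    K = additive-coeff i j
    S : Additive (λ f → coeff (∂x f) i j)
    S = additive-concatMap _ K
    sum : ∀ {L : Poly → ℕ} {A B : Poly → Poly} → (∀ f → L f ≡ coeff (A f ⊕ B f) i j) →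
          Additive (λ f → coeff (A f) i j) → Additive (λ f → coeff (B f) i j) → Additive L
    sum {L} {A} {B} e a b = record
      { on-[] = ≡.trans (e′ []) (on-[] s) ; on-∷ = λ t f → ≡.trans (e′ (t ∷ f)) (≡.trans (on-∷ s t f) (≡.sym (≡.cong₂ _+_ (e′ (t ∷ [])) (e′ f)))) }
      where
      s = additive-sum a b
      e′ : ∀ f → L f ≡ coeff (A f) i j + coeff (B f) i j
      e′ f = ≡.trans (e f) (coeff-++ (A f) (B f) i j)
    left : ∀ g → Additive (λ f → coeff ((f ⊗ ∂x g) ⊕ (∂x f ⊗ g)) i j)
    left g = sum {A = λ f → f ⊗ ∂x g} {B = λ f → ∂x f ⊗ g} (λ _ → ≡.refl) (⊗-additiveˡ (∂x g) K) (additive-concatMap _ (⊗-additiveˡ g K))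
    right : ∀ f → Additive (λ g → coeff ((f ⊗ ∂x g) ⊕ (∂x f ⊗ g)) i j)
    right f = sum {A = λ g → f ⊗ ∂x g} {B = λ g → ∂x f ⊗ g} (λ _ → ≡.refl) (additive-concatMap _ (⊗-additiveʳ f K)) (⊗-additiveʳ (∂x f) K)
    single : ∀ t s → coeff (∂x ((t ∷ []) ⊗ (s ∷ []))) i j ≡ coeff (((t ∷ []) ⊗ ∂x (s ∷ [])) ⊕ (∂x (t ∷ []) ⊗ (s ∷ []))) i j
    -- `∂x` deletes terms free of x, so the cases are split by which of the two factors involves x.
    single (c , zero  , b) (d , zero   , b′) = ≡.refl
    single (c , zero  , b) (d , suc a′ , b′) = ≡.cong (λ x → term x a′ (b + b′) i j + 0)
      (≡.trans (≡.sym (ℕ.*-assoc (suc a′) c d)) (≡.trans (≡.cong (_* d) (ℕ.*-comm (suc a′) c)) (ℕ.*-assoc c (suc a′) d)))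
    single (c , suc a , b) (d , zero   , b′) rewrite ℕ.+-identityʳ a = ≡.cong (λ x → term x a (b + b′) i j + 0) (≡.sym (ℕ.*-assoc (suc a) c d))
    single (c , suc a , b) (d , suc a′ , b′) rewrite ℕ.+-suc a a′ = begin
      term (suc (suc (a + a′)) * (c * d)) s (b + b′) i j + 0          ≡⟨ ≡.cong (λ x → term x s (b + b′) i j + 0) (leibniz a a′ c d) ⟩
      term (c * (suc a′ * d) + suc a * c * d) s (b + b′) i j + 0      ≡⟨ ≡.cong (_+ 0) (term-+ (c * (suc a′ * d)) _ s (b + b′) i j) ⟩
      term (c * (suc a′ * d)) s (b + b′) i j + term (suc a * c * d) s (b + b′) i j + 0
                                                                      ≡⟨ ℕ.+-assoc (term (c * (suc a′ * d)) s (b + b′) i j) _ 0 ⟩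
      term (c * (suc a′ * d)) s (b + b′) i j + (term (suc a * c * d) s (b + b′) i j + 0) ∎
      where
      open ≡.≡-Reasoning
      s = suc (a + a′)
      leibniz : ∀ a a′ c d → suc (suc (a + a′)) * (c * d) ≡ c * (suc a′ * d) + suc a * c * d
      leibniz = solve 4 (λ a a′ c d → (con 2 :+ (a :+ a′)) :* (c :* d) := c :* ((con 1 :+ a′) :* d) :+ (con 1 :+ a) :* c :* d) ≡.refl
        where open +-*-Solver

open Coefficients

-- Congruence modulo p and the graded ring F_p[x,y]

module Modular (p : ℕ) (prime : Prime p) where

  instance
    p≢0 : NonZero p
    p≢0 = prime⇒nonZero prime

  infix 4 _≅_
  _≅_ : ℕ → ℕ → Set
  a ≅ b = a ≡[ p ] b

  ≅⇒% : ∀ a b → a ≅ b → a % p ≡ b % p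
  ≅⇒% a b d with ℕ.≤-total a b
  ... | inj₁ a≤b = ≡.sym (≡.trans (≡.cong (_% p) (≡.trans (≡.sym (ℕ.m+[n∸m]≡n a≤b)) (≡.cong (a +_) (≡.sym (ℕ.m≤n⇒∣m-n∣≡n∸m a≤b)))))
                     (ℕ.%-remove-+ʳ a d))
  ... | inj₂ b≤a = ≡.trans (≡.cong (_% p) (≡.trans (≡.sym (ℕ.m+[n∸m]≡n b≤a)) (≡.cong (b +_) (≡.sym (ℕ.m≤n⇒∣n-m∣≡n∸m b≤a)))))
                     (ℕ.%-remove-+ʳ b d)

  %⇒≅ : ∀ a b → a % p ≡ b % p → a ≅ b
  %⇒≅ a b e = ℕ.divides ∣ a / p - b / p ∣ (begin
    ∣ a - b ∣                                         ≡⟨ ≡.cong₂ ∣_-_∣ (ℕ.m≡m%n+[m/n]*n a p) (≡.trans (ℕ.m≡m%n+[m/n]*n b p) (≡.cong (_+ b / p * p) (≡.sym e))) ⟩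
    ∣ a % p + a / p * p - a % p + b / p * p ∣         ≡⟨ ℕ.∣m+n-m+o∣≡∣n-o∣ (a % p) _ _ ⟩
    ∣ a / p * p - b / p * p ∣                         ≡⟨ ℕ.*-distribʳ-∣-∣ p (a / p) (b / p) ⟨
    ∣ a / p - b / p ∣ * p                             ∎)
    where open ≡.≡-Reasoning

  ≅-reflexive : ∀ {a b} → a ≡ b → a ≅ b
  ≅-reflexive {a} ≡.refl = %⇒≅ a a ≡.refl

  ≅-refl : ∀ a → a ≅ a
  ≅-refl a = ≅-reflexive {a} ≡.refl

  ≅-sym : ∀ a b → a ≅ b → b ≅ a
  ≅-sym a b d = ≡.subst (p ℕ.∣_) (ℕ.∣-∣-comm a b) d

  ≅-trans : ∀ a b c → a ≅ b → b ≅ c → a ≅ c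
  ≅-trans a b c d e = %⇒≅ a c (≡.trans (≅⇒% a b d) (≅⇒% b c e))

  ≅-resp : ∀ {a b c d} → a ≡ b → c ≡ d → a ≅ c → b ≅ d
  ≅-resp ≡.refl ≡.refl d = d

  +-≅ : ∀ a b c d → a ≅ b → c ≅ d → a + c ≅ b + d
  +-≅ a b c d e e′ = %⇒≅ (a + c) (b + d) (≡.trans (ℕ.%-distribˡ-+ a c p)
    (≡.trans (≡.cong₂ (λ x y → (x + y) % p) (≅⇒% a b e) (≅⇒% c d e′)) (≡.sym (ℕ.%-distribˡ-+ b d p))))

  *-≅ : ∀ c a b → a ≅ b → c * a ≅ c * b
  *-≅ c a b e = %⇒≅ (c * a) (c * b) (≡.trans (ℕ.%-distribˡ-* c a p)
    (≡.trans (≡.cong (λ x → ((c % p) * x) % p) (≅⇒% a b e)) (≡.sym (ℕ.%-distribˡ-* c b p))))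

  +-cancel-≅ : ∀ a b c → a + c ≅ b + c → a ≅ b
  +-cancel-≅ a b c d = ≡.subst (p ℕ.∣_) (≡.trans (≡.cong₂ ∣_-_∣ (ℕ.+-comm a c) (ℕ.+-comm b c)) (ℕ.∣m+n-m+o∣≡∣n-o∣ c a b)) d

  ∣⇒≅0 : ∀ {a} → p ℕ.∣ a → a ≅ 0
  ∣⇒≅0 {a} d = ≡.subst (p ℕ.∣_) (≡.sym (ℕ.∣-∣-identityʳ a)) d

  ≅0⇒∣ : ∀ {a} → a ≅ 0 → p ℕ.∣ a
  ≅0⇒∣ {a} d = ≡.subst (p ℕ.∣_) (ℕ.∣-∣-identityʳ a) d

  +-≅0 : ∀ a b → a ≅ 0 → b ≅ 0 → a + b ≅ 0
  +-≅0 a b = +-≅ a 0 b 0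

  *-≅0 : ∀ c a → a ≅ 0 → c * a ≅ 0
  *-≅0 c a e = ≅-resp {c * a} ≡.refl (ℕ.*-zeroʳ c) (*-≅ c a 0 e)

  p≢1 : p ≢ 1
  p≢1 e = ℕ.nonTrivial⇒≢1 {{prime⇒nonTrivial prime}} e

  inverse : ∀ c → ¬ p ℕ.∣ c → ∃[ d ] c * d ≅ 1
  inverse c p∤c = from-Bézout (coprime-Bézout {c} {p} coprime)
    where
    coprime : ∀ {d} → d ℕ.∣ c × d ℕ.∣ p → d ≡ 1
    coprime (d∣c , d∣p) with prime⇒irreducible prime d∣p
    ... | inj₁ d≡1    = d≡1
    ... | inj₂ ≡.refl = ⊥-elim (p∤c d∣c)
    from-Bézout : Bézout.Identity 1 c p → ∃[ d ] c * d ≅ 1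
    from-Bézout (Bézout.+- x y e) = x , ≅-resp (≡.trans e (ℕ.*-comm x c)) ≡.refl
      (+-≅ 1 1 (y * p) 0 (≅-refl 1) (∣⇒≅0 (ℕ.n∣m*n y)))
    -- Here 1 + x c = y p, so the inverse of c is -x, with -1 represented by p - 1.
    from-Bézout (Bézout.-+ x y e) = x * (p ∸ 1) , +-cancel-≅ (c * (x * (p ∸ 1))) 1 (x * c) (≅-trans (c * (x * (p ∸ 1)) + x * c) 0 (1 + x * c)
      (∣⇒≅0 (ℕ.∣-trans (ℕ.n∣m*n (x * c)) (ℕ.∣-reflexive (≡.trans (≡.cong (x * c *_) (≡.sym (ℕ.suc-pred p))) (expand x c (p ∸ 1))))))
      (≅-sym (1 + x * c) 0 (∣⇒≅0 (ℕ.∣-trans (ℕ.n∣m*n y) (ℕ.∣-reflexive (≡.sym e))))))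
      where
      expand : ∀ x c q → x * c * suc q ≡ c * (x * q) + x * c
      expand = solve 3 (λ x c q → x :* c :* (con 1 :+ q) := c :* (x :* q) :+ x :* c) ≡.refl
        where open +-*-Solver

  ⊕-cong : ∀ {f f′ g g′} → PolyEq p f f′ → PolyEq p g g′ → PolyEq p (f ⊕ g) (f′ ⊕ g′)
  ⊕-cong {f} {f′} {g} {g′} e e′ i j = ≅-resp (≡.sym (coeff-++ f g i j)) (≡.sym (coeff-++ f′ g′ i j)) (+-≅ (coeff f i j) (coeff f′ i j) (coeff g i j) (coeff g′ i j) (e i j) (e′ i j))

  ≐⇒≈ : ∀ f g → f ≐ g → PolyEq p f g
  ≐⇒≈ f g e i j = ≅-reflexive (e i j)

  coeff-⊗-∷ : ∀ t f g i j → coeff ((t ∷ f) ⊗ g) i j ≡ coeff ((t ∷ []) ⊗ g) i j + coeff (f ⊗ g) i j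
  coeff-⊗-∷ t f g i j = Additive.on-∷ (⊗-additiveˡ g (additive-coeff i j)) t f

  ⊗-congˡ : ∀ f {g g′} → PolyEq p g g′ → PolyEq p (f ⊗ g) (f ⊗ g′)
  ⊗-congˡ []                e i j = ≅-refl 0
  ⊗-congˡ (t@(c , a , b) ∷ f) {g} {g′} e i j = ≅-resp (≡.sym (coeff-⊗-∷ t f g i j)) (≡.sym (coeff-⊗-∷ t f g′ i j))
    (+-≅ (coeff ((t ∷ []) ⊗ g) i j) (coeff ((t ∷ []) ⊗ g′) i j) (coeff (f ⊗ g) i j) (coeff (f ⊗ g′) i j)
      (single (shifted a b i j)) (⊗-congˡ f {g} {g′} e i j))
    where
    single : ∀ {i j} → Shifted a b i j → coeff ((t ∷ []) ⊗ g) i j ≅ coeff ((t ∷ []) ⊗ g′) i j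
    single (inside i j)      = ≅-resp (≡.sym (monomial-coeff c a b g i j)) (≡.sym (monomial-coeff c a b g′ i j)) (*-≅ c (coeff g i j) (coeff g′ i j) (e i j))
    single (outside {i} {j} ≰) = ≅-reflexive (≡.trans (monomial-coeff-≰ c a b g i j ≰) (≡.sym (monomial-coeff-≰ c a b g′ i j ≰)))

  ≈-trans : ∀ {f g h} → PolyEq p f g → PolyEq p g h → PolyEq p f h
  ≈-trans {f} {g} {h} e e′ i j = ≅-trans (coeff f i j) (coeff g i j) (coeff h i j) (e i j) (e′ i j)

  ≈-sym : ∀ {f g} → PolyEq p f g → PolyEq p g f
  ≈-sym {f} {g} e i j = ≅-sym (coeff f i j) (coeff g i j) (e i j)

  ≈-refl : ∀ f → PolyEq p f f
  ≈-refl f i j = ≅-refl (coeff f i j)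

  ⊗-cong : ∀ {f f′ g g′} → PolyEq p f f′ → PolyEq p g g′ → PolyEq p (f ⊗ g) (f′ ⊗ g′)
  ⊗-cong {f} {f′} {g} {g′} e e′ = ≈-trans {f ⊗ g} {f ⊗ g′} {f′ ⊗ g′} (⊗-congˡ f {g} {g′} e′)
    (≈-trans {f ⊗ g′} {g′ ⊗ f} {f′ ⊗ g′} (≐⇒≈ (f ⊗ g′) (g′ ⊗ f) (⊗-comm f g′))
      (≈-trans {g′ ⊗ f} {g′ ⊗ f′} {f′ ⊗ g′} (⊗-congˡ g′ {f} {f′} e) (≐⇒≈ (g′ ⊗ f′) (f′ ⊗ g′) (⊗-comm g′ f′))))

  -- Coefficients are natural numbers, so p - 1 plays the role of -1.
  ⊖_ : Poly → Poly
  ⊖ f = scalar (p ∸ 1) f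

  ⊕-inverseʳ : ∀ f → PolyEq p (f ⊕ (⊖ f)) 0ₚ
  ⊕-inverseʳ f i j = ∣⇒≅0 (ℕ.∣-trans (ℕ.m∣m*n (coeff f i j)) (ℕ.∣-reflexive (≡.trans
    (≡.cong (_* coeff f i j) (≡.sym (ℕ.suc-pred p)))
    (≡.sym (≡.trans (coeff-++ f (⊖ f) i j) (≡.cong (coeff f i j +_) (coeff-scalar (p ∸ 1) f i j)))))))

  ⊕-comm : ∀ f g → f ⊕ g ≐ g ⊕ f
  ⊕-comm f g i j = ≡.trans (coeff-++ f g i j) (≡.trans (ℕ.+-comm (coeff f i j) _) (≡.sym (coeff-++ g f i j)))

  polynomialRing : CommutativeRing 0ℓ 0ℓ
  polynomialRing = record
    { Carrier = Poly ; _≈_ = PolyEq p ; _+_ = _⊕_ ; _*_ = _⊗_ ; -_ = ⊖_ ; 0# = 0ₚ ; 1# = 1ₚ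
    ; isCommutativeRing = record
      { isRing = record
        { +-isAbelianGroup = record
          { isGroup = record
            { isMonoid = record
              { isSemigroup = record
                { isMagma = record
                  { isEquivalence = record
                    { refl = λ {f} → ≈-refl f ; sym = λ {f} {g} → ≈-sym {f} {g} ; trans = λ {f} {g} {h} → ≈-trans {f} {g} {h} }
                  ; ∙-cong = λ {f} {f′} {g} {g′} → ⊕-cong {f} {f′} {g} {g′} }
                ; assoc = λ f g h i j → ≅-reflexive (≡.cong (λ l → coeff l i j) (List.++-assoc f g h)) }
              ; identity = (λ f → ≈-refl f) , λ f i j → ≅-reflexive (≡.cong (λ l → coeff l i j) (List.++-identityʳ f)) }
            ; inverse = (λ f → ≈-trans {(⊖ f) ⊕ f} {f ⊕ (⊖ f)} {0ₚ} (≐⇒≈ ((⊖ f) ⊕ f) (f ⊕ (⊖ f)) (⊕-comm (⊖ f) f)) (⊕-inverseʳ f)) , ⊕-inverseʳ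
            ; ⁻¹-cong = λ {f} {g} e i j → ≅-resp (≡.sym (coeff-scalar (p ∸ 1) f i j)) (≡.sym (coeff-scalar (p ∸ 1) g i j))
                (*-≅ (p ∸ 1) (coeff f i j) (coeff g i j) (e i j)) }
          ; comm = λ f g → ≐⇒≈ (f ⊕ g) (g ⊕ f) (⊕-comm f g) }
        ; *-cong = λ {f} {f′} {g} {g′} → ⊗-cong {f} {f′} {g} {g′}
        ; *-assoc = λ f g h → ≐⇒≈ ((f ⊗ g) ⊗ h) (f ⊗ (g ⊗ h)) (⊗-assoc f g h)
        ; *-identity = (λ f → ≐⇒≈ (1ₚ ⊗ f) f (⊗-identityˡ f)) ,
            λ f i j → ≅-reflexive (≡.trans (⊗-comm f 1ₚ i j) (⊗-identityˡ f i j))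
        ; distrib = (λ f g h i j → ≅-reflexive (≡.trans (Additive.on-++ (⊗-additiveʳ f (additive-coeff i j)) g h) (≡.sym (coeff-++ (f ⊗ g) (f ⊗ h) i j)))) ,
            λ f g h i j → ≅-reflexive (≡.trans (Additive.on-++ (⊗-additiveˡ f (additive-coeff i j)) g h) (≡.sym (coeff-++ (g ⊗ f) (h ⊗ f) i j))) }
      ; *-comm = λ f g → ≐⇒≈ (f ⊗ g) (g ⊗ f) (⊗-comm f g) } }

  part-≈ : ∀ {d} f → Homog p d f → PolyEq p f (homogeneous-part d f)
  part-≈ {d} f h i j with i + j ≟ d
  ... | yes e = ≅-reflexive (≡.sym (coeff-part d f i j e))
  ... | no ¬e = ≅-trans (coeff f i j) 0 _ (h i j ¬e) (≅-reflexive (≡.sym (coeff-part-≢ d f i j ¬e)))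

  -- The list of a homogeneous polynomial may contain terms of other degrees whose coefficients
  -- vanish only in sum modulo p. Passing to `homogeneous-part` leaves an equal polynomial in which
  -- every listed term has the right degree.
  homog-⊗ : ∀ {m n} f g → Homog p m f → Homog p n g → Homog p (m + n) (f ⊗ g)
  homog-⊗ {m} {n} f g hf hg i j i+j≢ = ≅-trans (coeff (f ⊗ g) i j) (coeff (homogeneous-part m f ⊗ g) i j) 0
    (⊗-cong {f} {homogeneous-part m f} {g} {g} (part-≈ f hf) (≈-refl g) i j) (parts f i j i+j≢)
    where
    parts : ∀ f i j → i + j ≢ m + n → coeff (homogeneous-part m f ⊗ g) i j ≅ 0
    parts []                i j off = ≅-refl 0
    parts ((c , a , b) ∷ f) i j off with a + b ≟ m
    ... | no _  = parts f i j off
    ... | yes e = ≅-resp (≡.sym (coeff-⊗-∷ (c , a , b) (homogeneous-part m f) g i j)) ≡.refl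
                    (+-≅0 (coeff (((c , a , b) ∷ []) ⊗ g) i j) _ (single (shifted a b i j) off) (parts f i j off))
      where
      interchange : ∀ i j → (a + b) + (i + j) ≡ (a + i) + (b + j)
      interchange = solve 4 (λ a b i j → (a :+ b) :+ (i :+ j) := (a :+ i) :+ (b :+ j)) ≡.refl a b
        where open +-*-Solver
      single : ∀ {i j} → Shifted a b i j → i + j ≢ m + n → coeff (((c , a , b) ∷ []) ⊗ g) i j ≅ 0
      single (outside {i} {j} ≰) _ = ≅-reflexive (monomial-coeff-≰ c a b g i j ≰)
      single (inside i j) off = ≅-resp (≡.sym (monomial-coeff c a b g i j)) ≡.refl
        (*-≅0 c (coeff g i j) (hg i j λ e′ → off (≡.trans (≡.sym (interchange i j)) (≡.cong₂ _+_ e e′))))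

  -- Membership in the d-th power of the ideal (x, y) modulo p, a condition stable under
  -- multiplication by any polynomial.
  Order : ℕ → Poly → Set
  Order d g = ∀ i j → i + j < d → coeff g i j ≅ 0

  order-⊗ : ∀ {d} f g → Order d g → Order d (f ⊗ g)
  order-⊗ []                g o i j lt = ≅-refl 0
  order-⊗ {d} ((c , a , b) ∷ f) g o i j lt = ≅-resp (≡.sym (coeff-⊗-∷ (c , a , b) f g i j)) ≡.refl
    (+-≅0 (coeff (((c , a , b) ∷ []) ⊗ g) i j) _ (single (shifted a b i j) lt) (order-⊗ f g o i j lt))
    where
    single : ∀ {i j} → Shifted a b i j → i + j < d → coeff (((c , a , b) ∷ []) ⊗ g) i j ≅ 0
    single (outside {i} {j} ≰) _ = ≅-reflexive (monomial-coeff-≰ c a b g i j ≰)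
    single (inside i j) lt = ≅-resp (≡.sym (monomial-coeff c a b g i j)) ≡.refl
      (*-≅0 c (coeff g i j) (o i j (ℕ.≤-<-trans (ℕ.+-mono-≤ (ℕ.m≤n+m i a) (ℕ.m≤n+m j b)) lt)))

  homog⇒order : ∀ {e d} g → Homog p d g → e < d → Order (suc e) g
  homog⇒order g h e<d i j lt = h i j λ i+j≡d → ℕ.<⇒≱ (ℕ.<-≤-trans e<d (ℕ.≤-reflexive (≡.sym i+j≡d))) (ℕ.≤-pred lt)

  homog-low : ∀ {e d d′ f g g′} → Homog p e f → Homog p d g → Homog p d′ g′ → e < d → e < d′ →
              ∀ a b → PolyEq p f ((a ⊗ g) ⊕ (b ⊗ g′)) → PolyEq p f 0ₚ
  homog-low {e} {f = f} {g} {g′} h hg hg′ e<d e<d′ a b eq i j with i + j ≟ e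
  ... | no ¬e      = h i j ¬e
  ... | yes ≡.refl = ≅-trans (coeff f i j) _ 0 (eq i j) (≅-resp (≡.sym (coeff-++ (a ⊗ g) (b ⊗ g′) i j)) ≡.refl
          (+-≅0 (coeff (a ⊗ g) i j) _ (order-⊗ a g (homog⇒order g hg e<d) i j ℕ.≤-refl)
                                      (order-⊗ b g′ (homog⇒order g′ hg′ e<d′) i j ℕ.≤-refl)))

  coeff-X⊗-suc : ∀ f i j → coeff (xₚ ⊗ f) (suc i) j ≡ coeff f i j
  coeff-X⊗-suc f i j = ≡.trans (monomial-coeff 1 1 0 f i j) (ℕ.+-identityʳ _)

  coeff-X⊗-zero : ∀ f j → coeff (xₚ ⊗ f) 0 j ≡ 0
  coeff-X⊗-zero f j = monomial-coeff-≰ 1 1 0 f 0 j (λ ())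

  coeff-Y⊗-suc : ∀ f i j → coeff (yₚ ⊗ f) i (suc j) ≡ coeff f i j
  coeff-Y⊗-suc f i j = ≡.trans (monomial-coeff 1 0 1 f i j) (ℕ.+-identityʳ _)

  coeff-Y⊗-zero : ∀ f i → coeff (yₚ ⊗ f) i 0 ≡ 0
  coeff-Y⊗-zero f i = monomial-coeff-≰ 1 0 1 f i 0 (λ ())

  homog-quotient-X : ∀ {n} f → Homog p (suc n) (xₚ ⊗ f) → Homog p n f
  homog-quotient-X f h i j off = ≅-resp (coeff-X⊗-suc f i j) ≡.refl (h (suc i) j (off ∘ ℕ.suc-injective))

  homog-quotient-Y : ∀ {n} f → Homog p (suc n) (yₚ ⊗ f) → Homog p n f
  homog-quotient-Y f h i j off = ≅-resp (coeff-Y⊗-suc f i j) ≡.refl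
    (h i (suc j) λ e → off (ℕ.suc-injective (≡.trans (≡.sym (ℕ.+-suc i j)) e)))

  -- The coefficient of (x + y) f at (i + 1, j + 1) is the sum of those of `f` at (i, j + 1) and (i
  -- + 1, j), which have equal degree. So vanishing passes from i to i + 1, starting from (0, j +
  -- 1), where the product has the coefficient of `f` at (0, j).
  homog-quotient-X+Y : ∀ {n} f → Homog p (suc n) ((xₚ ⊕ yₚ) ⊗ f) → Homog p n f
  homog-quotient-X+Y {n} f h = go
    where
    expand : ∀ i j → coeff ((xₚ ⊕ yₚ) ⊗ f) i j ≡ coeff (xₚ ⊗ f) i j + coeff (yₚ ⊗ f) i j
    expand = coeff-⊗-∷ (1 , 1 , 0) yₚ f
    go : Homog p n f
    go zero    j off = ≅-resp (≡.trans (expand 0 (suc j)) (≡.cong₂ _+_ (coeff-X⊗-zero f (suc j)) (coeff-Y⊗-suc f 0 j))) ≡.refl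
                       (h 0 (suc j) (off ∘ ℕ.suc-injective))
    go (suc i) j off = ≅-trans (coeff f (suc i) j) (coeff f i (suc j) + coeff f (suc i) j) 0 (+-≅ 0 (coeff f i (suc j)) (coeff f (suc i) j) (coeff f (suc i) j)
                         (≅-sym (coeff f i (suc j)) 0 (go i (suc j) λ e → off (≡.trans (≡.sym (ℕ.+-suc i j)) e))) (≅-refl (coeff f (suc i) j)))
                       (≅-resp (≡.trans (expand (suc i) (suc j)) (≡.cong₂ _+_ (coeff-X⊗-suc f i (suc j)) (coeff-Y⊗-suc f (suc i) j))) ≡.refl
                         (h (suc i) (suc j) (λ e → off (≡.trans (≡.sym (ℕ.+-suc i j)) (ℕ.suc-injective e)))))

-- F_p[x,y] with its derivations and Frobenius map as an instance

module Instance (p : ℕ) (prime : Prime p) where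
  open Modular p prime

  at-x=0 : Poly → Poly
  at-x=0 = concatMap λ { (c , zero , b) → (c , zero , b) ∷ [] ; (c , suc a , b) → [] }

  coeff-at-x=0 : ∀ f j → coeff (at-x=0 f) 0 j ≡ coeff f 0 j
  coeff-at-x=0 f j = additive-ext (additive-concatMap _ (additive-coeff 0 j)) (additive-coeff 0 j)
    (λ { (c , zero , b) → ≡.refl ; (c , suc a , b) → ≡.refl }) f

  coeff-at-x=0-suc : ∀ f i j → coeff (at-x=0 f) (suc i) j ≡ 0
  coeff-at-x=0-suc f i j = additive-ext (additive-concatMap _ (additive-coeff (suc i) j)) additive-0
    (λ { (c , zero , b) → ≡.refl ; (c , suc a , b) → ≡.refl }) f

  divY : Poly → Poly
  divY f = swap (divX (swap f))

  coeff-divY : ∀ f i j → coeff (divY f) i j ≡ coeff f i (suc j)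
  coeff-divY f i j = ≡.trans (coeff-swap (divX (swap f)) i j) (≡.trans (coeff-divX (swap f) j i) (coeff-swap f (suc j) i))

  -- The terms divisible by x go to X g; what remains is f(0, y), which is divisible by y because
  -- the constant term vanishes in positive degree.
  homog-split : ∀ {n f} → Homog p (suc n) f →
                ∃[ g ] ∃[ h ] Homog p n g × Homog p n h × PolyEq p f ((xₚ ⊗ g) ⊕ (yₚ ⊗ h))
  homog-split {n} {f} hf = g , h ,
    (λ i j off → ≅-resp (≡.sym (coeff-divX f i j)) ≡.refl (hf (suc i) j (off ∘ ℕ.suc-injective))) ,
    homog-h , λ i j → ≅-trans (coeff f i j) (coeff (xₚ ⊗ g) i j + coeff (yₚ ⊗ h) i j) _ (split i j)
      (≅-reflexive (≡.sym (coeff-++ (xₚ ⊗ g) (yₚ ⊗ h) i j)))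
    where
    g = divX f
    h = divY (at-x=0 f)
    homog-h : Homog p n h
    homog-h zero    j off = ≅-resp (≡.sym (≡.trans (coeff-divY (at-x=0 f) 0 j) (coeff-at-x=0 f (suc j)))) ≡.refl
                              (hf 0 (suc j) (off ∘ ℕ.suc-injective))
    homog-h (suc i) j off = ≅-reflexive (≡.trans (coeff-divY (at-x=0 f) (suc i) j) (coeff-at-x=0-suc f i (suc j)))
    split : ∀ i j → coeff f i j ≅ coeff (xₚ ⊗ g) i j + coeff (yₚ ⊗ h) i j
    split zero    zero    = ≅-trans (coeff f 0 0) 0 _ (hf 0 0 (λ ()))
      (≅-reflexive (≡.sym (≡.cong₂ _+_ (coeff-X⊗-zero g 0) (coeff-Y⊗-zero h 0))))
    split zero    (suc j) = ≅-reflexive (≡.sym (≡.cong₂ _+_ (coeff-X⊗-zero g (suc j))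
      (≡.trans (coeff-Y⊗-suc h 0 j) (≡.trans (coeff-divY (at-x=0 f) 0 j) (coeff-at-x=0 f (suc j))))))
    split (suc i) zero    = ≅-reflexive (≡.sym (≡.trans (≡.cong₂ _+_
      (≡.trans (coeff-X⊗-suc g i 0) (coeff-divX f i 0)) (coeff-Y⊗-zero h (suc i))) (ℕ.+-identityʳ _)))
    split (suc i) (suc j) = ≅-reflexive (≡.sym (≡.trans (≡.cong₂ _+_
      (≡.trans (coeff-X⊗-suc g i (suc j)) (coeff-divX f i (suc j)))
      (≡.trans (coeff-Y⊗-suc h (suc i) j) (≡.trans (coeff-divY (at-x=0 f) (suc i) j) (coeff-at-x=0-suc f i (suc j)))))
      (ℕ.+-identityʳ _)))

  constant : ℕ → Poly
  constant c = (c , 0 , 0) ∷ []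

  homog-constant : ∀ c → Homog p 0 (constant c)
  homog-constant c i j off = ≅-reflexive (≡.cong (_+ 0) (term-no c 0 0 i j λ { (≡.refl , ≡.refl) → off ≡.refl }))

  homog-0-≈ : ∀ f → Homog p 0 f → PolyEq p f (constant (coeff f 0 0))
  homog-0-≈ f h zero    zero    = ≅-reflexive (≡.sym (ℕ.+-identityʳ (coeff f 0 0)))
  homog-0-≈ f h zero    (suc j) = h 0 (suc j) (λ ())
  homog-0-≈ f h (suc i) j       = h (suc i) j (λ ())

  constant-cong : ∀ c d → c ≅ d → PolyEq p (constant c) (constant d)
  constant-cong c d e zero    zero    = +-≅ c d 0 0 e (≅-refl 0)
  constant-cong c d e zero    (suc j) = ≅-refl 0
  constant-cong c d e (suc i) j       = ≅-refl 0

  homog-const : ∀ {f} → Homog p 0 f → PolyEq p f 0ₚ ⊎ ∃[ g ] Homog p 0 g × PolyEq p (f ⊗ g) 1ₚ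
  homog-const {f} h with p ℕ.∣? coeff f 0 0
  ... | yes p∣c = inj₁ (≈-trans {f} {constant (coeff f 0 0)} {0ₚ} (homog-0-≈ f h)
                    (≈-trans {constant (coeff f 0 0)} {constant 0} {0ₚ} (constant-cong (coeff f 0 0) 0 (∣⇒≅0 p∣c)) zeroes))
    where
    zeroes : PolyEq p (constant 0) 0ₚ
    zeroes zero    zero    = ≅-refl 0
    zeroes zero    (suc j) = ≅-refl 0
    zeroes (suc i) j       = ≅-refl 0
  ... | no p∤c with inverse (coeff f 0 0) p∤c
  ... | d , cd = inj₂ (constant d , homog-constant d ,
      ≈-trans {f ⊗ constant d} {constant (coeff f 0 0) ⊗ constant d} {1ₚ}
        (⊗-cong {f} {constant (coeff f 0 0)} {constant d} {constant d} (homog-0-≈ f h) (≈-refl (constant d)))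
        (constant-cong (coeff f 0 0 * d) 1 cd))

  homog-xₚ : Homog p 1 xₚ
  homog-xₚ i j off = ≅-reflexive (≡.cong (_+ 0) (term-no 1 1 0 i j λ { (≡.refl , ≡.refl) → off ≡.refl }))

  homog-yₚ : Homog p 1 yₚ
  homog-yₚ i j off = ≅-reflexive (≡.cong (_+ 0) (term-no 1 0 1 i j λ { (≡.refl , ≡.refl) → off ≡.refl }))

  homog-resp : ∀ {n f g} → PolyEq p f g → Homog p n f → Homog p n g
  homog-resp {f = f} {g} e h i j off = ≅-trans (coeff g i j) (coeff f i j) 0 (≅-sym (coeff f i j) (coeff g i j) (e i j)) (h i j off)

  homog-unique : ∀ {m n f} → m ≢ n → Homog p m f → Homog p n f → PolyEq p f 0ₚ
  homog-unique {m} m≢n h h′ i j with i + j ≟ m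
  ... | yes e = h′ i j (λ e′ → m≢n (≡.trans (≡.sym e) e′))
  ... | no ¬e = h i j ¬e

  -- The coefficients of `f` free of x are those of y f in the same column, shifted by one, and a
  -- multiple of x has none.
  X∣Y*⇒X∣ : ∀ f → InIdeal p (yₚ ⊗ f) xₚ → InIdeal p f xₚ
  X∣Y*⇒X∣ f (h , e) = divX f , multiple
    where
    multiple : PolyEq p f (xₚ ⊗ divX f)
    multiple zero    j = ≅-resp (coeff-Y⊗-suc f 0 j) (≡.trans (coeff-X⊗-zero h (suc j)) (≡.sym (coeff-X⊗-zero (divX f) j))) (e 0 (suc j))
    multiple (suc i) j = ≅-reflexive (≡.sym (≡.trans (coeff-X⊗-suc (divX f) i j) (coeff-divX f i j)))

  plane : Plane
  plane = record
    { R = polynomialRing ; X = xₚ ; Y = yₚ ; Homog = Homog p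
    ; homog-cong = λ {n} {f} {g} → homog-resp {n} {f} {g}
    ; homog-0 = λ n i j off → ≅-refl 0
    ; homog-1 = homog-constant 1
    ; homog-X = homog-xₚ ; homog-Y = homog-yₚ
    ; homog-+ = λ {n} {f} {g} h h′ i j off → ≅-resp (≡.sym (coeff-++ f g i j)) ≡.refl (+-≅0 (coeff f i j) (coeff g i j) (h i j off) (h′ i j off))
    ; homog-neg = λ {n} {f} h i j off → ≅-resp (≡.sym (coeff-scalar (p ∸ 1) f i j)) ≡.refl (*-≅0 (p ∸ 1) (coeff f i j) (h i j off))
    ; homog-* = λ {m} {n} {f} {g} → homog-⊗ {m} {n} f g
    ; homog-unique = λ {m} {n} {f} → homog-unique {m} {n} {f}
    ; homog-low = λ {e} {d} {d′} {f} {g} {g′} → homog-low {e} {d} {d′} {f} {g} {g′}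
    ; homog-split = λ {n} {f} → homog-split {n} {f}
    ; homog-const = λ {f} → homog-const {f}
    ; quotient-X = homog-quotient-X
    ; quotient-Y = homog-quotient-Y
    ; quotient-X+Y = homog-quotient-X+Y
    ; X∣Y*⇒X∣ = X∣Y*⇒X∣
    ; 1≉0 = λ e → p≢1 (ℕ.∣1⇒≡1 (≅0⇒∣ (e 0 0))) }

  swap-cong : ∀ {f g} → PolyEq p f g → PolyEq p (swap f) (swap g)
  swap-cong {f} {g} e i j = ≅-resp (≡.sym (coeff-swap f i j)) (≡.sym (coeff-swap g i j)) (e j i)

  homog-swap : ∀ {n f} → Homog p n f → Homog p n (swap f)
  homog-swap {f = f} h i j off = ≅-resp (≡.sym (coeff-swap f i j)) ≡.refl (h j i λ e → off (≡.trans (ℕ.+-comm i j) e))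

  ∂x-cong : ∀ {f g} → PolyEq p f g → PolyEq p (∂x f) (∂x g)
  ∂x-cong {f} {g} e i j = ≅-resp (≡.sym (coeff-∂x f i j)) (≡.sym (coeff-∂x g i j))
    (*-≅ (suc i) (coeff f (suc i) j) (coeff g (suc i) j) (e (suc i) j))

  ∂x-homog : ∀ {n f} → Homog p (suc n) f → Homog p n (∂x f)
  ∂x-homog {f = f} h i j off = ≅-resp (≡.sym (coeff-∂x f i j)) ≡.refl
    (*-≅0 (suc i) (coeff f (suc i) j) (h (suc i) j (off ∘ ℕ.suc-injective)))

  ∂x-const : ∀ {f} → Homog p 0 f → PolyEq p (∂x f) 0ₚ
  ∂x-const {f} h i j = ≅-resp (≡.sym (coeff-∂x f i j)) ≡.refl (*-≅0 (suc i) (coeff f (suc i) j) (h (suc i) j (λ ())))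

  concatMap-⊕ : ∀ (k : Monomial → Poly) f g → PolyEq p (concatMap k (f ⊕ g)) (concatMap k f ⊕ concatMap k g)
  concatMap-⊕ k f g i j = ≅-reflexive (≡.trans (Additive.on-++ (additive-concatMap k (additive-coeff i j)) f g)
    (≡.sym (coeff-++ (concatMap k f) (concatMap k g) i j)))

  partial-x : IsPartial plane ∂x
  partial-x = record
    { ∂-cong = λ {f} {g} → ∂x-cong {f} {g}
    ; ∂-+ = concatMap-⊕ _
    ; ∂-* = λ f g → ≐⇒≈ (∂x (f ⊗ g)) ((f ⊗ ∂x g) ⊕ (∂x f ⊗ g)) (∂x-⊗ f g)
    ; ∂-homog = λ {n} {f} → ∂x-homog {n} {f}
    ; ∂-const = λ {f} → ∂x-const {f} }

  -- As a conjugate of `∂x` by the exchange of variables it inherits the product rule.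
  ∂y : Poly → Poly
  ∂y f = swap (∂x (swap f))

  coeff-∂y : ∀ f i j → coeff (∂y f) i j ≡ suc j * coeff f i (suc j)
  coeff-∂y f i j = ≡.trans (coeff-swap (∂x (swap f)) i j) (≡.trans (coeff-∂x (swap f) j i) (≡.cong (suc j *_) (coeff-swap f (suc j) i)))

  swap-swap : ∀ f → swap (swap f) ≐ f
  swap-swap f i j = ≡.trans (coeff-swap (swap f) i j) (coeff-swap f j i)

  partial-y : IsPartial plane ∂y
  partial-y = record
    { ∂-cong = λ {f} {g} e → swap-cong {∂x (swap f)} {∂x (swap g)} (∂x-cong {swap f} {swap g} (swap-cong {f} {g} e))
    ; ∂-+ = λ f g → ≈-trans {∂y (f ⊕ g)} {swap (∂x (swap f) ⊕ ∂x (swap g))} {∂y f ⊕ ∂y g}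
        (swap-cong {∂x (swap (f ⊕ g))} {∂x (swap f) ⊕ ∂x (swap g)}
          (≈-trans {∂x (swap (f ⊕ g))} {∂x (swap f ⊕ swap g)} {∂x (swap f) ⊕ ∂x (swap g)}
            (∂x-cong {swap (f ⊕ g)} {swap f ⊕ swap g} (concatMap-⊕ _ f g)) (concatMap-⊕ _ (swap f) (swap g))))
        (concatMap-⊕ _ (∂x (swap f)) (∂x (swap g)))
    ; ∂-* = λ f g →
        let f′ = swap f
            g′ = swap g
        in ≈-trans {∂y (f ⊗ g)} {swap ((f′ ⊗ ∂x g′) ⊕ (∂x f′ ⊗ g′))} {(f ⊗ ∂y g) ⊕ (∂y f ⊗ g)}
          (swap-cong {∂x (swap (f ⊗ g))} {(f′ ⊗ ∂x g′) ⊕ (∂x f′ ⊗ g′)}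
            (≈-trans {∂x (swap (f ⊗ g))} {∂x (f′ ⊗ g′)} {(f′ ⊗ ∂x g′) ⊕ (∂x f′ ⊗ g′)}
              (∂x-cong {swap (f ⊗ g)} {f′ ⊗ g′} (≐⇒≈ (swap (f ⊗ g)) (f′ ⊗ g′) (swap-⊗ f g)))
              (≐⇒≈ (∂x (f′ ⊗ g′)) ((f′ ⊗ ∂x g′) ⊕ (∂x f′ ⊗ g′)) (∂x-⊗ f′ g′))))
          (≈-trans {swap ((f′ ⊗ ∂x g′) ⊕ (∂x f′ ⊗ g′))} {swap (f′ ⊗ ∂x g′) ⊕ swap (∂x f′ ⊗ g′)} {(f ⊗ ∂y g) ⊕ (∂y f ⊗ g)}
            (concatMap-⊕ _ (f′ ⊗ ∂x g′) (∂x f′ ⊗ g′))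
            (⊕-cong {swap (f′ ⊗ ∂x g′)} {f ⊗ ∂y g} {swap (∂x f′ ⊗ g′)} {∂y f ⊗ g}
              (≈-trans {swap (f′ ⊗ ∂x g′)} {swap f′ ⊗ ∂y g} {f ⊗ ∂y g}
                (≐⇒≈ (swap (f′ ⊗ ∂x g′)) (swap f′ ⊗ ∂y g) (swap-⊗ f′ (∂x g′)))
                (⊗-cong {swap f′} {f} {∂y g} {∂y g} (≐⇒≈ (swap f′) f (swap-swap f)) (≈-refl (∂y g))))
              (≈-trans {swap (∂x f′ ⊗ g′)} {∂y f ⊗ swap g′} {∂y f ⊗ g}
                (≐⇒≈ (swap (∂x f′ ⊗ g′)) (∂y f ⊗ swap g′) (swap-⊗ (∂x f′) g′))
                (⊗-cong {∂y f} {∂y f} {swap g′} {g} (≈-refl (∂y f)) (≐⇒≈ (swap g′) g (swap-swap g))))))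
    ; ∂-homog = λ {n} {f} h → homog-swap {n} {∂x (swap f)} (∂x-homog {n} {swap f} (homog-swap {suc n} {f} h))
    ; ∂-const = λ {f} h → swap-cong {∂x (swap f)} {0ₚ} (∂x-const {swap f} (homog-swap {0} {f} h)) }

  φ : Poly → Poly
  φ = concatMap λ { (c , a , b) → (c , p * a , p * b) ∷ [] }

  -- The divisibility decisions are arguments so that the coefficient formula for π can be proved by
  -- matching on them.
  extract : ∀ c a b → Dec (p ℕ.∣ a) → Dec (p ℕ.∣ b) → Poly
  extract c a b (yes (ℕ.divides a′ _)) (yes (ℕ.divides b′ _)) = (c , a′ , b′) ∷ []
  extract c a b _                      _                      = []

  π : Poly → Poly
  π = concatMap λ { (c , a , b) → extract c a b (p ℕ.∣? a) (p ℕ.∣? b) }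

  coeff-φ : ∀ f i j → coeff (φ f) (p * i) (p * j) ≡ coeff f i j
  coeff-φ f i j = additive-ext (additive-concatMap _ (additive-coeff (p * i) (p * j))) (additive-coeff i j)
    (λ { (c , a , b) → ≡.cong (_+ 0) (term-⇔ c (p * a) (p * b) (p * i) (p * j) a b i j
      (λ e e′ → ℕ.*-cancelˡ-≡ _ _ p e , ℕ.*-cancelˡ-≡ _ _ p e′) (λ e e′ → ≡.cong (p *_) e , ≡.cong (p *_) e′)) }) f

  coeff-φ-∤ : ∀ f i j → ¬ (p ℕ.∣ i × p ℕ.∣ j) → coeff (φ f) i j ≡ 0
  coeff-φ-∤ f i j ∤ = additive-ext (additive-concatMap _ (additive-coeff i j)) additive-0
    (λ { (c , a , b) → ≡.cong (_+ 0) (term-no c (p * a) (p * b) i j λ { (≡.refl , ≡.refl) → ∤ (ℕ.m∣m*n a , ℕ.m∣m*n b) }) }) f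

  coeff-π : ∀ f i j → coeff (π f) i j ≡ coeff f (p * i) (p * j)
  coeff-π f i j = additive-ext (additive-concatMap _ (additive-coeff i j)) (additive-coeff (p * i) (p * j))
    (λ { (c , a , b) → single c a b (p ℕ.∣? a) (p ℕ.∣? b) }) f
    where
    single : ∀ c a b a? b? → coeff (extract c a b a? b? ++ []) i j ≡ term c a b (p * i) (p * j) + 0
    single c a b (yes (ℕ.divides a′ ≡.refl)) (yes (ℕ.divides b′ ≡.refl)) =
      ≡.cong (_+ 0) (term-⇔ c a′ b′ i j (a′ * p) (b′ * p) (p * i) (p * j)
        (λ e e′ → ≡.trans (ℕ.*-comm a′ p) (≡.cong (p *_) e) , ≡.trans (ℕ.*-comm b′ p) (≡.cong (p *_) e′))
        (λ e e′ → ℕ.*-cancelˡ-≡ _ _ p (≡.trans (ℕ.*-comm p a′) e) , ℕ.*-cancelˡ-≡ _ _ p (≡.trans (ℕ.*-comm p b′) e′)))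
    single c a b (yes _) (no p∤b) = ≡.sym (≡.cong (_+ 0) (term-no c a b (p * i) (p * j) λ { (_ , ≡.refl) → p∤b (ℕ.m∣m*n j) }))
    single c a b (no p∤a) _       = ≡.sym (≡.cong (_+ 0) (term-no c a b (p * i) (p * j) λ { (≡.refl , _) → p∤a (ℕ.m∣m*n i) }))

  data Exponent : ℕ → ℕ → Set where
    multiples : ∀ i j → Exponent (p * i) (p * j)
    others    : ∀ {i j} → ¬ (p ℕ.∣ i × p ℕ.∣ j) → Exponent i j

  exponent : ∀ i j → Exponent i j
  exponent i j with p ℕ.∣? i | p ℕ.∣? j
  ... | no ∤  | _     = others (∤ ∘ proj₁)
  ... | yes _ | no ∤  = others (∤ ∘ proj₂)
  ... | yes (ℕ.divides i′ ≡.refl) | yes (ℕ.divides j′ ≡.refl) =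
    ≡.subst₂ Exponent (ℕ.*-comm p i′) (ℕ.*-comm p j′) (multiples i′ j′)

  φ-cong : ∀ {f g} → PolyEq p f g → PolyEq p (φ f) (φ g)
  φ-cong {f} {g} e i j = go (exponent i j)
    where
    go : ∀ {i j} → Exponent i j → coeff (φ f) i j ≅ coeff (φ g) i j
    go (multiples i j)    = ≅-resp (≡.sym (coeff-φ f i j)) (≡.sym (coeff-φ g i j)) (e i j)
    go (others {i} {j} ∤) = ≅-reflexive (≡.trans (coeff-φ-∤ f i j ∤) (≡.sym (coeff-φ-∤ g i j ∤)))

  φ-⊗ : ∀ f g → φ (f ⊗ g) ≐ φ f ⊗ φ g
  φ-⊗ f g i j = additive-ext (⊗-additiveˡ g S) (additive-concatMap _ (⊗-additiveˡ (φ g) K)) (λ t →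
    additive-ext (⊗-additiveʳ (t ∷ []) S) (additive-concatMap _ (⊗-additiveʳ (φ (t ∷ [])) K)) (single t) g) f
    where
    K = additive-coeff i j
    S : Additive (λ f → coeff (φ f) i j)
    S = additive-concatMap _ K
    single : ∀ t s → coeff (φ ((t ∷ []) ⊗ (s ∷ []))) i j ≡ coeff (φ (t ∷ []) ⊗ φ (s ∷ [])) i j
    single (c , a , b) (d , a′ , b′) rewrite ℕ.*-distribˡ-+ p a a′ | ℕ.*-distribˡ-+ p b b′ = ≡.refl

  π-cong : ∀ {f g} → PolyEq p f g → PolyEq p (π f) (π g)
  π-cong {f} {g} e i j = ≅-resp (≡.sym (coeff-π f i j)) (≡.sym (coeff-π g i j)) (e (p * i) (p * j))

  π-φ* : ∀ f g → π (φ f ⊗ g) ≐ f ⊗ π g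
  π-φ* f g i j = additive-ext (additive-concatMap _ (⊗-additiveˡ g S)) (⊗-additiveˡ (π g) (additive-coeff i j))
    (λ { (c , a , b) → ≡.trans (coeff-π (φ ((c , a , b) ∷ []) ⊗ g) i j) (single c a b (shifted a b i j)) }) f
    where
    S : Additive (λ f → coeff (π f) i j)
    S = additive-concatMap _ (additive-coeff i j)
    single : ∀ c a b {i j} → Shifted a b i j →
             coeff (((c , p * a , p * b) ∷ []) ⊗ g) (p * i) (p * j) ≡ coeff (((c , a , b) ∷ []) ⊗ π g) i j
    single c a b (inside i j) rewrite ℕ.*-distribˡ-+ p a i | ℕ.*-distribˡ-+ p b j = ≡.trans (monomial-coeff c (p * a) (p * b) g (p * i) (p * j))
      (≡.sym (≡.trans (monomial-coeff c a b (π g) i j) (≡.cong (c *_) (coeff-π g i j))))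
    single c a b (outside {i} {j} ≰) = ≡.trans (monomial-coeff-≰ c (p * a) (p * b) g (p * i) (p * j)
      λ (le , le′) → ≰ (ℕ.*-cancelˡ-≤ p le , ℕ.*-cancelˡ-≤ p le′)) (≡.sym (monomial-coeff-≰ c a b (π g) i j ≰))

  π-1 : π 1ₚ ≐ 1ₚ
  π-1 i j = ≡.trans (coeff-π 1ₚ i j) (≡.cong (_+ 0) (term-⇔ 1 0 0 (p * i) (p * j) 0 0 i j
    (λ e e′ → zero-factor i e , zero-factor j e′) (λ { ≡.refl ≡.refl → ≡.sym (ℕ.*-zeroʳ p) , ≡.sym (ℕ.*-zeroʳ p) })))
    where
    zero-factor : ∀ i → 0 ≡ p * i → 0 ≡ i
    zero-factor i e = ℕ.*-cancelˡ-≡ 0 i p (≡.trans (ℕ.*-zeroʳ p) e)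

  -- A vanishing derivative gives i c = 0 or j c = 0 modulo p for the coefficient c at (i, j). By
  -- Euclid's lemma c vanishes unless p divides both exponents, and those are the terms that survive
  -- φ after π.
  φ-π : ∀ f → PolyEq p (∂x f) 0ₚ → PolyEq p (∂y f) 0ₚ → PolyEq p f (φ (π f))
  φ-π f dx dy i j = go (exponent i j)
    where
    cancel : ∀ n c → ¬ p ℕ.∣ n → n * c ≅ 0 → c ≅ 0
    cancel n c p∤n e with euclidsLemma n c prime (≅0⇒∣ e)
    ... | inj₁ p∣n = ⊥-elim (p∤n p∣n)
    ... | inj₂ p∣c = ∣⇒≅0 p∣c
    x-part : ∀ i j → ¬ p ℕ.∣ i → coeff f i j ≅ 0
    x-part zero    j ∤ = ⊥-elim (∤ (p ℕ.∣0))
    x-part (suc i) j ∤ = cancel (suc i) (coeff f (suc i) j) ∤ (≅-resp (coeff-∂x f i j) ≡.refl (dx i j))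
    y-part : ∀ i j → ¬ p ℕ.∣ j → coeff f i j ≅ 0
    y-part i zero    ∤ = ⊥-elim (∤ (p ℕ.∣0))
    y-part i (suc j) ∤ = cancel (suc j) (coeff f i (suc j)) ∤ (≅-resp (coeff-∂y f i j) ≡.refl (dy i j))
    vanish : ∀ i j → ¬ (p ℕ.∣ i × p ℕ.∣ j) → Dec (p ℕ.∣ i) → coeff f i j ≅ 0
    vanish i j ∤ (yes p∣i) = y-part i j (λ p∣j → ∤ (p∣i , p∣j))
    vanish i j ∤ (no p∤i)  = x-part i j p∤i
    go : ∀ {i j} → Exponent i j → coeff f i j ≅ coeff (φ (π f)) i j
    go (multiples i j)    = ≅-reflexive (≡.sym (≡.trans (coeff-φ (π f) i j) (coeff-π f i j)))
    go (others {i} {j} ∤) = ≅-trans (coeff f i j) 0 _ (vanish i j ∤ (p ℕ.∣? i)) (≅-reflexive (≡.sym (coeff-φ-∤ (π f) i j ∤)))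

  open import Algebra.Definitions.RawSemiring
    (Semiring.rawSemiring (CommutativeRing.semiring polynomialRing)) using (_^_) renaming (_×_ to _⨯_)

  coeff-⨯ : ∀ n f i j → coeff (n ⨯ f) i j ≡ n * coeff f i j
  coeff-⨯ zero    f i j = ≡.refl
  coeff-⨯ (suc n) f i j = ≡.trans (coeff-++ f (n ⨯ f) i j) (≡.cong (coeff f i j +_) (coeff-⨯ n f i j))

  xₚ^ : ∀ n → xₚ ^ n ≡ (1 , n , 0) ∷ []
  xₚ^ zero    = ≡.refl
  xₚ^ (suc n) = ≡.cong (xₚ ⊗_) (xₚ^ n)

  yₚ^ : ∀ n → yₚ ^ n ≡ (1 , 0 , n) ∷ []
  yₚ^ zero    = ≡.refl
  yₚ^ (suc n) = ≡.cong (yₚ ⊗_) (yₚ^ n)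

  ≡⇒≈ : ∀ {f g} → f ≡ g → PolyEq p f g
  ≡⇒≈ {f} ≡.refl = ≈-refl f

  frobenius : Frobenius plane p
  frobenius = record
    { characteristic = λ f i j → ∣⇒≅0 (ℕ.∣-trans (ℕ.m∣m*n (coeff f i j)) (ℕ.∣-reflexive (≡.sym (coeff-⨯ p f i j))))
    ; ∂X = ∂x ; ∂Y = ∂y ; partial-X = partial-x ; partial-Y = partial-y
    ; ∂X-Y = λ i j → ≅-refl 0
    ; ∂Y-X = λ i j → ≅-refl 0
    ; φ = φ ; π = π
    ; φ-cong = λ {f} {g} → φ-cong {f} {g}
    ; φ-+ = concatMap-⊕ _
    ; φ-* = λ f g → ≐⇒≈ (φ (f ⊗ g)) (φ f ⊗ φ g) (φ-⊗ f g)
    ; φ-1 = ≡⇒≈ (≡.cong (λ n → (1 , n , n) ∷ []) (ℕ.*-zeroʳ p))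
    ; φ-X = ≡⇒≈ (≡.trans (≡.cong₂ (λ m n → (1 , m , n) ∷ []) (ℕ.*-identityʳ p) (ℕ.*-zeroʳ p)) (≡.sym (xₚ^ p)))
    ; φ-Y = ≡⇒≈ (≡.trans (≡.cong₂ (λ m n → (1 , m , n) ∷ []) (ℕ.*-zeroʳ p) (ℕ.*-identityʳ p)) (≡.sym (yₚ^ p)))
    ; π-cong = λ {f} {g} → π-cong {f} {g}
    ; π-φ* = λ f g → ≐⇒≈ (π (φ f ⊗ g)) (f ⊗ π g) (π-φ* f g)
    ; π-1 = ≐⇒≈ (π 1ₚ) 1ₚ π-1
    ; π-homog = λ {n} {f} h i j off → ≅-resp (≡.sym (coeff-π f i j)) ≡.refl
        (h (p * i) (p * j) λ e → off (ℕ.*-cancelˡ-≡ _ _ p (≡.trans (ℕ.*-distribˡ-+ p i j) e)))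
    ; π-homog-∤ = λ {d} {f} p∤d h i j → ≅-resp (≡.sym (coeff-π f i j)) ≡.refl
        (h (p * i) (p * j) λ e → p∤d (ℕ.∣-trans (ℕ.m∣m*n (i + j)) (ℕ.∣-reflexive (≡.trans (ℕ.*-distribˡ-+ p i j) e))))
    ; φ-π = λ {f} → φ-π f }

open import Data.Nat using (_^_)
open import Function.Bundles using (_⇔_; mk⇔)

-- Components and balls

dist-self : ∀ μ → dist μ μ ≡ 0
dist-self (a , b , c) = ≡.cong₂ _+_ (≡.cong₂ _+_ (ℕ.∣n-n∣≡0 a) (ℕ.∣n-n∣≡0 b)) (ℕ.∣n-n∣≡0 c)

data Towards (m n : ℕ) : Set where
  arrived : m ≡ n → Towards m n
  up      : ∣ m - n ∣ ≡ suc ∣ suc m - n ∣ → Towards m n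
  down    : ∀ {l} → m ≡ suc l → ∣ m - n ∣ ≡ suc ∣ l - n ∣ → Towards m n

towards : ∀ m n → Towards m n
towards zero    zero    = arrived ≡.refl
towards zero    (suc n) = up ≡.refl
towards (suc m) zero    = down ≡.refl (≡.cong suc (≡.sym (ℕ.∣-∣-identityʳ m)))
towards (suc m) (suc n) with towards m n
... | arrived e          = arrived (≡.cong suc e)
... | up e               = up e
... | down {l} ≡.refl e  = down ≡.refl e

-- Moving one coordinate towards that of ζ keeps it nonnegative, so the balls stay connected through
-- their centres even where they meet the boundary of Λ.
nearer : ∀ μ ζ → μ ≡ ζ ⊎ ∃[ ν ] Adjacent ν μ × dist μ ζ ≡ suc (dist ν ζ)
nearer (a , b , c) (a′ , b′ , c′) with towards a a′ | towards b b′ | towards c c′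
... | up e          | _             | _             = inj₂ (_ , inj₂ step₁ , ≡.cong (λ x → x + ∣ b - b′ ∣ + ∣ c - c′ ∣) e)
... | down ≡.refl e | _             | _             = inj₂ (_ , inj₁ step₁ , ≡.cong (λ x → x + ∣ b - b′ ∣ + ∣ c - c′ ∣) e)
... | arrived _     | up e          | _             = inj₂ (_ , inj₂ step₂ ,
        ≡.trans (≡.cong (λ x → ∣ a - a′ ∣ + x + ∣ c - c′ ∣) e) (≡.cong (_+ ∣ c - c′ ∣) (ℕ.+-suc ∣ a - a′ ∣ _)))
... | arrived _     | down ≡.refl e | _             = inj₂ (_ , inj₁ step₂ ,
        ≡.trans (≡.cong (λ x → ∣ a - a′ ∣ + x + ∣ c - c′ ∣) e) (≡.cong (_+ ∣ c - c′ ∣) (ℕ.+-suc ∣ a - a′ ∣ _)))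
... | arrived _     | arrived _     | up e          = inj₂ (_ , inj₂ step₃ ,
        ≡.trans (≡.cong (∣ a - a′ ∣ + ∣ b - b′ ∣ +_) e) (ℕ.+-suc _ _))
... | arrived _     | arrived _     | down ≡.refl e = inj₂ (_ , inj₁ step₃ ,
        ≡.trans (≡.cong (∣ a - a′ ∣ + ∣ b - b′ ∣ +_) e) (ℕ.+-suc _ _))
... | arrived e     | arrived e′    | arrived e″    = inj₁ (≡.cong₂ _,_ e (≡.cong₂ _,_ e′ e″))

∣suc-∣ : ∀ m n → ∣ suc m - n ∣ ≤ suc ∣ m - n ∣ × ∣ m - n ∣ ≤ suc ∣ suc m - n ∣
∣suc-∣ zero    zero    = ℕ.≤-refl , z≤n
∣suc-∣ (suc m) zero    = ℕ.≤-refl , ℕ.m≤n⇒m≤1+n (ℕ.n≤1+n _)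
∣suc-∣ zero    (suc n) = ℕ.m≤n⇒m≤1+n (ℕ.n≤1+n n) , ℕ.≤-refl
∣suc-∣ (suc m) (suc n) = ∣suc-∣ m n

dist-step : ∀ ζ {μ ν} → Step μ ν → dist ν ζ ≤ suc (dist μ ζ) × dist μ ζ ≤ suc (dist ν ζ)
dist-step (a′ , b′ , c′) (step₁ {a} {b} {c}) =
  let (le , ge) = ∣suc-∣ a a′ in ℕ.+-monoˡ-≤ ∣ c - c′ ∣ (ℕ.+-monoˡ-≤ ∣ b - b′ ∣ le) , ℕ.+-monoˡ-≤ ∣ c - c′ ∣ (ℕ.+-monoˡ-≤ ∣ b - b′ ∣ ge)
dist-step (a′ , b′ , c′) (step₂ {a} {b} {c}) = let (le , ge) = ∣suc-∣ b b′ in bound le , bound ge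
  where
  bound : ∀ {m n} → m ≤ suc n → ∣ a - a′ ∣ + m + ∣ c - c′ ∣ ≤ suc (∣ a - a′ ∣ + n + ∣ c - c′ ∣)
  bound le = ℕ.≤-trans (ℕ.+-monoˡ-≤ ∣ c - c′ ∣ (ℕ.+-monoʳ-≤ ∣ a - a′ ∣ le)) (ℕ.≤-reflexive (≡.cong (_+ ∣ c - c′ ∣) (ℕ.+-suc ∣ a - a′ ∣ _)))
dist-step (a′ , b′ , c′) (step₃ {a} {b} {c}) = let (le , ge) = ∣suc-∣ c c′ in bound le , bound ge
  where
  bound : ∀ {m n} → m ≤ suc n → ∣ a - a′ ∣ + ∣ b - b′ ∣ + m ≤ suc (∣ a - a′ ∣ + ∣ b - b′ ∣ + n)
  bound le = ℕ.≤-trans (ℕ.+-monoʳ-≤ (∣ a - a′ ∣ + ∣ b - b′ ∣) le) (ℕ.≤-reflexive (ℕ.+-suc _ _))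

dist-adjacent : ∀ ζ {μ ν} → Adjacent μ ν → dist ν ζ ≤ suc (dist μ ζ)
dist-adjacent ζ (inj₁ s) = proj₁ (dist-step ζ s)
dist-adjacent ζ (inj₂ s) = proj₂ (dist-step ζ s)

balanced-unscale : ∀ n .{{_ : NonZero n}} ν → Balanced (scale n ν) → Balanced ν
balanced-unscale n ν@(a , b , c) (ha , hb , hc) = cancel a ha , cancel b hb , cancel c hc
  where
  cancel : ∀ x → 2 * (n * x) ≤ ∣ scale n ν ∣ₘ → 2 * x ≤ ∣ ν ∣ₘ
  cancel x h = ℕ.*-cancelˡ-≤ n (ℕ.≤-trans (ℕ.≤-reflexive (≡.trans (≡.sym (ℕ.*-assoc n 2 x))
    (≡.trans (≡.cong (_* x) (ℕ.*-comm n 2)) (ℕ.*-assoc 2 n x)))) (ℕ.≤-trans h (ℕ.≤-reflexive (∣scale∣ n ν))))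

module Components (p : ℕ) (prime : Prime p) where
  open Instance p prime using (plane; frobenius)
  1<p : 1 < p
  1<p = ℕ.nonTrivial⇒n>1 p {{prime⇒nonTrivial prime}}
  module T = Descent plane p 1<p frobenius
  open T using (D; Basis; Low; Uneven; Peak; AdjacentLow)

  ^ₚ≡^ : ∀ f n → f ^ₚ n ≡ f T.^ n
  ^ₚ≡^ f zero    = ≡.refl
  ^ₚ≡^ f (suc n) = ≡.cong (f ⊗_) (^ₚ≡^ f n)

  InD⇒D : ∀ {μ θ} → InD p μ θ → D μ θ
  InD⇒D {a , b , c} {f , g} (d , _ , _) 0F = ≡.subst (InIdeal p f) (^ₚ≡^ xₚ a) d
  InD⇒D {a , b , c} {f , g} (_ , d , _) 1F = ≡.subst (InIdeal p g) (^ₚ≡^ yₚ b) d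
  InD⇒D {a , b , c} {f , g} (_ , _ , d) 2F = ≡.subst (InIdeal p (f ⊕ g)) (^ₚ≡^ x+yₚ c) d

  D⇒InD : ∀ {μ θ} → D μ θ → InD p μ θ
  D⇒InD {a , b , c} {f , g} d =
    ≡.subst (InIdeal p f) (≡.sym (^ₚ≡^ xₚ a)) (d 0F) ,
    ≡.subst (InIdeal p g) (≡.sym (^ₚ≡^ yₚ b)) (d 1F) ,
    ≡.subst (InIdeal p (f ⊕ g)) (≡.sym (^ₚ≡^ x+yₚ c)) (d 2F)

  exponents⇒basis : ∀ {μ d₁ d₂} → IsExponents p μ d₁ d₂ → Basis μ d₁ d₂
  exponents⇒basis (θ₁ , θ₂ , h₁ , h₂ , in₁ , in₂ , span , independent) = record
    { θ₁ = θ₁ ; θ₂ = θ₂ ; homog₁ = h₁ ; homog₂ = h₂ ; D₁ = InD⇒D in₁ ; D₂ = InD⇒D in₂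
    ; span = λ θ d → span θ (D⇒InD d) ; independent = independent }

  basis⇒exponents : ∀ {μ d₁ d₂} → Basis μ d₁ d₂ → IsExponents p μ d₁ d₂
  basis⇒exponents B = θ₁ , θ₂ , homog₁ , homog₂ , D⇒InD D₁ , D⇒InD D₂ , (λ θ d → span θ (InD⇒D d)) , independent
    where open Basis B

  posΔ⇒low : ∀ {μ} → PosΔ p μ → Low μ
  posΔ⇒low (d₁ , d₂ , e , d₁≢d₂) = T.uneven⇒low (d₁ , d₂ , exponents⇒basis e , d₁≢d₂)

  low⇒posΔ : ∀ {μ} → Low μ → PosΔ p μ
  low⇒posΔ L = let (d₁ , d₂ , B , d₁≢d₂) = T.low⇒uneven L in d₁ , d₂ , basis⇒exponents B , d₁≢d₂

  sameComponent : ∀ {μ ν} → Star AdjacentLow μ ν → SameComponent p μ ν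
  sameComponent = Star.map λ (adj , L , L′) → adj , low⇒posΔ L , low⇒posΔ L′

  sameComponent-sym : ∀ {μ ν} → SameComponent p μ ν → SameComponent p ν μ
  sameComponent-sym = Star.reverse λ (adj , P , P′) → Sum.swap adj , P′ , P

  module _ {ζ d} (K : Peak ζ d) {δ} (s : ∣ ζ ∣ₘ ≡ d + d + δ) where

    -- Walking towards the centre stays inside the ball, where every point carries a low multiple of
    -- θ.
    ball⇒component : ∀ n λ′ → dist λ′ ζ ≡ n → dist λ′ ζ < δ → SameComponent p ζ λ′
    ball⇒component n λ′ e near with nearer λ′ ζ
    ... | inj₁ ≡.refl = ε
    ball⇒component zero    λ′ e near | inj₂ (ν , adj , e′) = ⊥-elim (ℕ.0≢1+n (≡.trans (≡.sym e) e′))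
    ball⇒component (suc n) λ′ e near | inj₂ (ν , adj , e′) =
      ball⇒component n ν (ℕ.suc-injective (≡.trans (≡.sym e′) e)) near′
        ◅◅ (adj , low⇒posΔ (T.low-inside K ν s near′) , low⇒posΔ (T.low-inside K λ′ s near)) ◅ ε
      where
      near′ : dist ν ζ < δ
      near′ = ℕ.<-trans (ℕ.≤-reflexive (≡.sym e′)) near

    -- One step changes the distance to ζ by at most 1, so a path leaving the ball would visit a
    -- point at distance exactly δ, and there Δ = 0.
    component⇒ball : ∀ {μ λ′} → SameComponent p μ λ′ → dist μ ζ < δ → dist λ′ ζ < δ
    component⇒ball ε near = near
    component⇒ball (_◅_ {j = ν} (adj , _ , P) path) near = component⇒ball path
      (ℕ.≤∧≢⇒< (ℕ.≤-trans (dist-adjacent ζ adj) near) λ far → T.not-low-boundary K ν s far (posΔ⇒low P))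

  peak-in-component : ∀ {μ} → Low μ → (∀ ν → SameComponent p μ ν → Balanced ν) →
                      ∃[ ζ ] ∃[ d ] SameComponent p μ ζ × Peak ζ d
  peak-in-component {μ} L@(d , _) balanced =
    -- With fuel 3 d + 1 the bound 3 d < |μ| + fuel holds whatever |μ| is.
    let (ζ , d , path , K) = T.ascend (suc (d + d + d)) L (ℕ.m≤n+m _ ∣ μ ∣ₘ) (λ ν path → balanced ν (sameComponent path))
    in ζ , d , sameComponent path , K

  component-ball : ∀ {μ} → (∀ ν → SameComponent p μ ν → Balanced ν) → ∃[ ζ ] ∃[ d ] SameComponent p μ ζ × Peak ζ d →
    ∃[ k ] ∃[ ν ] BalOdd ν × (∀ λ′ → SameComponent p μ λ′ ⇔ InBall (scale (p ^ k) ν) (p ^ k) λ′)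
  component-ball {μ} balanced (ζ , d , μ~ζ , K) = conclude (T.peak-shape δ ℕ.≤-refl s K)
    where
    δ = ∣ ζ ∣ₘ ∸ (d + d)
    s : ∣ ζ ∣ₘ ≡ d + d + δ
    s = ≡.sym (ℕ.m+[n∸m]≡n (ℕ.<⇒≤ (T.Peak.low K)))
    0<δ : dist ζ ζ < δ
    0<δ = ≡.subst (_< δ) (≡.sym (dist-self ζ)) (ℕ.m<n⇒0<n∸m (T.Peak.low K))
    conclude : ∃[ k ] ∃[ ν ] ζ ≡ scale (p ^ k) ν × Odd ∣ ν ∣ₘ × δ ≡ p ^ k →
      ∃[ k ] ∃[ ν ] BalOdd ν × (∀ λ′ → SameComponent p μ λ′ ⇔ InBall (scale (p ^ k) ν) (p ^ k) λ′)
    conclude (k , ν , ζ≡ , odd , δ≡) = k , ν ,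
      -- The peak lies in the component of μ, hence is balanced, and balancedness is homogeneous, so
      -- it passes to ν.
      (balanced-unscale (p ^ k) {{ℕ.m^n≢0 p k {{prime⇒nonZero prime}}}} ν (≡.subst Balanced ζ≡ (balanced ζ μ~ζ)) , odd) ,
      λ λ′ → mk⇔
        (λ μ~λ → ≡.subst₂ (λ ζ r → InBall ζ r λ′) ζ≡ δ≡ (component⇒ball K s (sameComponent-sym μ~ζ ◅◅ μ~λ) 0<δ))
        (λ near → μ~ζ ◅◅ ball⇒component K s (dist λ′ ζ) λ′ ≡.refl (≡.subst₂ (λ ζ r → InBall ζ r λ′) (≡.sym ζ≡) (≡.sym δ≡) near))

theorem3p1 : (p : ℕ) → Prime p → (μ : Mult) → PosΔ p μ →
    (∀ ν → SameComponent p μ ν → Balanced ν) →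
    ∃[ k ] ∃[ ν ] BalOdd ν ×
    (∀ λ' → SameComponent p μ λ' ⇔ InBall (scale (p ^ k) ν) (p ^ k) λ')
theorem3p1 p p-prime μ P balanced = component-ball balanced (peak-in-component (posΔ⇒low P) balanced)
  where open Components p p-prime
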